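{- The \textsc{Spanner} problem (given a connected undirected graph $G=(V,E)$ with edge weights $w\colon E\to\mathbb{N}_{\ge0}$, edge lengths $\ell\colon E\to\mathbb{N}_{\ge1}$, a stretch factor $\alpha\ge1$ and a weight bound $W\in\mathbb{N}$, is there an $\alpha$-spanner $H=(V,F)$ of $G$ with $\sum_{e\in F}w(e)\le W$?) parameterized by $W$ is $\mathbf{W[2]}$-hard, even when restricted to unit-length instances ($\ell(e)=1$ for all $e\in E$) on bipartite graphs with constant $\alpha$ and only three distinct edge weights.
   Context: For a subgraph $G'\subseteq G$ and $u,v\in V$, $\ell_{G'}[u,v]$ is the length of a shortest $u$-$v$-path in $G'$ w.r.t. $\ell$. A subgraph $H=(V,F)$, $F\subseteq E$, is an $\alpha$-spanner of $G$ if $\ell_H[u,v]\le\alpha\,\ell_G[u,v]$ for all $u,v\in V$; equivalently, for all $\{u,v\}\in E$. $\mathbf{W[2]}$-hardness is meant w.r.t. parameterized (FPT) reductions. "Three distinct weights" means that in each instance $w$ attains only three distinct values (the values may depend on the instance). -}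

module Defs where

open import Data.Bool using (Bool; if_then_else_)
open import Data.Fin as Fin using (Fin; toℕ)
open import Data.Fin.Subset using (Subset; _∈_; ⊤)
open import Data.Integer using (+_; ∣_∣)
open import Data.List as List using (List; []; _∷_; foldr)
open import Data.List.Membership.Propositional using () renaming (_∈_ to _∈ˡ_)
open import Data.List.Relation.Unary.Unique.Propositional using (Unique)
open import Data.Nat using (ℕ; zero; suc; _+_; _*_; _^_; _≤_)
open import Data.Nat.Binary using (ℕᵇ; 2[1+_]; 1+[2_]; fromℕ) renaming (zero to 0ᵇ)
open import Data.Product using (Σ; Σ-syntax; ∃; ∃-syntax; _×_; _,_; proj₁)
open import Data.Rational as ℚ using (ℚ; 1ℚ; ↥_; ↧ₙ_)
open import Data.Sum using (_⊎_)
open import Data.Vec as Vec using (Vec; _++_; lookup)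
open import Function using (_∘_; _⇔_)
open import Relation.Binary.PropositionalEquality using (_≡_; _≢_)
open import Relation.Nullary using (¬_)

infix  4 _≤fpt_
infixr 5 _∙_
infixr 9 _⨾_
infix  0 ifₚ_then_else_ while_loop_

------------------------------------------------------------------------
-- Computation: a first-order WHILE language over binary trees (in the
-- style of N. Jones, "Computability and Complexity", 1997).

data Tree : Set where
  nil : Tree
  _∙_ : Tree → Tree → Tree

size : Tree → ℕ
size nil     = 1
size (s ∙ t) = suc (size s + size t)

head tail : Tree → Tree
head nil     = nil
head (s ∙ t) = s
tail nil     = nil
tail (s ∙ t) = t

data Prog : Set where
  idₚ nilₚ headₚ tailₚ : Prog
  ⟨_,_⟩                : Prog → Prog → Prog
  _⨾_                  : Prog → Prog → Prog
  ifₚ_then_else_       : Prog → Prog → Prog → Prog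
  while_loop_          : Prog → Prog → Prog

-- Run p x y t: on input x, program p halts with output y after t steps.
-- Every instruction is charged the full size of the tree it reads or copies
-- (nothing is shared), so t is at least the size of the output, and t is
-- polynomially related to the running time of a Turing machine.
-- A condition counts as false exactly if it evaluates to nil.

data Run : Prog → Tree → Tree → ℕ → Set where
  run-id   : ∀ {x} → Run idₚ   x x        (size x)
  run-nil  : ∀ {x} → Run nilₚ  x nil      (size x)
  run-head : ∀ {x} → Run headₚ x (head x) (size x)
  run-tail : ∀ {x} → Run tailₚ x (tail x) (size x)
  run-pair : ∀ {p q x y z s t} → Run p x y s → Run q x z t →
             Run ⟨ p , q ⟩ x (y ∙ z) (size x + s + t)
  run-seq  : ∀ {p q x y z s t} → Run p x y s → Run q y z t →
             Run (p ⨾ q) x z (s + t)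
  run-then : ∀ {c p q x b y s t} → Run c x b s → b ≢ nil → Run p x y t →
             Run (ifₚ c then p else q) x y (size x + s + t)
  run-else : ∀ {c p q x y s t} → Run c x nil s → Run q x y t →
             Run (ifₚ c then p else q) x y (size x + s + t)
  run-stop : ∀ {c p x s} → Run c x nil s →
             Run (while c loop p) x x (size x + s)
  run-loop : ∀ {c p x b y z s t u} → Run c x b s → b ≢ nil → Run p x y t →
             Run (while c loop p) y z u →
             Run (while c loop p) x z (size x + s + t + u)

codeList : {A : Set} → (A → Tree) → List A → Tree
codeList code = foldr (λ a t → code a ∙ t) nil

unary : ℕ → Tree
unary zero    = nil
unary (suc n) = nil ∙ unary n

codeFin : ∀ {n} → Fin n → Tree
codeFin = unary ∘ toℕ

-- Bijective base 2, least significant digit first.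
codeℕᵇ : ℕᵇ → Tree
codeℕᵇ 0ᵇ       = nil
codeℕᵇ 2[1+ b ] = (nil ∙ nil) ∙ codeℕᵇ b
codeℕᵇ 1+[2 b ] = nil ∙ codeℕᵇ b

binary : ℕ → Tree
binary = codeℕᵇ ∘ fromℕ

Computable : (ℕ → ℕ) → Set
Computable f = ∃[ p ] (∀ n → ∃[ t ] Run p (unary n) (unary (f n)) t)

------------------------------------------------------------------------
-- Parameterized problems and fpt-reductions

-- As in the view of a parameterized problem as a subset of Σ* × ℕ, an
-- algorithm receives the code of an instance together with its parameter in
-- unary; `code` covers the part of the instance other than the parameter.

record ParamProblem : Set₁ where
  field
    Instance : Set
    code     : Instance → Tree
    param    : Instance → ℕ
    Yes      : Instance → Set

  input : Instance → Tree
  input x = code x ∙ unary (param x)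

record _≤fpt_ (P Q : ParamProblem) : Set where
  private
    module P = ParamProblem P
    module Q = ParamProblem Q
  field
    reduce  : P.Instance → Q.Instance
    correct : ∀ x → P.Yes x ⇔ Q.Yes (reduce x)

    bound            : ℕ → ℕ
    bound-computable : Computable bound
    param-bounded    : ∀ x → Q.param (reduce x) ≤ bound (P.param x)

    program         : Prog
    time            : ℕ → ℕ
    time-computable : Computable time
    degree          : ℕ
    runs            : ∀ x → ∃[ t ] (Run program (P.input x) (Q.input (reduce x)) t
                        × t ≤ time (P.param x) * size (P.input x) ^ degree)

-- A reduction to `restrict Q R` only produces instances satisfying R.
restrict : (Q : ParamProblem) → (ParamProblem.Instance Q → Set) → ParamProblem
restrict Q R = record
  { Instance = Σ Q.Instance R
  ; code     = Q.code ∘ proj₁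
  ; param    = Q.param ∘ proj₁
  ; Yes      = Q.Yes ∘ proj₁
  } where module Q = ParamProblem Q

------------------------------------------------------------------------
-- The class W[2], following Flum and Grohe, "Parameterized Complexity
-- Theory" (2006): W[t] is the closure under fpt-reductions of the weighted
-- Fagin-definable problems p-WD_φ with φ(X) a Π_t formula of first-order logic.

-- A finite relational vocabulary, given by the arities of its symbols.
Vocabulary : Set
Vocabulary = List ℕ

Symbol : Vocabulary → Set
Symbol τ = Fin (List.length τ)

arity : (τ : Vocabulary) → Symbol τ → ℕ
arity = List.lookup

-- The universe of a structure is nonempty.
record Structure (τ : Vocabulary) : Set where
  field
    pred-size : ℕ

  Universe : Set
  Universe = Fin (suc pred-size)

  field
    relation : (R : Symbol τ) → List (Vec Universe (arity τ R))

codeStructure : ∀ {τ} → Structure τ → Tree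
codeStructure {τ} A =
  unary (suc pred-size)
    ∙ codeList (λ t → t) (List.tabulate (λ (R : Symbol τ) → codeList codeTuple (relation R)))
  where
  open Structure A
  codeTuple : ∀ {r} → Vec Universe r → Tree
  codeTuple = codeList codeFin ∘ Vec.toList

-- Quantifier-free formulas with v individual variables and a free relation
-- variable X of arity s.
data QF (τ : Vocabulary) (s v : ℕ) : Set where
  relₐ     : (R : Symbol τ) → Vec (Fin v) (arity τ R) → QF τ s v
  eqₐ      : Fin v → Fin v → QF τ s v
  Xₐ       : Vec (Fin v) s → QF τ s v
  notₐ     : QF τ s v → QF τ s v
  andₐ orₐ : QF τ s v → QF τ s v → QF τ s v

-- ∀ x₁ … x_p ∃ y₁ … y_q. matrix
record Π₂ (τ : Vocabulary) (s : ℕ) : Set where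
  field
    p q    : ℕ
    matrix : QF τ s (p + q)

module _ {τ : Vocabulary} {s : ℕ} (A : Structure τ) where
  open Structure A

  holds : ∀ {v} → QF τ s v → List (Vec Universe s) → Vec Universe v → Set
  holds (relₐ R xs) S ρ = Vec.map (lookup ρ) xs ∈ˡ relation R
  holds (eqₐ x y)   S ρ = lookup ρ x ≡ lookup ρ y
  holds (Xₐ xs)     S ρ = Vec.map (lookup ρ) xs ∈ˡ S
  holds (notₐ φ)    S ρ = ¬ holds φ S ρ
  holds (andₐ φ ψ)  S ρ = holds φ S ρ × holds ψ S ρ
  holds (orₐ φ ψ)   S ρ = holds φ S ρ ⊎ holds ψ S ρ

  Satisfies : Π₂ τ s → List (Vec Universe s) → Set
  Satisfies φ S = ∀ (xs : Vec Universe p) → ∃[ ys ] holds matrix S (xs ++ ys)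
    where open Π₂ φ

-- Given A and k, is there a relation S ⊆ Aˢ with |S| = k and A ⊨ φ(S)?
p-WD : ∀ {τ s} → Π₂ τ s → ParamProblem
p-WD {τ} φ = record
  { Instance = Structure τ × ℕ
  ; code     = λ (A , k) → codeStructure A
  ; param    = λ (A , k) → k
  ; Yes      = λ (A , k) → ∃[ S ] (Unique S × List.length S ≡ k × Satisfies A φ S)
  }

W[2] : ParamProblem → Set
W[2] P = Σ[ τ ∈ Vocabulary ] Σ[ s ∈ ℕ ] Σ[ φ ∈ Π₂ τ s ] P ≤fpt p-WD φ

W[2]-Hard : ParamProblem → Set₁
W[2]-Hard Q = ∀ P → W[2] P → P ≤fpt Q

------------------------------------------------------------------------
-- Graphs and spanners

-- A finite simple undirected graph with weighted edges of positive length: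
-- edge e joins src e and tgt e, where the orientation src e < tgt e is only
-- there to represent the two-element set {src e, tgt e} uniquely.
record Graph : Set where
  field
    n m     : ℕ
    src     : Fin m → Fin n
    tgt     : Fin m → Fin n
    src<tgt : ∀ e → src e Fin.< tgt e
    simple  : ∀ e f → src e ≡ src f → tgt e ≡ tgt f → e ≡ f
    w       : Fin m → ℕ
    ℓ       : Fin m → ℕ
    ℓ≥1     : ∀ e → 1 ≤ ℓ e

  V E : Set
  V = Fin n
  E = Fin m

  Joins : E → V → V → Set
  Joins e u v = (src e ≡ u × tgt e ≡ v) ⊎ (src e ≡ v × tgt e ≡ u)

  -- Walks in the subgraph (V, F).
  data Walk (F : Subset m) : V → V → Set where
    stop : ∀ {u} → Walk F u u
    step : ∀ {u v z} (e : E) → e ∈ F → Joins e u v → Walk F v z → Walk F u z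

  vertices : ∀ {F u v} → Walk F u v → List V
  vertices {u = u} stop           = u ∷ []
  vertices {u = u} (step _ _ _ W) = u ∷ vertices W

  walkLength : ∀ {F u v} → Walk F u v → ℕ
  walkLength stop           = 0
  walkLength (step e _ _ W) = ℓ e + walkLength W

  Path : Subset m → V → V → Set
  Path F u v = Σ[ W ∈ Walk F u v ] Unique (vertices W)

  pathLength : ∀ {F u v} → Path F u v → ℕ
  pathLength (W , _) = walkLength W

  -- ℓ_{(V,F)}[u,v] = d; no such d exists if F does not connect u and v.
  IsDist : Subset m → V → V → ℕ → Set
  IsDist F u v d = (∃[ P ] pathLength {F} {u} {v} P ≡ d)
                 × (∀ (P : Path F u v) → d ≤ pathLength P)

  Connected : Set
  Connected = ∀ u v → Path ⊤ u v

  Bipartite : Set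
  Bipartite = Σ[ side ∈ (V → Bool) ] (∀ e → side (src e) ≢ side (tgt e))

  IsSpanner : ℚ → Subset m → Set
  IsSpanner α F = ∀ u v d → IsDist ⊤ u v d →
    ∃[ d′ ] (IsDist F u v d′ × (+ d′ ℚ./ 1) ℚ.≤ α ℚ.* (+ d ℚ./ 1))

  weight : Subset m → ℕ
  weight F = List.sum (List.tabulate (λ e → if lookup F e then w e else 0))

record SpannerInstance : Set where
  field
    graph     : Graph
    connected : Graph.Connected graph
    α         : ℚ
    α≥1       : 1ℚ ℚ.≤ α
    W         : ℕ

  open Graph graph public

Spanner : ParamProblem
Spanner = record
  { Instance = SpannerInstance
  ; code     = code
  ; param    = SpannerInstance.W
  ; Yes      = λ I → let open SpannerInstance I in
                 ∃[ F ] (IsSpanner α F × weight F ≤ W)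
  }
  where
  code : SpannerInstance → Tree
  code I = unary n ∙ codeList codeEdge (List.allFin m) ∙ binary ∣ ↥ α ∣ ∙ binary (↧ₙ α)
    where
    open SpannerInstance I
    codeEdge : E → Tree
    codeEdge e = codeFin (src e) ∙ codeFin (tgt e) ∙ binary (w e) ∙ binary (ℓ e)

module _ (I : SpannerInstance) where
  open SpannerInstance I

  UnitLength : Set
  UnitLength = ∀ e → ℓ e ≡ 1

  AtMostThreeWeights : Set
  AtMostThreeWeights = ∃[ a ] ∃[ b ] ∃[ c ] (∀ e → w e ≡ a ⊎ w e ≡ b ⊎ w e ≡ c)

-- Unit-length instances on bipartite graphs with stretch factor α₀ and only
-- three distinct edge weights.
Restricted : ℚ → SpannerInstance → Set
Restricted α₀ I = UnitLength I
                × Graph.Bipartite (SpannerInstance.graph I)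
                × SpannerInstance.α I ≡ α₀
                × AtMostThreeWeights I

{-# OPTIONS --safe #-}
-- A solution S of an instance (A , k) of the weighted Fagin-definable problem is a set of k tuples,
-- which we encode as a chain: an increasing map σ from {0, …, k+1} to ranks of tuples.  The membership
-- of a tuple in S is certified by one value of σ, its non-membership by two consecutive values, so a
-- formula with c occurrences of X is certified by 2c values.  A hitting set instance has as elements
-- the partial graphs of potential chains with d = 2c+1 points; the (k+2)^d slots (tuples of indices),
-- as many as the parameter, are each hit exactly once.  Clauses force the selected partial graphs to be
-- compatible, hence to come from a single chain, and to certify the formula at every tuple x.
-- Finally a hitting set instance becomes a 3-spanner instance on vertices root, hub, elements and
-- clauses: the edge hub–clause is too expensive to be bought, so it needs the detour
-- hub–root–element–clause, for which the edge root–element of weight 1 has to be bought.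
module Submission where

-- The obstacle is non-membership. A hitting set clause is a monotone disjunction over elements, so
-- each literal of the matrix has to be confirmed by something selected whose size depends on the
-- formula only. In an unordered set, refuting `t ∈ S` involves all k members; in a sorted one the
-- two neighbours of t suffice, which keeps the candidates polynomial in number, with an exponent
-- fixed by φ. The existential quantifiers cost nothing, because a clause is itself a disjunction:
-- it contains a partial graph as soon as this certifies the matrix for some y.
--
-- Having at most one element per slot is not monotone either, so it comes from counting: every slot
-- has to be hit, and the budget allows no second element anywhere. Then "e is not selected" turns
-- into the positive statement "some other element with the slot of e is selected", and the
-- implication "if e is selected, then so is something compatible in slot J" becomes a clause.
--
-- In the graph an unbought edge root-e also needs a detour. It is root-f-c-e for a clause c that
-- contains e and a selected f in c, so every element has to lie in some clause.

open import Defs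

-- Polynomial-time functions on coded data and their closure properties.

module PolynomialTime where

  open import Data.Bool using (Bool; true; false; if_then_else_)
  open import Data.List using (List; []; _∷_; length; foldl)
  open import Data.Nat
  open import Data.Nat.Properties
  open import Data.Product using (∃-syntax; _×_; _,_; proj₁; proj₂)
  open import Data.Unit using (tt) renaming (⊤ to 𝟙)
  open import Data.Vec as Vec using (Vec)
  open import Function using (_∘_; id)
  open import Relation.Binary.PropositionalEquality
  open import Data.Nat.Tactic.RingSolver using (solve-∀)

  size≥1 : ∀ x → 1 ≤ size x
  size≥1 nil     = ≤-refl
  size≥1 (_ ∙ _) = s≤s z≤n

  head-size : ∀ x → size (head x) ≤ size x
  head-size nil     = ≤-refl
  head-size (s ∙ t) = m≤n⇒m≤1+n (m≤m+n _ _)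

  tail-size : ∀ x → size (tail x) ≤ size x
  tail-size nil     = ≤-refl
  tail-size (s ∙ t) = m≤n⇒m≤1+n (m≤n+m _ _)

  -- Every instruction is charged at least the size of what it produces. A program that runs next
  -- therefore has an input bounded by the time already spent, which is what makes running times
  -- compose.
  output-size : ∀ {p x y t} → Run p x y t → size y ≤ t
  output-size run-id   = ≤-refl
  output-size {x = x} run-nil  = size≥1 x
  output-size {x = x} run-head = head-size x
  output-size {x = x} run-tail = tail-size x
  output-size {x = x} (run-pair r r′) =
    +-mono-≤ (+-mono-≤ (size≥1 x) (output-size r)) (output-size r′)
  output-size (run-seq r r′)      = m≤n⇒m≤o+n _ (output-size r′)
  output-size (run-then _ _ r)    = m≤n⇒m≤o+n _ (output-size r)
  output-size (run-else _ r)      = m≤n⇒m≤o+n _ (output-size r)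
  output-size (run-stop _)        = m≤m+n _ _
  output-size (run-loop _ _ _ r)  = m≤n⇒m≤o+n _ (output-size r)

  infixr 4 _⊗_

  data Ty : Set where
    unit bool nat : Ty
    list          : Ty → Ty
    vec           : Ty → ℕ → Ty
    _⊗_           : Ty → Ty → Ty

  ⟦_⟧ : Ty → Set
  ⟦ unit ⟧    = 𝟙
  ⟦ bool ⟧    = Bool
  ⟦ nat ⟧     = ℕ
  ⟦ list a ⟧  = List ⟦ a ⟧
  ⟦ vec a n ⟧ = Vec ⟦ a ⟧ n
  ⟦ a ⊗ b ⟧   = ⟦ a ⟧ × ⟦ b ⟧

  enc : ∀ a → ⟦ a ⟧ → Tree
  enc unit      _       = nil
  enc bool      b       = if b then nil ∙ nil else nil
  enc nat       n       = unary n
  enc (list a)  xs      = codeList (enc a) xs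
  enc (vec a n) xs      = codeList (enc a) (Vec.toList xs)
  enc (a ⊗ b)   (x , y) = enc a x ∙ enc b y

  -- There is no constant factor: sizes are at least 1, so the base is at least 2, and constants and
  -- sums disappear into the exponent.
  record Poly {a b : Ty} (f : ⟦ a ⟧ → ⟦ b ⟧) : Set where
    field
      program : Prog
      degree  : ℕ
      runs    : ∀ x → ∃[ t ] (Run program (enc a x) (enc b (f x)) t
                  × t ≤ suc (size (enc a x)) ^ degree)

  module _ {a : ℕ} (2≤a : 2 ≤ a) where

    private instance
      a≢0 : NonZero a
      a≢0 = >-nonZero (≤-trans (s≤s z≤n) 2≤a)

    linear-bound : ∀ {x} → x ≤ a → x ≤ a ^ 1
    linear-bound x≤a = ≤-trans x≤a (≤-reflexive (sym (^-identityʳ a)))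

    const-bound : ∀ {x} → x ≤ 1 → x ≤ a ^ 0
    const-bound x≤a = x≤a

    -- Both summands are at most `a ^ (m + n)`, and doubling costs one more factor, as `2 ≤ a`.
    sum-bound : ∀ {x y m n} → x ≤ a ^ m → y ≤ a ^ n → x + y ≤ a ^ suc (m + n)
    sum-bound {x} {y} {m} {n} p q = begin
      x + y                     ≤⟨ +-mono-≤ (≤-trans p (^-monoʳ-≤ a (m≤m+n m n)))
                                            (≤-trans q (^-monoʳ-≤ a (m≤n+m n m))) ⟩
      a ^ (m + n) + a ^ (m + n) ≡⟨ cong (a ^ (m + n) +_) (sym (+-identityʳ _)) ⟩
      2 * a ^ (m + n)           ≤⟨ *-monoˡ-≤ _ 2≤a ⟩
      a ^ suc (m + n)           ∎
      where open ≤-Reasoning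

    suc-bound : ∀ {x m} → x ≤ a ^ m → suc x ≤ a ^ suc m
    suc-bound {x} {m} = sum-bound {1} {x} {0} {m} (const-bound ≤-refl)

    product-bound : ∀ {x y m n} → x ≤ a ^ m → y ≤ a ^ n → x * y ≤ a ^ (m + n)
    product-bound {m = m} {n} p q = ≤-trans (*-mono-≤ p q) (≤-reflexive (sym (^-distribˡ-+-* a m n)))

    power-bound : ∀ {x m} n → x ≤ a ^ m → x ^ n ≤ a ^ (m * n)
    power-bound {m = m} n p = ≤-trans (^-monoˡ-≤ n p) (≤-reflexive (^-*-assoc a m n))

    -- Matches the bound of `iterate` for `K` equal to `a ^ d`: `suc l` rounds, each paying `K`
    -- three times for the loop and its test, and `suc K ^ e` for the body.
    loop-bound : ∀ {l} d e → suc l ≤ a →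
      suc l * (a ^ d + (a ^ d + a ^ d) + suc (a ^ d) ^ e)
        ≤ a ^ (1 + suc (suc (d + suc (d + d)) + suc d * e))
    loop-bound {l} d e l≤a =
      product-bound {suc l} {T + suc K ^ e} {1} {suc (suc (d + suc (d + d)) + suc d * e)} (linear-bound l≤a)
        (sum-bound {T} {suc K ^ e} {suc (d + suc (d + d))} {suc d * e}
          (sum-bound {K} {K + K} {d} {suc (d + d)} ≤-refl (sum-bound {K} {K} {d} {d} ≤-refl ≤-refl))
          (power-bound {suc K} {suc d} e (suc-bound {K} {d} ≤-refl)))
      where
      K T : ℕ
      K = a ^ d
      T = K + (K + K)

    state-bound : ∀ {s l} e → s ≤ a → l ≤ a → s + l * a ^ e ≤ a ^ suc (1 + (1 + e))
    state-bound {s} {l} e s≤a l≤a = sum-bound {s} {l * a ^ e} {1} {1 + e} (linear-bound s≤a)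
      (product-bound {l} {a ^ e} {1} {e} (linear-bound l≤a) ≤-refl)

  2≤1+size : ∀ x → 2 ≤ suc (size x)
  2≤1+size x = s≤s (size≥1 x)

  size-bound : ∀ x → size x ≤ suc (size x) ^ 1
  size-bound x = linear-bound (2≤1+size x) (n≤1+n _)

  private variable
    a b c Γ : Ty

  module _ {f : ⟦ a ⟧ → ⟦ b ⟧} where
    Poly-cong : {g : ⟦ a ⟧ → ⟦ b ⟧} → (∀ x → f x ≡ g x) → Poly {a} {b} f → Poly {a} {b} g
    Poly-cong f≗g P = record
      { program = program ; degree = degree
      ; runs = λ x → subst (λ y → ∃[ t ] (Run program (enc a x) (enc b y) t × _)) (f≗g x) (runs x) }
      where open Poly P

  primitiveP : {f : ⟦ a ⟧ → ⟦ b ⟧} (p : Prog) →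
               (∀ x → Run p (enc a x) (enc b (f x)) (size (enc a x))) → Poly {a} {b} f
  primitiveP p r = record
    { program = p ; degree = 1 ; runs = λ x → _ , r x , size-bound _ }

  idP : Poly {a} {a} id
  idP = primitiveP idₚ (λ _ → run-id)

  fstP : Poly {a ⊗ b} {a} proj₁
  fstP = primitiveP headₚ (λ _ → run-head)

  sndP : Poly {a ⊗ b} {b} proj₂
  sndP = primitiveP tailₚ (λ _ → run-tail)

  nilP : Poly {Γ} {list a} (λ _ → [])
  nilP = primitiveP nilₚ (λ _ → run-nil)

  vnilP : Poly {Γ} {vec a 0} (λ _ → Vec.[])
  vnilP = primitiveP nilₚ (λ _ → run-nil)

  unitP : Poly {Γ} {unit} (λ _ → tt)
  unitP = primitiveP nilₚ (λ _ → run-nil)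

  falseP : Poly {Γ} {bool} (λ _ → false)
  falseP = primitiveP nilₚ (λ _ → run-nil)

  zeroP : Poly {Γ} {nat} (λ _ → 0)
  zeroP = primitiveP nilₚ (λ _ → run-nil)

  infixr 9 _∘P_

  _∘P_ : {f : ⟦ a ⟧ → ⟦ b ⟧} {g : ⟦ b ⟧ → ⟦ c ⟧} →
         Poly {b} {c} g → Poly {a} {b} f → Poly {a} {c} (g ∘ f)
  _∘P_ {f = f} Q P = record
    { program = P.program ⨾ Q.program
    ; degree  = suc (P.degree + suc P.degree * Q.degree)
    ; runs    = λ x →
        let s , r , s≤ = P.runs x
            t , r′ , t≤ = Q.runs (f x)
            2≤ = 2≤1+size (enc _ x)
            size≤ = suc-bound 2≤ {m = P.degree} (≤-trans (output-size r) s≤)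
        in s + t , run-seq r r′ ,
           sum-bound 2≤ {m = P.degree} {suc P.degree * Q.degree} s≤
             (≤-trans t≤ (power-bound 2≤ {m = suc P.degree} Q.degree size≤)) }
    where
    module P = Poly P
    module Q = Poly Q

  pairP : {f : ⟦ Γ ⟧ → ⟦ a ⟧} {g : ⟦ Γ ⟧ → ⟦ b ⟧} →
          Poly {Γ} {a} f → Poly {Γ} {b} g → Poly {Γ} {a ⊗ b} (λ x → f x , g x)
  pairP P Q = record
    { program = ⟨ P.program , Q.program ⟩
    ; degree  = suc (suc (1 + P.degree) + Q.degree)
    ; runs    = λ x →
        let s , r , s≤ = P.runs x
            t , r′ , t≤ = Q.runs x
            2≤ = 2≤1+size (enc _ x)
        in _ , run-pair r r′ ,
           sum-bound 2≤ {m = suc (1 + P.degree)} {Q.degree}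
             (sum-bound 2≤ {m = 1} {P.degree} (size-bound (enc _ x)) s≤) t≤ }
    where
    module P = Poly P
    module Q = Poly Q

  ifP : {f : ⟦ Γ ⟧ → Bool} {g h : ⟦ Γ ⟧ → ⟦ a ⟧} →
        Poly {Γ} {bool} f → Poly {Γ} {a} g → Poly {Γ} {a} h →
        Poly {Γ} {a} (λ x → if f x then g x else h x)
  ifP {Γ = Γ} {a = a} {f} {g} {h} P Q R = record
    { program = ifₚ P.program then Q.program else R.program
    ; degree  = suc (suc (1 + P.degree) + (Q.degree + R.degree))
    ; runs    = λ x → branch x (f x) refl }
    where
    module P = Poly P
    module Q = Poly Q
    module R = Poly R
    branch : ∀ x b → f x ≡ b → ∃[ t ] (Run (ifₚ P.program then Q.program else R.program)
               (enc Γ x) (enc a (if b then g x else h x)) t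
               × t ≤ suc (size (enc Γ x)) ^ suc (suc (1 + P.degree) + (Q.degree + R.degree)))
    branch x b fx≡b with P.runs x
    branch x true fx≡b | s , r , s≤ =
        let t , r′ , t≤ = Q.runs x
            2≤ = 2≤1+size (enc Γ x)
        in _ , run-then (subst (λ v → Run P.program (enc Γ x) (enc bool v) s) fx≡b r) (λ ()) r′ ,
           sum-bound 2≤ {m = suc (1 + P.degree)} {Q.degree + R.degree}
             (sum-bound 2≤ {m = 1} {P.degree} (size-bound (enc Γ x)) s≤)
             (≤-trans t≤ (^-monoʳ-≤ (suc (size (enc Γ x))) (m≤m+n Q.degree R.degree)))
    branch x false fx≡b | s , r , s≤ =
        let t , r′ , t≤ = R.runs x
            2≤ = 2≤1+size (enc Γ x)
        in _ , run-else (subst (λ v → Run P.program (enc Γ x) (enc bool v) s) fx≡b r) r′ ,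
           sum-bound 2≤ {m = suc (1 + P.degree)} {Q.degree + R.degree}
             (sum-bound 2≤ {m = 1} {P.degree} (size-bound (enc Γ x)) s≤)
             (≤-trans t≤ (^-monoʳ-≤ (suc (size (enc Γ x))) (m≤n+m R.degree Q.degree)))

  length≤size : (xs : List ⟦ a ⟧) → length xs ≤ size (enc (list a) xs)
  length≤size []       = z≤n
  length≤size (x ∷ xs) = s≤s (m≤n⇒m≤o+n _ (length≤size xs))

  -- The accumulator grows by a polynomial in γ and x only, independently of the accumulator itself;
  -- otherwise iterating a polynomial-time step could blow up exponentially.
  module _ {g : ⟦ Γ ⊗ (a ⊗ c) ⟧ → ⟦ c ⟧} (P : Poly {Γ ⊗ (a ⊗ c)} {c} g) (e : ℕ)
           (growth : ∀ γ x z → size (enc c (g (γ , x , z)))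
                       ≤ size (enc c z) + suc (size (enc (Γ ⊗ a) (γ , x))) ^ e) where

    private
      State : Ty
      State = Γ ⊗ (c ⊗ list a)

      abstract
       body : Poly {Γ ⊗ (c ⊗ (a ⊗ list a))} {State} (λ (γ , z , x , xs) → γ , g (γ , x , z) , xs)
       body = pairP fstP (pairP (P ∘P pairP fstP (pairP (fstP ∘P sndP ∘P sndP) (fstP ∘P sndP)))
                                (sndP ∘P sndP ∘P sndP))

      module B = Poly body

      -- In a state (γ , z , xs) two tails reach `xs`, whose code is `nil` exactly if nothing is
      -- left to process.
      iteration : Prog
      iteration = while tailₚ ⨾ tailₚ loop B.program

      -- `A` bounds the context and the remaining list, which only shrinks, so the same `A` serves
      -- every round and each round adds at most `A ^ e` to the accumulator. `K` covers the present
      -- state and all growth still to come, hence every later state.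
      iterate : ∀ γ z xs A K →
        suc (size (enc (Γ ⊗ list a) (γ , xs))) ≤ A →
        size (enc State (γ , z , xs)) + length xs * A ^ e ≤ K →
        ∃[ t ] (Run iteration (enc State (γ , z , xs))
                  (enc State (γ , foldl (λ z x → g (γ , x , z)) z xs , [])) t
                × t ≤ suc (length xs) * (K + (K + K) + suc K ^ B.degree))
      iterate γ z [] A K A≥ K≥ =
        _ , run-stop (run-seq run-tail run-tail) ,
        ≤-trans (+-mono-≤ s≤K (+-mono-≤ s≤K (≤-trans (tail-size (enc State (γ , z , []))) s≤K)))
          (≤-trans (m≤m+n (K + (K + K)) (suc K ^ B.degree)) (m≤m+n _ 0))
        where
        s≤K : size (enc State (γ , z , [])) ≤ K
        s≤K = m+n≤o⇒m≤o _ K≥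
      iterate γ z (x ∷ xs) A K A≥ K≥ =
        let tb , rb , tb≤ = B.runs (γ , z , x , xs)
            u , r , u≤ = iterate γ (g (γ , x , z)) xs A K A≥′ K≥′
        in _ , run-loop (run-seq run-tail run-tail) (λ ()) rb r ,
           +-mono-≤ (+-mono-≤ (+-mono-≤ s≤K (+-mono-≤ s≤K
             (≤-trans (tail-size (enc State (γ , z , x ∷ xs))) s≤K)))
             (≤-trans tb≤ (^-monoˡ-≤ B.degree (s≤s s≤K)))) u≤
        where
        s≤K : size (enc State (γ , z , x ∷ xs)) ≤ K
        s≤K = m+n≤o⇒m≤o _ K≥
        |γ| = size (enc Γ γ)
        |z| = size (enc c z)
        |x| = size (enc a x)
        |xs| = size (enc (list a) xs)
        A≥′ : suc (suc (|γ| + |xs|)) ≤ A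
        A≥′ = ≤-trans (s≤s (s≤s (+-monoʳ-≤ |γ| (m≤n⇒m≤1+n (m≤n+m |xs| |x|))))) A≥
        step≤ : size (enc c (g (γ , x , z))) ≤ |z| + A ^ e
        step≤ = ≤-trans (growth γ x z) (+-monoʳ-≤ |z| (^-monoˡ-≤ e
                  (≤-trans (s≤s (s≤s (+-monoʳ-≤ |γ| (m≤n⇒m≤1+n (m≤m+n |x| |xs|))))) A≥)))
        rearrange : ∀ γ z x xs G l → suc (γ + suc ((z + G) + xs)) + l * G + suc x
                      ≡ suc (γ + suc (z + suc (x + xs))) + (G + l * G)
        rearrange = solve-∀
        K≥′ : size (enc State (γ , g (γ , x , z) , xs)) + length xs * A ^ e ≤ K
        K≥′ = begin
          suc (|γ| + suc (size (enc c (g (γ , x , z))) + |xs|)) + length xs * A ^ e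
            ≤⟨ +-monoˡ-≤ _ (s≤s (+-monoʳ-≤ |γ| (s≤s (+-monoˡ-≤ |xs| step≤)))) ⟩
          suc (|γ| + suc ((|z| + A ^ e) + |xs|)) + length xs * A ^ e
            ≤⟨ m≤m+n _ (suc |x|) ⟩
          -- The slack `suc |x|` is the room freed by the consumed entry.
          suc (|γ| + suc ((|z| + A ^ e) + |xs|)) + length xs * A ^ e + suc |x|
            ≡⟨ rearrange |γ| |z| |x| |xs| (A ^ e) (length xs) ⟩
          suc (|γ| + suc (|z| + suc (|x| + |xs|))) + (A ^ e + length xs * A ^ e)
            ≤⟨ K≥ ⟩
          K ∎
          where open ≤-Reasoning

    foldP : Poly {Γ ⊗ (c ⊗ list a)} {c} (λ (γ , z , xs) → foldl (λ z x → g (γ , x , z)) z xs)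
    foldP = output ∘P final
      where
      d : ℕ
      d = suc (1 + (1 + e))
      output : Poly {State} {c} (λ (γ , z , xs) → z)
      output = fstP ∘P sndP
      run-fold : ∀ x → let γ , z , xs = x in
        ∃[ t ] (Run iteration (enc State x) (enc State (γ , foldl (λ z x → g (γ , x , z)) z xs , [])) t
              × t ≤ suc (size (enc State x)) ^ (1 + suc (suc (d + suc (d + d)) + suc d * B.degree)))
      run-fold (γ , z , xs) =
        let t , r , t≤ = iterate γ z xs (suc s) (suc s ^ d)
              (s≤s (s≤s (+-monoʳ-≤ (size (enc Γ γ)) (m≤n⇒m≤1+n (m≤n+m _ (size (enc c z)))))))
              (state-bound 2≤ e (n≤1+n s) (≤-trans |xs|≤ (n≤1+n s)))
        in t , r , ≤-trans t≤ (loop-bound 2≤ d B.degree (s≤s |xs|≤))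
        where
        s : ℕ
        s = size (enc State (γ , z , xs))
        2≤ : 2 ≤ suc s
        2≤ = 2≤1+size (enc State (γ , z , xs))
        |xs|≤ : length xs ≤ s
        |xs|≤ = ≤-trans (length≤size {a} xs)
          (≤-trans (tail-size (enc (c ⊗ list a) (z , xs))) (tail-size (enc State (γ , z , xs))))
      final : Poly {State} {State} (λ (γ , z , xs) → γ , foldl (λ z x → g (γ , x , z)) z xs , [])
      final = record
        { program = iteration
        ; degree  = 1 + suc (suc (d + suc (d + d)) + suc d * B.degree)
        ; runs    = run-fold }

-- Programs for booleans, vectors, lists and unary arithmetic.

module Combinators where

  open PolynomialTime
  open import Data.Bool using (Bool; true; false; if_then_else_; not; _∧_; _∨_)
  open import Data.Fin as Fin using (Fin; toℕ)
  open import Data.List as List using (List; []; _∷_; length; foldr; _++_; concatMap; reverse; null; map; replicate; upTo)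
  open import Data.Bool.ListAction using (any; all)
  open import Data.List.Properties
  open import Data.Nat
  open import Data.Nat.Properties
  open import Data.Product using (∃-syntax; _×_; _,_; proj₁)
  open import Data.Unit using (tt)
  open import Data.Vec as Vec using (Vec)
  open import Function using (_∘_; id)
  open import Relation.Binary.PropositionalEquality
  open import Data.Nat.Tactic.RingSolver using (solve-∀)

  private variable
    a b c Γ : Ty
    n : ℕ

  -- A program sees only codes, so values with equal codes share their programs: `suc n` is a pair
  -- with `nil`, a list cell is a pair, and a vector is a list.
  recodeP : {f : ⟦ Γ ⟧ → ⟦ a ⟧} {g : ⟦ Γ ⟧ → ⟦ b ⟧} → (∀ x → enc a (f x) ≡ enc b (g x)) →
            Poly {Γ} {a} f → Poly {Γ} {b} g
  recodeP {Γ = Γ} eq P = record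
    { program = program ; degree = degree
    ; runs = λ x → subst (λ y → ∃[ t ] (Run program (enc Γ x) y t × _)) (eq x) (runs x) }
    where open Poly P

  consP : {f : ⟦ Γ ⟧ → ⟦ a ⟧} {g : ⟦ Γ ⟧ → List ⟦ a ⟧} →
          Poly {Γ} {a} f → Poly {Γ} {list a} g → Poly {Γ} {list a} (λ γ → f γ ∷ g γ)
  consP P Q = recodeP (λ _ → refl) (pairP P Q)

  vconsP : {f : ⟦ Γ ⟧ → ⟦ a ⟧} {g : ⟦ Γ ⟧ → Vec ⟦ a ⟧ n} →
           Poly {Γ} {a} f → Poly {Γ} {vec a n} g → Poly {Γ} {vec a (suc n)} (λ γ → f γ Vec.∷ g γ)
  vconsP P Q = recodeP (λ _ → refl) (pairP P Q)

  vheadP : Poly {vec a (suc n)} {a} Vec.head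
  vheadP = primitiveP headₚ (λ { (_ Vec.∷ _) → run-head })

  vtailP : Poly {vec a (suc n)} {vec a n} Vec.tail
  vtailP = primitiveP tailₚ (λ { (_ Vec.∷ _) → run-tail })

  vlookupP : (i : Fin n) → Poly {vec a n} {a} (λ v → Vec.lookup v i)
  vlookupP Fin.zero    = Poly-cong (λ { (_ Vec.∷ _) → refl }) vheadP
  vlookupP (Fin.suc i) = Poly-cong (λ { (_ Vec.∷ _) → refl }) (vlookupP i ∘P vtailP)

  vtoListP : {f : ⟦ Γ ⟧ → Vec ⟦ a ⟧ n} → Poly {Γ} {vec a n} f → Poly {Γ} {list a} (Vec.toList ∘ f)
  vtoListP P = recodeP (λ _ → refl) P

  vmapP : {f : ⟦ a ⟧ → ⟦ b ⟧} → Poly {a} {b} f → ∀ n → Poly {vec a n} {vec b n} (Vec.map f)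
  vmapP P zero    = Poly-cong (λ { Vec.[] → refl }) vnilP
  vmapP P (suc n) = Poly-cong (λ { (_ Vec.∷ _) → refl }) (vconsP (P ∘P vheadP) (vmapP P n ∘P vtailP))

  vappendP : ∀ {m} {f : ⟦ Γ ⟧ → Vec ⟦ a ⟧ m} {g : ⟦ Γ ⟧ → Vec ⟦ a ⟧ n} → Poly {Γ} {vec a m} f →
             Poly {Γ} {vec a n} g → Poly {Γ} {vec a (m + n)} (λ γ → f γ Vec.++ g γ)
  vappendP {m = zero} {f} P Q = Poly-cong (λ γ → cong (Vec._++ _) (empty (f γ))) Q
    where
    empty : ∀ {A : Set} (v : Vec A 0) → Vec.[] ≡ v
    empty Vec.[] = refl
  vappendP {m = suc m} {f} P Q =
    Poly-cong (λ γ → split (f γ) _) (vconsP (vheadP ∘P P) (vappendP (vtailP ∘P P) Q))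
    where
    split : ∀ {A : Set} {m n} (v : Vec A (suc m)) (w : Vec A n) →
            Vec.head v Vec.∷ (Vec.tail v Vec.++ w) ≡ v Vec.++ w
    split (_ Vec.∷ _) _ = refl

  trueP : Poly {Γ} {bool} (λ _ → true)
  trueP = recodeP (λ _ → refl) (pairP unitP unitP)

  sucP : {f : ⟦ Γ ⟧ → ℕ} → Poly {Γ} {nat} f → Poly {Γ} {nat} (λ γ → suc (f γ))
  sucP P = recodeP (λ _ → refl) (pairP unitP P)

  constP : ∀ n → Poly {Γ} {nat} (λ _ → n)
  constP zero    = zeroP
  constP (suc n) = sucP (constP n)

  predP : Poly {nat} {nat} pred
  predP = primitiveP tailₚ (λ { zero → run-tail ; (suc _) → run-tail })

  notP : {f : ⟦ Γ ⟧ → Bool} → Poly {Γ} {bool} f → Poly {Γ} {bool} (not ∘ f)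
  notP {f = f} P = Poly-cong (λ γ → lemma (f γ)) (ifP P falseP trueP)
    where
    lemma : ∀ b → (if b then false else true) ≡ not b
    lemma true  = refl
    lemma false = refl

  andP : {f g : ⟦ Γ ⟧ → Bool} → Poly {Γ} {bool} f → Poly {Γ} {bool} g →
         Poly {Γ} {bool} (λ γ → f γ ∧ g γ)
  andP {f = f} {g} P Q = Poly-cong (λ γ → lemma (f γ) (g γ)) (ifP P Q falseP)
    where
    lemma : ∀ b c → (if b then c else false) ≡ b ∧ c
    lemma true  _ = refl
    lemma false _ = refl

  orP : {f g : ⟦ Γ ⟧ → Bool} → Poly {Γ} {bool} f → Poly {Γ} {bool} g →
        Poly {Γ} {bool} (λ γ → f γ ∨ g γ)
  orP {f = f} {g} P Q = Poly-cong (λ γ → lemma (f γ) (g γ)) (ifP P trueP Q)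
    where
    lemma : ∀ b c → (if b then true else c) ≡ b ∨ c
    lemma true  _ = refl
    lemma false _ = refl

  nullP : Poly {list a} {bool} null
  nullP = record
    { program = ifₚ idₚ then nilₚ else ⟨ nilₚ , nilₚ ⟩
    ; degree  = 5
    ; runs    = λ { []       → _ , run-else run-id (run-pair run-nil run-nil) , m≤m+n 5 27
                  ; (x ∷ xs) → let s = size (enc (list _) (x ∷ xs))
                                   2≤ = 2≤1+size (enc (list _) (x ∷ xs))
                                   s≤ = size-bound (enc (list _) (x ∷ xs)) in
                      _ , run-then run-id (λ ()) run-nil ,
                      sum-bound 2≤ {s + s} {s} {3} {1} (sum-bound 2≤ {s} {s} {1} {1} s≤ s≤) s≤ } }

  -- The growth condition of `foldP` with exponent 1 and context `unit`: an entry of size `x` paired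
  -- with that context has size 2 + x, and `foldP` adds one.
  cons-growth : ∀ x z → suc (x + z) ≤ z + suc (suc (suc x)) * 1
  cons-growth x z = begin
    suc (x + z)               ≤⟨ m≤m+n _ 2 ⟩
    suc (x + z) + 2           ≡⟨ lemma x z ⟩
    z + suc (suc (suc x)) * 1 ∎
    where
    open ≤-Reasoning
    lemma : ∀ x z → suc (x + z) + 2 ≡ z + suc (suc (suc x)) * 1
    lemma = solve-∀

  reverseP : {f : ⟦ Γ ⟧ → List ⟦ a ⟧} → Poly {Γ} {list a} f → Poly {Γ} {list a} (reverse ∘ f)
  reverseP {a = a} P =
    foldP {Γ = unit} {g = λ (_ , x , z) → x ∷ z} (consP (fstP ∘P sndP) (sndP ∘P sndP)) 1
      (λ _ x z → cons-growth (size (enc a x)) (size (enc (list a) z)))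
    ∘P pairP unitP (pairP nilP P)

  -- A left fold over the reversed list; the reversal is itself a left fold.
  foldrP : {g : ⟦ Γ ⊗ (a ⊗ c) ⟧ → ⟦ c ⟧} (P : Poly {Γ ⊗ (a ⊗ c)} {c} g) (e : ℕ)
           (growth : ∀ γ x z → size (enc c (g (γ , x , z)))
                       ≤ size (enc c z) + suc (size (enc (Γ ⊗ a) (γ , x))) ^ e) →
           {z : ⟦ Γ ⟧ → ⟦ c ⟧} {xs : ⟦ Γ ⟧ → List ⟦ a ⟧} →
           Poly {Γ} {c} z → Poly {Γ} {list a} xs →
           Poly {Γ} {c} (λ γ → foldr (λ x z → g (γ , x , z)) (z γ) (xs γ))
  foldrP {g = g} P e growth {z} {xs} Z XS =
    Poly-cong (λ γ → reverse-foldl (λ z x → g (γ , x , z)) (z γ) (xs γ))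
      (foldP P e growth ∘P pairP idP (pairP Z (reverseP XS)))

  appendP : {f g : ⟦ Γ ⟧ → List ⟦ a ⟧} → Poly {Γ} {list a} f → Poly {Γ} {list a} g →
            Poly {Γ} {list a} (λ γ → f γ ++ g γ)
  appendP {Γ = Γ} {a} {f} {g} P Q = Poly-cong (λ γ → sym (++-is-foldr (f γ) (g γ)))
    (foldrP {g = λ (_ , x , z) → x ∷ z} (consP (fstP ∘P sndP) (sndP ∘P sndP)) 1
      (λ γ x z → ≤-trans (cons-growth (size (enc a x)) (size (enc (list a) z)))
        (+-monoʳ-≤ (size (enc (list a) z)) (*-monoˡ-≤ 1 (s≤s (s≤s
          (+-monoˡ-≤ (size (enc a x)) (size≥1 (enc Γ γ)))))))) Q P)

  append-size : (xs ys : List ⟦ a ⟧) →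
    size (enc (list a) (xs ++ ys)) ≤ size (enc (list a) ys) + size (enc (list a) xs)
  append-size []       ys = m≤m+n _ 1
  append-size {a} (x ∷ xs) ys = begin
    suc (|x| + size (enc (list a) (xs ++ ys))) ≤⟨ s≤s (+-monoʳ-≤ |x| (append-size xs ys)) ⟩
    suc (|x| + (|ys| + |xs|))                  ≡⟨ lemma |x| |ys| |xs| ⟩
    |ys| + suc (|x| + |xs|)                    ∎
    where
    open ≤-Reasoning
    |x| = size (enc a x)
    |xs| = size (enc (list a) xs)
    |ys| = size (enc (list a) ys)
    lemma : ∀ x y z → suc (x + (y + z)) ≡ y + suc (x + z)
    lemma = solve-∀

  -- The growth condition holds with the degree of `P`: what an entry adds is bounded by the time
  -- for computing `f (γ , x)`, which does not depend on the accumulated list. `mapP`, `allP` and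
  -- `anyP` are derived from this case.
  concatMapP : {f : ⟦ Γ ⊗ a ⟧ → List ⟦ b ⟧} {xs : ⟦ Γ ⟧ → List ⟦ a ⟧} →
               Poly {Γ ⊗ a} {list b} f → Poly {Γ} {list a} xs →
               Poly {Γ} {list b} (λ γ → concatMap (λ x → f (γ , x)) (xs γ))
  concatMapP {Γ = Γ} {a = a} {b = b} {f = f} {xs} P XS =
    Poly-cong (λ γ → lemma (λ x → f (γ , x)) (xs γ))
      (foldrP {g = λ (γ , x , z) → f (γ , x) ++ z}
        (appendP (P ∘P pairP fstP (fstP ∘P sndP)) (sndP ∘P sndP)) P.degree
        (λ γ x z → ≤-trans (append-size (f (γ , x)) z) (+-monoʳ-≤ (size (enc (list b) z))
          (let _ , r , t≤ = P.runs (γ , x) in ≤-trans (output-size r) t≤)))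
        nilP XS)
    where
    module P = Poly P
    lemma : ∀ {A B : Set} (f : A → List B) xs → foldr (λ x z → f x ++ z) [] xs ≡ concatMap f xs
    lemma f []       = refl
    lemma f (x ∷ xs) = cong (f x ++_) (lemma f xs)

  mapP : {f : ⟦ Γ ⊗ a ⟧ → ⟦ b ⟧} {xs : ⟦ Γ ⟧ → List ⟦ a ⟧} →
         Poly {Γ ⊗ a} {b} f → Poly {Γ} {list a} xs →
         Poly {Γ} {list b} (λ γ → map (λ x → f (γ , x)) (xs γ))
  mapP {f = f} {xs} P XS = Poly-cong (λ γ → lemma (λ x → f (γ , x)) (xs γ))
    (concatMapP (consP P nilP) XS)
    where
    lemma : ∀ {A B : Set} (f : A → B) xs → concatMap (λ x → f x ∷ []) xs ≡ map f xs
    lemma f []       = refl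
    lemma f (x ∷ xs) = cong (f x ∷_) (lemma f xs)

  allP : {f : ⟦ Γ ⊗ a ⟧ → Bool} {xs : ⟦ Γ ⟧ → List ⟦ a ⟧} →
         Poly {Γ ⊗ a} {bool} f → Poly {Γ} {list a} xs →
         Poly {Γ} {bool} (λ γ → all (λ x → f (γ , x)) (xs γ))
  allP {f = f} {xs} P XS = Poly-cong (λ γ → lemma (λ x → f (γ , x)) (xs γ))
    (nullP ∘P concatMapP (ifP P (nilP {a = unit}) (consP unitP nilP)) XS)
    where
    lemma : ∀ {A : Set} (p : A → Bool) xs →
            null (concatMap (λ x → if p x then [] else tt ∷ []) xs) ≡ all p xs
    lemma p []       = refl
    lemma p (x ∷ xs) with p x
    ... | true  = lemma p xs
    ... | false = refl

  anyP : {f : ⟦ Γ ⊗ a ⟧ → Bool} {xs : ⟦ Γ ⟧ → List ⟦ a ⟧} →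
         Poly {Γ ⊗ a} {bool} f → Poly {Γ} {list a} xs →
         Poly {Γ} {bool} (λ γ → any (λ x → f (γ , x)) (xs γ))
  anyP {f = f} {xs} P XS = Poly-cong (λ γ → lemma (λ x → f (γ , x)) (xs γ)) (notP (allP (notP P) XS))
    where
    lemma : ∀ {A : Set} (p : A → Bool) xs → not (all (not ∘ p) xs) ≡ any p xs
    lemma p []       = refl
    lemma p (x ∷ xs) with p x
    ... | true  = refl
    ... | false = lemma p xs

  replicateP : {f : ⟦ Γ ⟧ → ℕ} → Poly {Γ} {nat} f → Poly {Γ} {list unit} (λ γ → replicate (f γ) tt)
  replicateP {f = f} P = recodeP (λ γ → lemma (f γ)) P
    where
    lemma : ∀ n → unary n ≡ enc (list unit) (replicate n tt)
    lemma zero    = refl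
    lemma (suc n) = cong (nil ∙_) (lemma n)

  lengthP : {f : ⟦ Γ ⟧ → List ⟦ a ⟧} → Poly {Γ} {list a} f → Poly {Γ} {nat} (length ∘ f)
  lengthP {f = f} P = recodeP (λ γ → lemma (f γ)) (mapP {f = λ _ → tt} unitP P)
    where
    lemma : ∀ {A : Set} (xs : List A) → enc (list unit) (map (λ _ → tt) xs) ≡ unary (length xs)
    lemma []       = refl
    lemma (x ∷ xs) = cong (nil ∙_) (lemma xs)

  addP : {f g : ⟦ Γ ⟧ → ℕ} → Poly {Γ} {nat} f → Poly {Γ} {nat} g → Poly {Γ} {nat} (λ γ → f γ + g γ)
  addP {f = f} {g} P Q = Poly-cong
    (λ γ → trans (length-++ (replicate (f γ) tt)) (cong₂ _+_ (length-replicate (f γ)) (length-replicate (g γ))))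
    (lengthP (appendP (replicateP P) (replicateP Q)))

  mulP : {f g : ⟦ Γ ⟧ → ℕ} → Poly {Γ} {nat} f → Poly {Γ} {nat} g → Poly {Γ} {nat} (λ γ → f γ * g γ)
  mulP {f = f} {g} P Q = Poly-cong (λ γ → lemma (f γ) (g γ))
    (lengthP (concatMapP (replicateP Q ∘P fstP) (replicateP P)))
    where
    lemma : ∀ m n → length (concatMap (λ _ → replicate n tt) (replicate m tt)) ≡ m * n
    lemma zero    n = refl
    lemma (suc m) n = trans (length-++ (replicate n tt)) (cong₂ _+_ (length-replicate n) (lemma m n))

  powP : {f : ⟦ Γ ⟧ → ℕ} → Poly {Γ} {nat} f → ∀ n → Poly {Γ} {nat} (λ γ → f γ ^ n)
  powP P zero    = constP 1
  powP P (suc n) = mulP P (powP P n)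

  monusP : {f g : ⟦ Γ ⟧ → ℕ} → Poly {Γ} {nat} f → Poly {Γ} {nat} g → Poly {Γ} {nat} (λ γ → f γ ∸ g γ)
  monusP {f = f} {g} P Q = Poly-cong (λ γ → lemma (f γ) (g γ))
    (foldrP {g = λ (_ , _ , z) → pred z} (predP ∘P sndP ∘P sndP) 0
      (λ _ _ z → m≤n⇒m≤n+o _ (pred-size z)) P (replicateP Q))
    where
    pred-size : ∀ z → size (unary (pred z)) ≤ size (unary z)
    pred-size zero    = ≤-refl
    pred-size (suc z) = m≤n⇒m≤1+n (n≤1+n _)
    pred-∸ : ∀ m n → pred (m ∸ n) ≡ m ∸ suc n
    pred-∸ zero    zero    = refl
    pred-∸ zero    (suc n) = refl
    pred-∸ (suc m) zero    = refl
    pred-∸ (suc m) (suc n) = pred-∸ m n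
    lemma : ∀ m n → foldr (λ _ z → pred z) m (replicate n tt) ≡ m ∸ n
    lemma m zero    = refl
    lemma m (suc n) = trans (cong pred (lemma m n)) (pred-∸ m n)

  ltP : {f g : ⟦ Γ ⟧ → ℕ} → Poly {Γ} {nat} f → Poly {Γ} {nat} g → Poly {Γ} {bool} (λ γ → f γ <ᵇ g γ)
  ltP {f = f} {g} P Q = Poly-cong (λ γ → lemma (f γ) (g γ)) (notP (nullP ∘P replicateP (monusP Q P)))
    where
    lemma : ∀ m n → not (null (replicate (n ∸ m) tt)) ≡ (m <ᵇ n)
    lemma zero    zero    = refl
    lemma zero    (suc n) = refl
    lemma (suc m) zero    = refl
    lemma (suc m) (suc n) = lemma m n

  eqP : {f g : ⟦ Γ ⟧ → ℕ} → Poly {Γ} {nat} f → Poly {Γ} {nat} g → Poly {Γ} {bool} (λ γ → f γ ≡ᵇ g γ)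
  eqP {f = f} {g} P Q = Poly-cong (λ γ → lemma (f γ) (g γ)) (andP (notP (ltP P Q)) (notP (ltP Q P)))
    where
    lemma : ∀ m n → not (m <ᵇ n) ∧ not (n <ᵇ m) ≡ (m ≡ᵇ n)
    lemma zero    zero    = refl
    lemma zero    (suc n) = refl
    lemma (suc m) zero    = refl
    lemma (suc m) (suc n) = lemma m n

  indexFrom : {A : Set} → ℕ → List A → List (ℕ × A)
  indexFrom i []       = []
  indexFrom i (x ∷ xs) = (i , x) ∷ indexFrom (suc i) xs

  indexFrom-tabulate : ∀ {A : Set} i (xs : List A) →
    indexFrom i xs ≡ List.tabulate (λ j → i + toℕ j , List.lookup xs j)
  indexFrom-tabulate i []       = refl
  indexFrom-tabulate i (x ∷ xs) = cong₂ _∷_ (cong (_, x) (sym (+-identityʳ i)))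
    (trans (indexFrom-tabulate (suc i) xs)
           (tabulate-cong (λ j → cong (_, List.lookup xs j) (sym (+-suc i (toℕ j))))))

  unary-size : ∀ n → size (unary n) ≡ suc (n + n)
  unary-size zero    = refl
  unary-size (suc n) = cong (suc ∘ suc) (trans (unary-size n) (sym (+-suc n n)))

  -- A right fold does not see positions. The total length `n` is put into the context, and the
  -- position is recovered from `n` and the number of entries already produced; being at most `n`,
  -- it respects the growth condition.
  indexP : {f : ⟦ Γ ⟧ → List ⟦ a ⟧} → Poly {Γ} {list a} f → Poly {Γ} {list (nat ⊗ a)} (indexFrom 0 ∘ f)
  indexP {a = a} {f} P = Poly-cong (λ γ → trans (lemma (length (f γ)) (f γ) ≤-refl)
      (cong (λ i → indexFrom i (f γ)) (n∸n≡0 (length (f γ)))))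
    (foldrP {Γ = nat ⊗ list a} {a = a} {c = list (nat ⊗ a)}
      {g = λ ((n , _) , x , z) → (n ∸ suc (length z) , x) ∷ z}
      (consP (pairP (monusP (fstP ∘P fstP) (sucP (lengthP (sndP ∘P sndP)))) (fstP ∘P sndP)) (sndP ∘P sndP))
      1 (λ (n , xs) x z → growth n xs x z) nilP sndP ∘P pairP (lengthP P) P)
    where
    lemma : ∀ {A : Set} n (xs : List A) → length xs ≤ n →
      foldr (λ x z → (n ∸ suc (length z) , x) ∷ z) [] xs ≡ indexFrom (n ∸ length xs) xs
    lemma n []       _ = refl
    lemma n (x ∷ xs) p =
      let eq = lemma n xs (≤-trans (n≤1+n _) p)
          len = trans (cong length eq) (length-indexFrom (n ∸ length xs) xs)
      in cong₂ _∷_ (cong (λ l → n ∸ suc l , x) len)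
           (trans eq (cong (λ i → indexFrom i xs) (∸-suc′ n (length xs) p)))
      where
      length-indexFrom : ∀ {A : Set} i (xs : List A) → length (indexFrom i xs) ≡ length xs
      length-indexFrom i []       = refl
      length-indexFrom i (x ∷ xs) = cong suc (length-indexFrom (suc i) xs)
      ∸-suc′ : ∀ n l → suc l ≤ n → n ∸ l ≡ suc (n ∸ suc l)
      ∸-suc′ (suc n) l (s≤s p) = +-∸-assoc 1 p
    growth : ∀ n xs x z → size (enc (list (nat ⊗ a)) ((n ∸ suc (length z) , x) ∷ z))
      ≤ size (enc (list (nat ⊗ a)) z) + suc (size (enc ((nat ⊗ list a) ⊗ a) ((n , xs) , x))) ^ 1
    growth n xs x z = begin
      suc (suc (size (unary (n ∸ suc (length z))) + |x|) + |z|)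
        ≤⟨ s≤s (+-monoˡ-≤ |z| (s≤s (+-monoˡ-≤ |x| smaller))) ⟩
      suc (suc (size (unary n) + |x|) + |z|)
        ≤⟨ m≤m+n _ (suc |xs|) ⟩
      suc (suc (size (unary n) + |x|) + |z|) + suc |xs|
        ≡⟨ rearrange (size (unary n)) |x| |z| |xs| ⟩
      |z| + suc (suc (suc (size (unary n) + |xs|) + |x|)) ^ 1
        ∎
      where
      open ≤-Reasoning
      |x| = size (enc a x)
      |xs| = size (enc (list a) xs)
      |z| = size (enc (list (nat ⊗ a)) z)
      smaller : size (unary (n ∸ suc (length z))) ≤ size (unary n)
      smaller = subst₂ _≤_ (sym (unary-size (n ∸ suc (length z)))) (sym (unary-size n))
        (s≤s (+-mono-≤ (m∸n≤m n (suc (length z))) (m∸n≤m n (suc (length z)))))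
      rearrange : ∀ n x z xs →
        suc (suc (n + x) + z) + suc xs ≡ z + suc (suc (suc (n + xs) + x)) * 1
      rearrange = solve-∀

  upToP : {f : ⟦ Γ ⟧ → ℕ} → Poly {Γ} {nat} f → Poly {Γ} {list nat} (upTo ∘ f)
  upToP {f = f} P = Poly-cong (λ γ → lemma id 0 (f γ) (λ _ → refl))
    (mapP (fstP ∘P sndP) (indexP (replicateP P)))
    where
    lemma : ∀ (g : ℕ → ℕ) i n → (∀ j → i + j ≡ g j) → map proj₁ (indexFrom i (replicate n tt)) ≡ List.applyUpTo g n
    lemma g i zero    eq = refl
    lemma g i (suc n) eq = cong₂ _∷_ (trans (sym (+-identityʳ i)) (eq 0))
      (lemma (g ∘ suc) (suc i) n (λ j → trans (sym (+-suc i j)) (eq (suc j))))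

-- Composing an fpt-reduction with a polynomial-time one.

module Reductions where

  open PolynomialTime
  open Combinators
  open import Data.Nat
  open import Data.Nat.Properties
  open import Data.Product using (_,_; proj₁)
  open import Function using (_∘_; _⇔_)
  open import Function.Construct.Composition using (_⇔-∘_)
  open import Data.Nat.Tactic.RingSolver using (solve-∀)
  open import Relation.Binary.PropositionalEquality

  computable : {f : ℕ → ℕ} → Poly {nat} {nat} f → Computable f
  computable P = program , λ n → let t , r , _ = runs n in t , r
    where open Poly P

  computable-∘ : {f g : ℕ → ℕ} → Computable g → Computable f → Computable (g ∘ f)
  computable-∘ {f} (q , rq) (p , rp) = p ⨾ q , λ n →
    let s , r = rp n ; t , r′ = rq (f n) in s + t , run-seq r r′

  power-product : ∀ n x y → (x * y) ^ n ≡ x ^ n * y ^ n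
  power-product zero    x y = refl
  power-product (suc n) x y = trans (cong (x * y *_) (power-product n x y)) (lemma x y (x ^ n) (y ^ n))
    where
    lemma : ∀ a b c d → a * b * (c * d) ≡ a * c * (b * d)
    lemma = solve-∀

  module _ {P Q R : ParamProblem} (P≤Q : P ≤fpt Q) where
    private
      module P = ParamProblem P
      module Q = ParamProblem Q
      module R = ParamProblem R
      module P≤Q = _≤fpt_ P≤Q

    -- As `1 ≤ s`, also `suc t ≤ suc F * s ^ D`. Raising this to the power `b` keeps the parameter
    -- factor apart from the power of `s`, so the sum has the fpt form again.
    composition-time : ∀ F s D b {t u} → 1 ≤ s → t ≤ F * s ^ D → u ≤ suc t ^ b →
      t + u ≤ suc F ^ suc b * s ^ (D + D * b)
    composition-time F s D b {t} {u} 1≤s t≤ u≤ = begin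
      t + u
        ≤⟨ +-mono-≤ t≤ (≤-trans u≤ (^-monoˡ-≤ b suc-t≤)) ⟩
      F * s ^ D + (suc F * s ^ D) ^ b
        ≡⟨ cong (F * s ^ D +_) (trans (power-product b (suc F) (s ^ D)) (cong (suc F ^ b *_) (^-*-assoc s D b))) ⟩
      F * s ^ D + suc F ^ b * s ^ (D * b)
        ≤⟨ +-mono-≤ (*-mono-≤ F≤ (^-monoʳ-≤ s (m≤m+n D (D * b)))) (*-monoʳ-≤ (suc F ^ b) (^-monoʳ-≤ s (m≤n+m (D * b) D))) ⟩
      F * suc F ^ b * s ^ (D + D * b) + suc F ^ b * s ^ (D + D * b)
        ≡⟨ sym (*-distribʳ-+ (s ^ (D + D * b)) (F * suc F ^ b) (suc F ^ b)) ⟩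
      (F * suc F ^ b + suc F ^ b) * s ^ (D + D * b)
        ≡⟨ cong (_* s ^ (D + D * b)) (+-comm (F * suc F ^ b) (suc F ^ b)) ⟩
      suc F ^ suc b * s ^ (D + D * b) ∎
      where
      open ≤-Reasoning
      instance
        s≢0 : NonZero s
        s≢0 = >-nonZero 1≤s
      suc-t≤ : suc t ≤ suc F * s ^ D
      suc-t≤ = +-mono-≤ (>-nonZero⁻¹ (s ^ D) {{m^n≢0 s D}}) t≤
      F≤ : F ≤ F * suc F ^ b
      F≤ = m≤m*n F (suc F ^ b) {{m^n≢0 (suc F) b}}

    -- Of the intermediate parameter only an upper bound is known, hence the monotonicity of
    -- `bound`. The polynomial-time function works on decoded data and has to agree with `reduce` on
    -- codes only.
    ≤fpt-trans-poly :
      ∀ {a b} {f : ⟦ a ⟧ → ⟦ b ⟧} (poly : Poly {a} {b} f) {bound : ℕ → ℕ} (bound-poly : Poly {nat} {nat} bound)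
      (reduce : Q.Instance → R.Instance) (decode : Q.Instance → ⟦ a ⟧) →
      (∀ x → Q.Yes x ⇔ R.Yes (reduce x)) →
      (∀ {m n} → m ≤ n → bound m ≤ bound n) →
      (∀ x → R.param (reduce x) ≤ bound (Q.param x)) →
      (∀ x → enc a (decode x) ≡ Q.input x) →
      (∀ x → enc b (f (decode x)) ≡ R.input (reduce x)) →
      P ≤fpt R
    ≤fpt-trans-poly {a} {b} {f} poly {bound} bound-poly reduce decode correct mono param≤ input≡ output≡ = record
      { reduce           = reduce ∘ P≤Q.reduce
      ; correct          = λ x → correct (P≤Q.reduce x) ⇔-∘ P≤Q.correct x
      ; bound            = bound ∘ P≤Q.bound
      ; bound-computable = computable-∘ (computable bound-poly) P≤Q.bound-computable
      ; param-bounded    = λ x → ≤-trans (param≤ (P≤Q.reduce x)) (mono (P≤Q.param-bounded x))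
      ; program          = P≤Q.program ⨾ program
      ; time             = λ k → suc (P≤Q.time k) ^ suc degree
      ; time-computable  = computable-∘ (computable (powP (sucP idP) (suc degree))) P≤Q.time-computable
      ; degree           = P≤Q.degree + P≤Q.degree * degree
      ; runs             = λ x →
          let y = P≤Q.reduce x
              t , r , t≤ = P≤Q.runs x
              u , r′ , u≤ = runs (decode y)
              u≤′ = subst (λ i → u ≤ suc (size i) ^ degree) (input≡ y) u≤
          in t + u , run-seq r (subst₂ (λ i o → Run program i o u) (input≡ y) (output≡ y) r′) ,
             composition-time (P≤Q.time (P.param x)) (size (P.input x)) P≤Q.degree degree (size≥1 (P.input x)) t≤
               (≤-trans u≤′ (^-monoˡ-≤ degree (s≤s (output-size r)))) }
      where open Poly poly

  -- Restricting changes neither codes nor parameters nor answers, so the same program serves.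
  forget-restriction : ∀ {P Q R} → P ≤fpt restrict Q R → P ≤fpt Q
  forget-restriction P≤Q = record
    { reduce = proj₁ ∘ reduce ; correct = correct
    ; bound = bound ; bound-computable = bound-computable ; param-bounded = param-bounded
    ; program = program ; time = time ; time-computable = time-computable ; degree = degree ; runs = runs }
    where open _≤fpt_ P≤Q

-- Sums over duplicate-free lists; walks, distances and detours in unit-length graphs.

module UnitLengthGraphs where

  open import Data.Fin as Fin using (Fin)
  open import Data.Fin.Properties as Fin using (any?)
  open import Data.Fin.Subset using (Subset; _∈_; ⊤)
  open import Data.Fin.Subset.Properties using (_∈?_)
  open import Data.List as List using (List; []; _∷_; length; map)
  open import Data.Nat.ListAction using (sum)
  open import Data.List.Membership.Propositional using () renaming (_∈_ to _∈ˡ_)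
  open import Data.List.Relation.Unary.All as All using (All; []; _∷_)
  open import Data.List.Relation.Unary.AllPairs using ([]; _∷_)
  open import Data.List.Relation.Unary.Any using (here; there; _─_)
  open import Data.List.Relation.Unary.Unique.Propositional using (Unique)
  open import Data.Nat
  open import Data.Nat.Properties
  open import Data.Product using (∃-syntax; Σ-syntax; _×_; _,_; proj₁)
  open import Data.Sum using (_⊎_; inj₁; inj₂; swap)
  open import Function using (_∘_)
  open import Relation.Binary.PropositionalEquality
  open import Relation.Nullary using (Dec; yes; no; ¬_; contradiction)
  open import Relation.Nullary.Decidable using (_×-dec_; _⊎-dec_; map′)
  open import Data.Nat.Tactic.RingSolver using (solve-∀)

  module _ {A : Set} (f : A → ℕ) where

    sum-─ : ∀ {x} {xs : List A} (p : x ∈ˡ xs) → sum (map f xs) ≡ f x + sum (map f (xs ─ p))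
    sum-─ (here refl)         = refl
    sum-─ {x} {y ∷ xs} (there p) = trans (cong (f y +_) (sum-─ p)) (lemma (f y) (f x) _)
      where
      lemma : ∀ a b c → a + (b + c) ≡ b + (a + c)
      lemma = solve-∀

    ∈-─ : ∀ {x y} {xs : List A} (p : x ∈ˡ xs) → y ∈ˡ xs → y ≢ x → y ∈ˡ (xs ─ p)
    ∈-─ (here refl) (here refl) y≢x = contradiction refl y≢x
    ∈-─ (here refl) (there q)   y≢x = q
    ∈-─ (there p)   (here refl) y≢x = here refl
    ∈-─ (there p)   (there q)   y≢x = there (∈-─ p q y≢x)

    -- Each entry of nonzero value is removed from `xs` once it is counted; as `ys` has no
    -- repetitions, the later ones survive the removal. Entries of value 0 are exempt, so that edges
    -- of weight 0 can be ignored.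
    sum-mono-support : ∀ {xs ys : List A} → Unique ys →
      (∀ {y} → y ∈ˡ ys → f y ≢ 0 → y ∈ˡ xs) → sum (map f ys) ≤ sum (map f xs)
    sum-mono-support {ys = []}     _          _   = z≤n
    sum-mono-support {xs} {y ∷ ys} (y∉ys ∷ u) sub with f y ≟ 0
    ... | yes fy≡0 = ≤-trans (≤-reflexive (cong (_+ sum (map f ys)) fy≡0)) (sum-mono-support u (sub ∘ there))
    ... | no  fy≢0 = begin
      f y + sum (map f ys)            ≤⟨ +-monoʳ-≤ (f y) (sum-mono-support u λ {z} z∈ys fz≢0 →
                                           ∈-─ y∈xs (sub (there z∈ys) fz≢0) λ { refl → All.lookup y∉ys z∈ys refl }) ⟩
      f y + sum (map f (xs ─ y∈xs))   ≡⟨ sum-─ y∈xs ⟨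
      sum (map f xs)                  ∎
      where
      open ≤-Reasoning
      y∈xs = sub (here refl) fy≢0

    sum-map-const : ∀ c (xs : List A) → (∀ {x} → x ∈ˡ xs → f x ≡ c) → sum (map f xs) ≡ length xs * c
    sum-map-const c []       _  = refl
    sum-map-const c (x ∷ xs) eq = cong₂ _+_ (eq (here refl)) (sum-map-const c xs (eq ∘ there))

  unique-length : {A : Set} {xs ys : List A} → Unique xs → (∀ {x} → x ∈ˡ xs → x ∈ˡ ys) → length xs ≤ length ys
  unique-length {xs = xs} {ys} u sub = subst₂ _≤_ (count xs) (count ys)
    (sum-mono-support (λ _ → 1) u (λ x∈xs _ → sub x∈xs))
    where
    count : ∀ zs → sum (map (λ _ → 1) zs) ≡ length zs
    count zs = trans (sum-map-const _ 1 zs (λ _ → refl)) (*-identityʳ (length zs))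

  module _ (G : Graph) where
    open Graph G

    module _ {F : Subset m} where

      _++ʷ_ : ∀ {u v z} → Walk F u v → Walk F v z → Walk F u z
      stop         ++ʷ Z = Z
      step e p j W ++ʷ Z = step e p j (W ++ʷ Z)

      ++ʷ-length : ∀ {u v z} (W : Walk F u v) (Z : Walk F v z) →
                   walkLength (W ++ʷ Z) ≡ walkLength W + walkLength Z
      ++ʷ-length stop           Z = refl
      ++ʷ-length (step e p j W) Z = trans (cong (ℓ e +_) (++ʷ-length W Z)) (sym (+-assoc (ℓ e) _ _))

      reverse-onto : ∀ {u v z} → Walk F u v → Walk F u z → Walk F v z
      reverse-onto stop           Z = Z
      reverse-onto (step e p j W) Z = reverse-onto W (step e p (swap j) Z)

      reverseʷ : ∀ {u v} → Walk F u v → Walk F v u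
      reverseʷ W = reverse-onto W stop

      reverse-onto-length : ∀ {u v z} (W : Walk F u v) (Z : Walk F u z) →
                            walkLength (reverse-onto W Z) ≡ walkLength W + walkLength Z
      reverse-onto-length stop           Z = refl
      reverse-onto-length (step e p j W) Z =
        trans (reverse-onto-length W _) (lemma (walkLength W) (ℓ e) (walkLength Z))
        where
        lemma : ∀ a b c → a + (b + c) ≡ b + a + c
        lemma = solve-∀

      reverseʷ-length : ∀ {u v} (W : Walk F u v) → walkLength (reverseʷ W) ≡ walkLength W
      reverseʷ-length W = trans (reverse-onto-length W stop) (+-identityʳ _)

      suffix : ∀ {u v x} (W : Walk F u v) → Unique (vertices W) → x ∈ˡ vertices W →
               ∃[ P ] pathLength {F} {x} {v} P ≤ walkLength W
      suffix stop           u       (here refl) = (stop , u) , ≤-refl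
      suffix (step e p j W) u       (here refl) = (step e p j W , u) , ≤-refl
      suffix (step e p j W) (_ ∷ u) (there x∈W) =
        let P , P≤ = suffix W u x∈W in P , m≤n⇒m≤o+n (ℓ e) P≤

      -- Induction on the walk: if the start recurs in the shortened rest, the part from that
      -- recurrence on is kept instead.
      shorten : ∀ {u v} (W : Walk F u v) → ∃[ P ] pathLength {F} {u} {v} P ≤ walkLength W
      shorten stop                   = (stop , [] ∷ []) , z≤n
      shorten {u} (step e p j W) with shorten W
      ... | (W′ , uniq) , W′≤ with member? u (vertices W′)
        where
        open import Data.List.Membership.DecPropositional Fin._≟_ renaming (_∈?_ to member?)
      ... | yes u∈W′ = let P , P≤ = suffix W′ uniq u∈W′ in P , m≤n⇒m≤o+n (ℓ e) (≤-trans P≤ W′≤)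
      ... | no  u∉W′ = (step e p j W′ , All.tabulate (λ { x∈ refl → u∉W′ x∈ }) ∷ uniq) , +-monoʳ-≤ (ℓ e) W′≤

      module _ (unit : ∀ e → ℓ e ≡ 1) where

        Within : ℕ → V → V → Set
        Within b u v = Σ[ W ∈ Walk F u v ] walkLength W ≤ b

        within? : ∀ b u v → Dec (Within b u v)
        within? zero u v = map′ (λ { refl → stop , z≤n }) trivial (u Fin.≟ v)
          where
          trivial : Within 0 u v → u ≡ v
          trivial (stop , _)         = refl
          trivial (step e _ _ _ , p) = contradiction (≤-trans (ℓ≥1 e) (m+n≤o⇒m≤o (ℓ e) p)) λ ()
        within? (suc b) u v = map′ to from ((u Fin.≟ v) ⊎-dec any? λ e → (e ∈? F) ×-dec
          ((src e Fin.≟ u ×-dec within? b (tgt e) v) ⊎-dec (tgt e Fin.≟ u ×-dec within? b (src e) v)))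
          where
          cons : ∀ e {z} → e ∈ F → Joins e u z → Within b z v → Within (suc b) u v
          cons e e∈F j (W , p) = step e e∈F j W , subst (λ l → l + walkLength W ≤ suc b) (sym (unit e)) (s≤s p)
          to : _ → Within (suc b) u v
          to (inj₁ refl)                             = stop , z≤n
          to (inj₂ (e , e∈F , inj₁ (src≡u , W)))     = cons e e∈F (inj₁ (src≡u , refl)) W
          to (inj₂ (e , e∈F , inj₂ (tgt≡u , W)))     = cons e e∈F (inj₂ (refl , tgt≡u)) W
          from : Within (suc b) u v → _
          from (stop , _) = inj₁ refl
          from (step e e∈F j W , p) with s≤s⁻¹ (subst (λ l → l + walkLength W ≤ suc b) (unit e) p) | j
          ... | W≤ | inj₁ (src≡u , refl) = inj₂ (e , e∈F , inj₁ (src≡u , W , W≤))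
          ... | W≤ | inj₂ (refl , tgt≡u) = inj₂ (e , e∈F , inj₂ (tgt≡u , W , W≤))

        -- The bound is lowered as long as `within?` still finds a walk. At the last bound that
        -- admits one, every path is at least that long, and a shortened walk attains it.
        distance : ∀ b {u v} → Within b u v → ∃[ d ] (IsDist F u v d × d ≤ b)
        distance zero    (W , p) = let P , P≤ = shorten W in
          0 , ((P , n≤0⇒n≡0 (≤-trans P≤ p)) , λ _ → z≤n) , z≤n
        distance (suc b) {u} {v} (W , p) with within? b u v
        ... | yes W′ = let d , dist , d≤ = distance b W′ in d , dist , m≤n⇒m≤1+n d≤
        ... | no ¬W′ = let P , P≤ = shorten W
                           longer = λ (Q : Path F u v) → ≰⇒> (λ Q≤ → ¬W′ (proj₁ Q , Q≤)) in
          suc b , ((P , ≤-antisym (≤-trans P≤ p) (longer P)) , longer) , ≤-refl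

        -- Replaces each edge by its detour or the reversed detour, so that the spanner property has
        -- to be checked on edges only.
        expand : ∀ {c u v} → (∀ e → Within c (src e) (tgt e)) → (W : Walk ⊤ u v) → Within (c * walkLength W) u v
        expand     stretch stop             = stop , z≤n
        expand {c} stretch (step e _ j W) =
          let Z , Z≤ = expand {c} stretch W
              Y , Y≤ = detour j
          in Y ++ʷ Z , (begin
            walkLength (Y ++ʷ Z)         ≡⟨ ++ʷ-length Y Z ⟩
            walkLength Y + walkLength Z  ≤⟨ +-mono-≤ Y≤ Z≤ ⟩
            c + c * walkLength W         ≡⟨ *-suc c (walkLength W) ⟨
            c * suc (walkLength W)       ≡⟨ cong (λ l → c * (l + walkLength W)) (unit e) ⟨
            c * (ℓ e + walkLength W)     ∎)
          where
          open ≤-Reasoning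
          detour : ∀ {u v} → Joins e u v → Within c u v
          detour (inj₁ (refl , refl)) = stretch e
          detour (inj₂ (refl , refl)) = let Y , Y≤ = stretch e in
            reverseʷ Y , ≤-trans (≤-reflexive (reverseʷ-length Y)) Y≤

-- From hitting sets to 3-spanners.

module HittingSets where

  open UnitLengthGraphs
  open import Data.Bool using (Bool; true; false; if_then_else_; T?)
  open import Data.Bool.Properties using (T-≡)
  open import Data.Empty using (⊥-elim)
  open import Data.Fin as Fin using (Fin; toℕ; _↑ˡ_; _↑ʳ_; splitAt)
  open import Data.Fin.Properties as Fin using (toℕ-↑ˡ; toℕ-↑ʳ; toℕ<n)
  open import Data.Fin.Subset using (Subset; _∈_; ⊤)
  open import Data.Fin.Subset.Properties using (_∈?_; ∈⊤)
  import Data.Integer as ℤ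
  import Data.Integer.Properties as ℤ
  open import Data.Rational as ℚ using (ℚ; 1ℚ)
  import Data.Rational.Properties as ℚ
  import Data.Rational.Unnormalised as ℚᵘ
  import Data.Rational.Unnormalised.Properties as ℚᵘ
  open import Data.List as List using (List; []; _∷_; length; map; allFin; cartesianProductWith; filterᵇ; _++_; filter)
  open import Data.List.Properties using (length-map; map-tabulate)
  open import Data.Nat.ListAction using (sum)
  open import Data.List.Membership.Propositional using () renaming (_∈_ to _∈ˡ_)
  open import Data.List.Membership.Propositional.Properties
  open import Data.List.Relation.Unary.All as All using (All; []; _∷_)
  open import Data.List.Relation.Unary.AllPairs using ([]; _∷_)
  open import Data.List.Relation.Unary.Any using (here; there; index)
  open import Data.List.Relation.Unary.Any.Properties using (lookup-index)
  open import Data.List.Relation.Unary.Unique.Propositional using (Unique)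
  import Data.List.Relation.Unary.Unique.Propositional.Properties as Unique
  open import Data.Nat
  open import Data.Nat.Properties
  open import Data.Product using (∃-syntax; Σ-syntax; _×_; _,_; proj₁; proj₂)
  open import Data.Sum using (_⊎_; inj₁; inj₂)
  import Data.Vec as Vec
  open import Data.Vec.Properties using (lookup∘tabulate; []=⇒lookup; lookup⇒[]=)
  open import Function using (_∘_; id; Equivalence)
  open import Relation.Binary.PropositionalEquality
  open import Relation.Nullary using (¬_; contradiction)
  open import Relation.Nullary.Decidable using (⌊_⌋; toWitness; fromWitness)

  lookup-injective : ∀ {A : Set} {xs : List A} → Unique xs → ∀ {i j} →
                     List.lookup xs i ≡ List.lookup xs j → i ≡ j
  lookup-injective (_ ∷ _)    {Fin.zero}  {Fin.zero}  _  = refl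
  lookup-injective {xs = _ ∷ xs} (x∉ ∷ _) {Fin.zero}  {Fin.suc j} eq = contradiction eq (All.lookup x∉ (∈-lookup j))
  lookup-injective {xs = _ ∷ xs} (x∉ ∷ _) {Fin.suc i} {Fin.zero}  eq = contradiction (sym eq) (All.lookup x∉ (∈-lookup i))
  lookup-injective (_ ∷ u)    {Fin.suc i} {Fin.suc j} eq = cong Fin.suc (lookup-injective u eq)

  α₃ : ℚ
  α₃ = ℤ.+ 3 ℚ./ 1

  -- `ℚ./` normalises, which blocks evaluation at a variable `d`. Over unnormalised fractions with
  -- denominator 1 the stretch condition becomes an inequality of natural numbers.
  fraction : ∀ d → ℚ.toℚᵘ (ℤ.+ d ℚ./ 1) ℚᵘ.≃ ℚᵘ.mkℚᵘ (ℤ.+ d) 0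
  fraction d = ℚ.toℚᵘ-fromℚᵘ (ℚᵘ.mkℚᵘ (ℤ.+ d) 0)

  stretched : ∀ d → ℚ.toℚᵘ (α₃ ℚ.* (ℤ.+ d ℚ./ 1)) ℚᵘ.≃ ℚᵘ.mkℚᵘ (ℤ.+ (3 * d)) 0
  stretched d = ℚᵘ.≃-trans (ℚ.toℚᵘ-homo-* α₃ (ℤ.+ d ℚ./ 1))
    (ℚᵘ.≃-trans (ℚᵘ.*-congˡ {ℚ.toℚᵘ α₃} (fraction d))
      (ℚᵘ.≃-reflexive (cong (λ z → ℚᵘ.mkℚᵘ z 0) (sym (ℤ.pos-* 3 d)))))

  stretch⁺ : ∀ {d′ d} → d′ ≤ 3 * d → (ℤ.+ d′ ℚ./ 1) ℚ.≤ α₃ ℚ.* (ℤ.+ d ℚ./ 1)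
  stretch⁺ {d′} {d} p = ℚ.toℚᵘ-cancel-≤ (ℚᵘ.≤-trans (ℚᵘ.≤-reflexive (fraction d′))
    (ℚᵘ.≤-trans (ℚᵘ.*≤* (ℤ.*-monoʳ-≤-nonNeg (ℤ.+ 1) (ℤ.+≤+ p))) (ℚᵘ.≤-reflexive (ℚᵘ.≃-sym (stretched d)))))

  stretch⁻ : ∀ {d′ d} → (ℤ.+ d′ ℚ./ 1) ℚ.≤ α₃ ℚ.* (ℤ.+ d ℚ./ 1) → d′ ≤ 3 * d
  stretch⁻ {d′} {d} p with ℚᵘ.≤-trans (ℚᵘ.≤-reflexive (ℚᵘ.≃-sym (fraction d′)))
    (ℚᵘ.≤-trans (ℚ.toℚᵘ-mono-≤ p) (ℚᵘ.≤-reflexive (stretched d)))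
  ... | ℚᵘ.*≤* q = ℤ.drop‿+≤+ (ℤ.*-cancelʳ-≤-pos (ℤ.+ d′) (ℤ.+ (3 * d)) (ℤ.+ 1) q)

  1≤α₃ : 1ℚ ℚ.≤ α₃
  1≤α₃ = ℚ.*≤* (ℤ.+≤+ (s≤s z≤n))

  n<2^n : ∀ n → n < 2 ^ n
  n<2^n zero    = s≤s z≤n
  n<2^n (suc n) = begin
    suc (suc n)             ≤⟨ s≤s (n<2^n n) ⟩
    1 + 2 ^ n               ≤⟨ +-monoˡ-≤ (2 ^ n) (≤-trans (s≤s z≤n) (n<2^n n)) ⟩
    2 ^ n + 2 ^ n           ≡⟨ cong (2 ^ n +_) (sym (+-identityʳ _)) ⟩
    2 ^ suc n               ∎
    where open ≤-Reasoning

  -- `covered` serves the edges root-element: the detour of an unbought one enters its element from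
  -- a clause that contains it.
  record HittingSet : Set where
    field
      M C     : ℕ
      hit     : Fin C → Fin M → Bool
      covered : ∀ e → ∃[ c ] hit c e ≡ true
      K       : ℕ

    Solvable : Set
    Solvable = ∃[ H ] (length H ≤ K × ∀ c → ∃[ e ] (e ∈ˡ H × hit c e ≡ true))

    data Vertex : Set where
      root hub : Vertex
      elem     : Fin M → Vertex
      clause   : Fin C → Vertex

    data Edge : Set where
      base : Edge
      sel  : Fin M → Edge
      dir  : Fin C → Edge
      mem  : Fin C → Fin M → Edge

    source target : Edge → Vertex
    source base      = root
    source (sel _)   = root
    source (dir _)   = hub
    source (mem _ e) = elem e
    target base      = hub
    target (sel e)   = elem e
    target (dir c)   = clause c
    target (mem c _) = clause c

    -- A left inverse of taking end points, which excludes parallel edges. The default `base`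
    -- answers for root-hub and for all other pairs.
    edgeBetween : Vertex → Vertex → Edge
    edgeBetween root     (elem e)   = sel e
    edgeBetween hub      (clause c) = dir c
    edgeBetween (elem e) (clause c) = mem c e
    edgeBetween _        _          = base

    edgeBetween-ends : ∀ e → edgeBetween (source e) (target e) ≡ e
    edgeBetween-ends base      = refl
    edgeBetween-ends (sel _)   = refl
    edgeBetween-ends (dir _)   = refl
    edgeBetween-ends (mem _ _) = refl

    side : Vertex → Bool
    side root       = false
    side hub        = true
    side (elem _)   = true
    side (clause _) = false

    sides-differ : ∀ e → side (source e) ≢ side (target e)
    sides-differ base      ()
    sides-differ (sel _)   ()
    sides-differ (dir _)   ()
    sides-differ (mem _ _) ()

    -- Ordered as root, hub, elements, clauses, so that every `source` precedes its `target`.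
    position : Vertex → Fin (2 + (M + C))
    position root       = Fin.zero
    position hub        = Fin.suc Fin.zero
    position (elem e)   = Fin.suc (Fin.suc (e ↑ˡ C))
    position (clause c) = Fin.suc (Fin.suc (M ↑ʳ c))

    vertex : Fin (2 + (M + C)) → Vertex
    vertex Fin.zero              = root
    vertex (Fin.suc Fin.zero)    = hub
    vertex (Fin.suc (Fin.suc i)) with splitAt M i
    ... | inj₁ e = elem e
    ... | inj₂ c = clause c

    vertex-position : ∀ v → vertex (position v) ≡ v
    vertex-position root       = refl
    vertex-position hub        = refl
    vertex-position (elem e)   rewrite Fin.splitAt-↑ˡ M e C = refl
    vertex-position (clause c) rewrite Fin.splitAt-↑ʳ M C c = refl

    position-vertex : ∀ i → position (vertex i) ≡ i
    position-vertex Fin.zero              = refl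
    position-vertex (Fin.suc Fin.zero)    = refl
    position-vertex (Fin.suc (Fin.suc i)) with splitAt M i in eq
    ... | inj₁ e = cong (Fin.suc ∘ Fin.suc) (Fin.splitAt⁻¹-↑ˡ eq)
    ... | inj₂ c = cong (Fin.suc ∘ Fin.suc) (Fin.splitAt⁻¹-↑ʳ eq)

    position-injective : ∀ {u v} → position u ≡ position v → u ≡ v
    position-injective {u} {v} eq =
      trans (sym (vertex-position u)) (trans (cong vertex eq) (vertex-position v))

    position-< : ∀ e → position (source e) Fin.< position (target e)
    position-< base      = s≤s z≤n
    position-< (sel _)   = s≤s z≤n
    position-< (dir _)   = s≤s (s≤s z≤n)
    position-< (mem c e) = s≤s (s≤s (subst₂ _<_ (sym (toℕ-↑ˡ e C)) (sym (toℕ-↑ʳ M c))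
      (≤-trans (toℕ<n e) (m≤m+n M (toℕ c)))))

    -- Weights are of the form 2 ^ j ∸ 1: their bijective binary code is the unary code of j.
    logWeight : Edge → ℕ
    logWeight base      = 0
    logWeight (sel _)   = 1
    logWeight (dir _)   = suc K
    logWeight (mem _ _) = 0

    present : Edge → Bool
    present (mem c e) = hit c e
    present _         = true

    allEdges edges : List Edge
    allEdges = base ∷ map sel (allFin M) ++ map dir (allFin C) ++
               cartesianProductWith mem (allFin C) (allFin M)
    edges    = filterᵇ present allEdges

    ∈-allEdges : ∀ e → e ∈ˡ allEdges
    ∈-allEdges base      = here refl
    ∈-allEdges (sel e)   = there (∈-++⁺ˡ (∈-map⁺ sel (∈-allFin e)))
    ∈-allEdges (dir c)   = there (∈-++⁺ʳ (map sel (allFin M)) (∈-++⁺ˡ (∈-map⁺ dir (∈-allFin c))))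
    ∈-allEdges (mem c e) = there (∈-++⁺ʳ (map sel (allFin M)) (∈-++⁺ʳ (map dir (allFin C))
      (∈-cartesianProductWith⁺ mem (∈-allFin c) (∈-allFin e))))

    edges-unique : Unique edges
    edges-unique = Unique.filter⁺ (T? ∘ present) (All.tabulate distinct ∷
      Unique.++⁺ {xs = map sel (allFin M)} {map dir (allFin C) ++ mems}
        (Unique.map⁺ (λ { refl → refl }) (Unique.allFin⁺ M))
        (Unique.++⁺ {xs = map dir (allFin C)} {mems} (Unique.map⁺ (λ { refl → refl }) (Unique.allFin⁺ C))
          (Unique.cartesianProductWith⁺ mem (λ { refl → refl , refl }) (Unique.allFin⁺ C) (Unique.allFin⁺ M))
          dir-mem)
        sel-rest)
      where
      mems = cartesianProductWith mem (allFin C) (allFin M)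
      dir-mem : ∀ {v} → ¬ (v ∈ˡ map dir (allFin C) × v ∈ˡ mems)
      dir-mem (p , q) with ∈-map⁻ dir p | ∈-cartesianProductWith⁻ mem (allFin C) (allFin M) q
      ... | _ , _ , refl | _ , _ , _ , _ , ()
      sel-rest : ∀ {v} → ¬ (v ∈ˡ map sel (allFin M) × v ∈ˡ map dir (allFin C) ++ mems)
      sel-rest (p , q) with ∈-map⁻ sel p | ∈-++⁻ (map dir (allFin C)) q
      ... | _ , _ , refl | inj₁ q′ with ∈-map⁻ dir q′
      ... | _ , _ , ()
      sel-rest (p , q) | _ , _ , refl | inj₂ q′ with ∈-cartesianProductWith⁻ mem (allFin C) (allFin M) q′
      ... | _ , _ , _ , _ , ()
      distinct : ∀ {v} → v ∈ˡ map sel (allFin M) ++ map dir (allFin C) ++ mems → base ≢ v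
      distinct p refl with ∈-++⁻ (map sel (allFin M)) p
      ... | inj₁ q with ∈-map⁻ sel q
      ... | _ , _ , ()
      distinct p refl | inj₂ q with ∈-++⁻ (map dir (allFin C)) q
      ... | inj₁ r with ∈-map⁻ dir r
      ... | _ , _ , ()
      distinct p refl | inj₂ q | inj₂ r with ∈-cartesianProductWith⁻ mem (allFin C) (allFin M) r
      ... | _ , _ , _ , _ , ()

    edge : Fin (length edges) → Edge
    edge = List.lookup edges

    indexOf : ∀ e → present e ≡ true → ∃[ i ] edge i ≡ e
    indexOf e p = index e∈ , sym (lookup-index e∈)
      where e∈ = ∈-filter⁺ (T? ∘ present) (∈-allEdges e) (Equivalence.from T-≡ p)

    edge-present : ∀ i → present (edge i) ≡ true
    edge-present i = Equivalence.to T-≡ (proj₂ (∈-filter⁻ (T? ∘ present) {xs = allEdges} (∈-lookup i)))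

    graph : Graph
    graph = record
      { n       = 2 + (M + C)
      ; m       = length edges
      ; src     = position ∘ source ∘ edge
      ; tgt     = position ∘ target ∘ edge
      ; src<tgt = position-< ∘ edge
      ; simple  = λ i j s t → lookup-injective edges-unique (begin
          edge i                                             ≡⟨ edgeBetween-ends (edge i) ⟨
          edgeBetween (source (edge i)) (target (edge i))    ≡⟨ cong₂ edgeBetween (position-injective s) (position-injective t) ⟩
          edgeBetween (source (edge j)) (target (edge j))    ≡⟨ edgeBetween-ends (edge j) ⟩
          edge j                                             ∎)
      ; w       = λ i → 2 ^ logWeight (edge i) ∸ 1
      ; ℓ       = λ _ → 1
      ; ℓ≥1     = λ _ → ≤-refl
      }
      where open ≡-Reasoning

    open Graph graph using (Walk; stop; step; walkLength; Joins; Path; IsDist; IsSpanner; weight; m)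

    module _ (F : Subset m) where

      Chosen : Edge → Set
      Chosen e = ∃[ i ] (edge i ≡ e × i ∈ F)

      -- A walk knows only positions; here the end points stay vertices and can be read off the
      -- type.
      data Reach (b : ℕ) (u v : Vertex) : Set where
        within : (W : Walk F (position u) (position v)) → walkLength W ≤ b → Reach b u v

      walk : ∀ {b u v} → Reach b u v → Σ[ W ∈ Walk F (position u) (position v) ] walkLength W ≤ b
      walk (within W p) = W , p

      forth′ : ∀ e {v b} → Chosen e → Reach b (target e) v → Reach (suc b) (source e) v
      forth′ _ (i , refl , i∈F) (within W p) = within (step i i∈F (inj₁ (refl , refl)) W) (s≤s p)

      back′ : ∀ e {v b} → Chosen e → Reach b (source e) v → Reach (suc b) (target e) v
      back′ _ (i , refl , i∈F) (within W p) = within (step i i∈F (inj₂ (refl , refl)) W) (s≤s p)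

      done : ∀ {v b} → Reach b v v
      done = within stop z≤n

    connected : Graph.Connected graph
    connected u v = proj₁ (shorten graph (_++ʷ_ graph (reverseʷ graph (fromRoot u)) (fromRoot v)))
      where
      all-chosen : ∀ e → present e ≡ true → Chosen ⊤ e
      all-chosen e p = let i , eq = indexOf e p in i , eq , ∈⊤
      reach : ∀ v → Reach ⊤ 2 root v
      reach root       = done ⊤
      reach hub        = forth′ ⊤ base (all-chosen base refl) (done ⊤)
      reach (elem e)   = forth′ ⊤ (sel e) (all-chosen (sel e) refl) (done ⊤)
      reach (clause c) = forth′ ⊤ base (all-chosen base refl) (forth′ ⊤ (dir c) (all-chosen (dir c) refl) (done ⊤))
      fromRoot : ∀ v → Walk ⊤ (position root) v
      fromRoot v = subst (Walk ⊤ _) (position-vertex v) (proj₁ (walk ⊤ (reach (vertex v))))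

    bipartite : Graph.Bipartite graph
    bipartite = side ∘ vertex , λ i eq → sides-differ (edge i)
      (trans (cong side (sym (vertex-position (source (edge i)))))
        (trans eq (cong side (vertex-position (target (edge i))))))

    selIndex : Fin M → Fin m
    selIndex e = proj₁ (indexOf (sel e) refl)

    edge-selIndex : ∀ e → edge (selIndex e) ≡ sel e
    edge-selIndex e = proj₂ (indexOf (sel e) refl)

    weightIn : Subset m → Fin m → ℕ
    weightIn F i = if Vec.lookup F i then 2 ^ logWeight (edge i) ∸ 1 else 0

    weight≡ : ∀ F → weight F ≡ sum (map (weightIn F) (allFin m))
    weight≡ F = cong sum (sym (map-tabulate id (weightIn F)))

    weightIn-∈ : ∀ {F i} → i ∈ F → weightIn F i ≡ 2 ^ logWeight (edge i) ∸ 1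
    weightIn-∈ {F} {i} i∈F rewrite []=⇒lookup i∈F = refl

    solvable⇒spanner : Solvable → ∃[ F ] (IsSpanner α₃ F × weight F ≤ K)
    solvable⇒spanner (H , H≤K , hits) = F , spanner , ≤-trans weight≤ H≤K
      where
      open import Data.List.Membership.DecPropositional (Fin._≟_ {M}) using () renaming (_∈?_ to _∈ˡ?_)

      chosen : Edge → Bool
      chosen base      = true
      chosen (sel e)   = ⌊ e ∈ˡ? H ⌋
      chosen (dir _)   = false
      chosen (mem _ _) = true

      F : Subset m
      F = Vec.tabulate (chosen ∘ edge)

      choose : ∀ e → present e ≡ true → chosen e ≡ true → Chosen F e
      choose e p q = let i , eq = indexOf e p in
        i , eq , lookup⇒[]= i F (trans (lookup∘tabulate (chosen ∘ edge) i) (trans (cong chosen eq) q))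

      choose-sel : ∀ {e} → e ∈ˡ H → Chosen F (sel e)
      choose-sel {e} e∈H = choose (sel e) refl (Equivalence.to T-≡ (fromWitness {a? = e ∈ˡ? H} e∈H))

      -- Besides `base` and all `mem` edges, exactly the `sel f` with `f` in `H` are bought. The
      -- edge `sel e` takes root-f-c-e, where `c` contains `e` and `f` hits `c`; this works whether
      -- or not `e` is in `H`.
      detour : ∀ e → present e ≡ true → Reach F 3 (source e) (target e)
      detour base      p = forth′ F base (choose base refl refl) (done F)
      detour (sel e)   p =
        let c , e∈c = covered e ; f , f∈H , f∈c = hits c in
        forth′ F (sel f) (choose-sel f∈H) (forth′ F (mem c f) (choose (mem c f) f∈c refl)
          (back′ F (mem c e) (choose (mem c e) e∈c refl) (done F)))
      detour (dir c)   p =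
        let f , f∈H , f∈c = hits c in
        back′ F base (choose base refl refl) (forth′ F (sel f) (choose-sel f∈H)
          (forth′ F (mem c f) (choose (mem c f) f∈c refl) (done F)))
      detour (mem c e) p = forth′ F (mem c e) (choose (mem c e) p refl) (done F)

      spanner : IsSpanner α₃ F
      spanner u v d (((W , _) , refl) , _) =
        let d′ , dist , d′≤ = distance graph (λ _ → refl) (3 * d)
              (expand graph (λ _ → refl) {3} (λ i → walk F (detour (edge i) (edge-present i))) W)
        in d′ , dist , stretch⁺ {d′} {d} d′≤

      light : ∀ {i} → i ∈ˡ map selIndex H → weightIn F i ≤ 1
      light {i} i∈ with ∈-map⁻ selIndex i∈
      ... | e , _ , refl with Vec.lookup F (selIndex e)
      ... | true  = ≤-reflexive (cong (λ e → 2 ^ logWeight e ∸ 1) (edge-selIndex e))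
      ... | false = z≤n

      sum-≤1 : ∀ is → (∀ {i} → i ∈ˡ is → weightIn F i ≤ 1) → sum (map (weightIn F) is) ≤ length is
      sum-≤1 []       _ = z≤n
      sum-≤1 (i ∷ is) p = +-mono-≤ (p (here refl)) (sum-≤1 is (p ∘ there))

      -- `base` and `mem` edges are bought but weigh 0, and `dir` edges are not bought.
      support : ∀ i → weightIn F i ≢ 0 → i ∈ˡ map selIndex H
      support i w≢0 with Vec.lookup F i in eq
      ... | false = contradiction refl w≢0
      ... | true with edge i in eq′ | trans (sym (lookup∘tabulate (chosen ∘ edge) i)) eq
      ... | base    | _ = contradiction refl w≢0
      ... | mem _ _ | _ = contradiction refl w≢0
      ... | sel e   | chosen-e = subst (_∈ˡ map selIndex H)
        (lookup-injective edges-unique (trans (edge-selIndex e) (sym eq′)))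
        (∈-map⁺ selIndex (toWitness {a? = e ∈ˡ? H} (Equivalence.from T-≡ chosen-e)))

      weight≤ : weight F ≤ length H
      weight≤ = begin
        weight F                                 ≡⟨ weight≡ F ⟩
        sum (map (weightIn F) (allFin m))        ≤⟨ sum-mono-support (weightIn F) (Unique.allFin⁺ m) (λ {i} _ → support i) ⟩
        sum (map (weightIn F) (map selIndex H))  ≤⟨ sum-≤1 (map selIndex H) light ⟩
        length (map selIndex H)                  ≡⟨ length-map selIndex H ⟩
        length H                                 ∎
        where open ≤-Reasoning

    spanner⇒solvable : ∃[ F ] (IsSpanner α₃ F × weight F ≤ K) → Solvable
    spanner⇒solvable (F , spanner , weight≤K) = H , H≤K , hits
      where
      H : List (Fin M)
      H = filter (λ e → selIndex e ∈? F) (allFin M)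

      sum≤K : ∀ {is} → Unique is → sum (map (weightIn F) is) ≤ K
      sum≤K {is} u = ≤-trans (sum-mono-support (weightIn F) {allFin m} u (λ {i} _ _ → ∈-allFin i))
                       (≤-trans (≤-reflexive (sym (weight≡ F))) weight≤K)

      selIndex-injective : ∀ {e f} → selIndex e ≡ selIndex f → e ≡ f
      selIndex-injective {e} {f} eq
        with trans (sym (edge-selIndex e)) (trans (cong edge eq) (edge-selIndex f))
      ... | refl = refl

      H≤K : length H ≤ K
      H≤K = begin
        length H                                 ≡⟨ length-map selIndex H ⟨
        length (map selIndex H)                  ≡⟨ *-identityʳ _ ⟨
        length (map selIndex H) * 1              ≡⟨ sum-map-const (weightIn F) 1 (map selIndex H) one ⟨
        sum (map (weightIn F) (map selIndex H))  ≤⟨ sum≤K (Unique.map⁺ selIndex-injective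
                                                       (Unique.filter⁺ (λ e → selIndex e ∈? F) (Unique.allFin⁺ M))) ⟩
        K                                        ∎
        where
        open ≤-Reasoning
        one : ∀ {i} → i ∈ˡ map selIndex H → weightIn F i ≡ 1
        one i∈ with ∈-map⁻ selIndex i∈
        ... | e , e∈H , refl = trans
          (weightIn-∈ {F} (proj₂ (∈-filter⁻ (λ e → selIndex e ∈? F) {xs = allFin M} e∈H)))
          (cong (λ e → 2 ^ logWeight e ∸ 1) (edge-selIndex e))

      -- A single such edge weighs `2 ^ suc K ∸ 1`, which is at least `suc K` and exceeds the
      -- budget.
      dir-not-chosen : ∀ c → ¬ Chosen F (dir c)
      dir-not-chosen c (i , eq , i∈F) = <-irrefl refl (begin
        suc K                                    ≤⟨ ∸-monoˡ-≤ 1 (n<2^n (suc K)) ⟩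
        2 ^ suc K ∸ 1                            ≡⟨ cong (λ e → 2 ^ logWeight e ∸ 1) eq ⟨
        2 ^ logWeight (edge i) ∸ 1               ≡⟨ weightIn-∈ {F} i∈F ⟨
        weightIn F i                             ≡⟨ +-identityʳ _ ⟨
        sum (map (weightIn F) (i ∷ []))          ≤⟨ sum≤K ([] ∷ []) ⟩
        K                                        ∎)
        where open ≤-Reasoning

      -- There is no constructor for `dir`, as it cannot be bought. Evidence is attached only where
      -- a short walk from hub to a clause has to pass: from root to an element and from an element
      -- to a clause.
      data Neighbour : Vertex → Vertex → Set where
        base⁺ : Neighbour root hub
        base⁻ : Neighbour hub root
        sel⁺  : ∀ {e} → Chosen F (sel e) → Neighbour root (elem e)
        sel⁻  : ∀ {e} → Neighbour (elem e) root
        mem⁺  : ∀ {c e} → hit c e ≡ true → Neighbour (elem e) (clause c)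
        mem⁻  : ∀ {c e} → Neighbour (clause c) (elem e)

      along : ∀ e → Chosen F e → present e ≡ true → Neighbour (source e) (target e)
      along base      _ _ = base⁺
      along (sel _)   d _ = sel⁺ d
      along (dir c)   d _ = ⊥-elim (dir-not-chosen c d)
      along (mem _ _) _ p = mem⁺ p

      against : ∀ e → Chosen F e → Neighbour (target e) (source e)
      against base      _ = base⁻
      against (sel _)   _ = sel⁻
      against (dir c)   d = ⊥-elim (dir-not-chosen c d)
      against (mem _ _) _ = mem⁻

      neighbour : ∀ {u v} i → i ∈ F → Joins i u v → Neighbour (vertex u) (vertex v)
      neighbour i i∈F (inj₁ (refl , refl)) = subst₂ Neighbour (sym (vertex-position _)) (sym (vertex-position _))
        (along (edge i) (i , refl , i∈F) (edge-present i))
      neighbour i i∈F (inj₂ (refl , refl)) = subst₂ Neighbour (sym (vertex-position _)) (sym (vertex-position _))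
        (against (edge i) (i , refl , i∈F))

      Hit : Fin C → Set
      Hit c = ∃[ e ] (e ∈ˡ H × hit c e ≡ true)

      -- From hub the only step leads to root, and a clause is entered only from an element, so the
      -- middle step is a bought edge root-element.
      after-three : ∀ {c x y} → Neighbour hub x → Neighbour x y → Neighbour y (clause c) → Hit c
      after-three base⁻ (sel⁺ {e} (i , eq , i∈F)) (mem⁺ e∈c) =
        e , ∈-filter⁺ (λ e → selIndex e ∈? F) (∈-allFin e)
              (subst (_∈ F) (lookup-injective edges-unique (trans eq (sym (edge-selIndex e)))) i∈F) , e∈c

      after-two : ∀ {c x} → Neighbour hub x → ¬ Neighbour x (clause c)
      after-two base⁻ ()

      after-one : ∀ {c} → ¬ Neighbour hub (clause c)
      after-one ()

      analyse : ∀ {c u v} (W : Walk F u v) → walkLength W ≤ 3 → vertex u ≡ hub → vertex v ≡ clause c → Hit c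
      analyse stop _ u≡ v≡ with trans (sym u≡) v≡
      ... | ()
      analyse (step i i∈F j stop) _ u≡ v≡ =
        ⊥-elim (after-one (subst₂ Neighbour u≡ v≡ (neighbour i i∈F j)))
      analyse (step i i∈F j (step i′ i′∈F j′ stop)) _ u≡ v≡ =
        ⊥-elim (after-two (subst (λ u → Neighbour u _) u≡ (neighbour i i∈F j))
                          (subst (Neighbour _) v≡ (neighbour i′ i′∈F j′)))
      analyse (step i i∈F j (step i′ i′∈F j′ (step i″ i″∈F j″ stop))) _ u≡ v≡ =
        after-three (subst (λ u → Neighbour u _) u≡ (neighbour i i∈F j)) (neighbour i′ i′∈F j′)
          (subst (Neighbour _) v≡ (neighbour i″ i″∈F j″))
      analyse (step _ _ _ (step _ _ _ (step _ _ _ (step _ _ _ _)))) (s≤s (s≤s (s≤s ()))) _ _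

      hits : ∀ c → Hit c
      hits c =
        let i , eq = indexOf (dir c) refl
            joins : Joins i (position hub) (position (clause c))
            joins = inj₁ (cong (position ∘ source) eq , cong (position ∘ target) eq)
            nonempty : (P : Path ⊤ (position hub) (position (clause c))) → 1 ≤ Graph.pathLength graph P
            nonempty = λ { (step _ _ _ _ , _) → s≤s z≤n }
            -- The expensive edge itself shows that hub and clause have distance 1 in the full
            -- graph, so the spanner joins them by a path of length at most 3.
            d′ , ((W , eq′) , _) , d′≤ = spanner (position hub) (position (clause c)) 1
              (((step i ∈⊤ joins stop , ((λ ()) ∷ []) ∷ [] ∷ []) , refl) , nonempty)
        in analyse (proj₁ W) (≤-trans (≤-reflexive eq′) (stretch⁻ {d = 1} d′≤)) refl (vertex-position (clause c))

    instance′ : SpannerInstance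
    instance′ = record
      { graph = graph ; connected = connected ; α = α₃ ; α≥1 = 1≤α₃ ; W = K }

    restricted : Restricted α₃ instance′
    restricted = (λ _ → refl) , bipartite , refl , 0 , 1 , 2 ^ suc K ∸ 1 , λ i → weights (edge i)
      where
      weights : ∀ e → 2 ^ logWeight e ∸ 1 ≡ 0 ⊎ 2 ^ logWeight e ∸ 1 ≡ 1 ⊎ 2 ^ logWeight e ∸ 1 ≡ 2 ^ suc K ∸ 1
      weights base      = inj₁ refl
      weights (sel _)   = inj₂ (inj₁ refl)
      weights (dir _)   = inj₂ (inj₂ refl)
      weights (mem _ _) = inj₁ refl

-- Chains as the solutions of a hitting set instance.

module Chains where

  open UnitLengthGraphs
  open HittingSets
  open import Data.Bool using (Bool; true; false; if_then_else_; not; _∧_; _∨_)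
  open import Data.Bool.ListAction using (any; all)
  open import Data.Fin using (Fin)
  open import Data.List as List using (List; []; _∷_; length; map; allFin; cartesianProductWith; cartesianProduct; _++_; filter; upTo)
  open import Data.List.Properties using (filter-notAll; length-++; length-map; length-tabulate)
  open import Data.List.Membership.Propositional using () renaming (_∈_ to _∈ˡ_)
  open import Data.List.Membership.Propositional.Properties
  open import Data.List.Relation.Unary.All using ([]; _∷_)
  open import Data.List.Relation.Unary.AllPairs using ([]; _∷_)
  open import Data.List.Relation.Unary.Any as Any using (here; there; index)
  open import Data.List.Relation.Unary.Any.Properties using (lookup-index)
  open import Data.List.Relation.Unary.Unique.Propositional using (Unique)
  import Data.List.Relation.Unary.Unique.Propositional.Properties as Unique
  open import Data.Nat
  open import Data.Nat.Properties
  open import Data.Product using (∃-syntax; _×_; _,_; proj₁; proj₂)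
  open import Data.Product.Properties using (≡-dec)
  open import Data.Sum using (_⊎_; inj₁; inj₂)
  open import Data.Vec as Vec using (Vec; []; _∷_; lookup; toList)
  import Data.Vec.Properties as Vec
  open import Function using (_∘_; id)
  open import Relation.Binary.PropositionalEquality
  open import Relation.Binary.Definitions using (tri<; tri≈; tri>)
  open import Relation.Nullary using (Dec; yes; no; ¬_; contradiction; ¬?)

  ∧-true : ∀ {a b} → a ∧ b ≡ true → a ≡ true × b ≡ true
  ∧-true {true} eq = refl , eq

  ∨-true : ∀ {a b} → a ∨ b ≡ true → a ≡ true ⊎ b ≡ true
  ∨-true {true}  _  = inj₁ refl
  ∨-true {false} eq = inj₂ eq

  ∨-trueʳ : ∀ a {b} → b ≡ true → a ∨ b ≡ true
  ∨-trueʳ true  _  = refl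
  ∨-trueʳ false eq = eq

  not-true : ∀ {a} → not a ≡ true → a ≢ true
  not-true {true} ()
  not-true {false} _ ()

  true-not : ∀ {a} → a ≢ true → not a ≡ true
  true-not {true}  p = contradiction refl p
  true-not {false} _ = refl

  <ᵇ-true : ∀ {m n} → m < n → (m <ᵇ n) ≡ true
  <ᵇ-true {zero}  (s≤s _) = refl
  <ᵇ-true {suc m} (s≤s p) = <ᵇ-true p

  true-<ᵇ : ∀ m n → (m <ᵇ n) ≡ true → m < n
  true-<ᵇ zero    (suc n) _  = s≤s z≤n
  true-<ᵇ (suc m) (suc n) eq = s≤s (true-<ᵇ m n eq)

  ≡ᵇ-true : ∀ {m n} → m ≡ n → (m ≡ᵇ n) ≡ true
  ≡ᵇ-true {zero}  refl = refl
  ≡ᵇ-true {suc m} refl = ≡ᵇ-true {m} refl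

  true-≡ᵇ : ∀ m n → (m ≡ᵇ n) ≡ true → m ≡ n
  true-≡ᵇ zero    zero    _  = refl
  true-≡ᵇ (suc m) (suc n) eq = cong suc (true-≡ᵇ m n eq)

  module _ {A : Set} {p : A → Bool} where

    any-true : ∀ {x xs} → x ∈ˡ xs → p x ≡ true → any p xs ≡ true
    any-true {xs = x ∷ xs} (here refl) eq rewrite eq = refl
    any-true {xs = x ∷ xs} (there x∈)  eq = ∨-trueʳ (p x) (any-true x∈ eq)

    true-any : ∀ xs → any p xs ≡ true → ∃[ x ] (x ∈ˡ xs × p x ≡ true)
    true-any (x ∷ xs) eq with ∨-true {p x} eq
    ... | inj₁ px = x , here refl , px
    ... | inj₂ rest = let y , y∈ , py = true-any xs rest in y , there y∈ , py

    all-true : ∀ xs → (∀ {x} → x ∈ˡ xs → p x ≡ true) → all p xs ≡ true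
    all-true []       _ = refl
    all-true (x ∷ xs) f rewrite f (here refl) = all-true xs (f ∘ there)

    true-all : ∀ {x xs} → all p xs ≡ true → x ∈ˡ xs → p x ≡ true
    true-all eq (here refl) = proj₁ (∧-true eq)
    true-all {xs = y ∷ _} eq (there x∈) = true-all (proj₂ (∧-true {p y} eq)) x∈

  ∈-toList-map : ∀ {A B : Set} {n} (f : A → B) {x} (v : Vec A n) → x ∈ˡ toList v → f x ∈ˡ toList (Vec.map f v)
  ∈-toList-map f v x∈ = subst (f _ ∈ˡ_) (sym (Vec.toList-map f v)) (∈-map⁺ f x∈)

  ∈-toList-map⁻ : ∀ {A B : Set} {n} (f : A → B) {y} (v : Vec A n) → y ∈ˡ toList (Vec.map f v) →
                  ∃[ x ] (x ∈ˡ toList v × y ≡ f x)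
  ∈-toList-map⁻ f v y∈ = ∈-map⁻ f (subst (_ ∈ˡ_) (Vec.toList-map f v) y∈)

  eqVec : ∀ {d} → Vec ℕ d → Vec ℕ d → Bool
  eqVec []       []       = true
  eqVec (x ∷ xs) (y ∷ ys) = (x ≡ᵇ y) ∧ eqVec xs ys

  eqVec-true : ∀ {d} {v w : Vec ℕ d} → v ≡ w → eqVec v w ≡ true
  eqVec-true {v = []}    refl = refl
  eqVec-true {v = x ∷ v} refl rewrite ≡ᵇ-true {x} refl = eqVec-true {v = v} refl

  true-eqVec : ∀ {d} (v w : Vec ℕ d) → eqVec v w ≡ true → v ≡ w
  true-eqVec []       []       _  = refl
  true-eqVec (x ∷ xs) (y ∷ ys) eq =
    cong₂ _∷_ (true-≡ᵇ x y (proj₁ (∧-true eq))) (true-eqVec xs ys (proj₂ (∧-true {x ≡ᵇ y} eq)))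

  tuples : {A : Set} → ∀ d → List A → List (Vec A d)
  tuples zero    D = [] ∷ []
  tuples (suc d) D = cartesianProductWith _∷_ D (tuples d D)

  module _ {A : Set} {D : List A} where

    ∈-tuples : ∀ {d} {v : Vec A d} → (∀ {x} → x ∈ˡ toList v → x ∈ˡ D) → v ∈ˡ tuples d D
    ∈-tuples {v = []}    _  = here refl
    ∈-tuples {v = x ∷ v} v⊆ = ∈-cartesianProductWith⁺ _∷_ (v⊆ (here refl)) (∈-tuples (v⊆ ∘ there))

    tuples-⊆ : ∀ d {v : Vec A d} → v ∈ˡ tuples d D → ∀ {x} → x ∈ˡ toList v → x ∈ˡ D
    tuples-⊆ zero    {[]} _ ()
    tuples-⊆ (suc d) v∈ x∈ with ∈-cartesianProductWith⁻ _∷_ D (tuples d D) v∈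
    tuples-⊆ (suc d) v∈ (here refl) | _ , _ , y∈ , _  , refl = y∈
    tuples-⊆ (suc d) v∈ (there x∈)  | _ , _ , _  , w∈ , refl = tuples-⊆ d w∈ x∈

    tuples-unique : ∀ d → Unique D → Unique (tuples d D)
    tuples-unique zero    _ = [] ∷ []
    tuples-unique (suc d) u = Unique.cartesianProductWith⁺ _∷_ (λ { refl → refl , refl }) u (tuples-unique d u)

    length-tuples : ∀ d → length (tuples d D) ≡ length D ^ d
    length-tuples zero    = refl
    length-tuples (suc d) = trans (lemma D) (cong (length D *_) (length-tuples d))
      where
      lemma : ∀ E → length (cartesianProductWith _∷_ E (tuples d D)) ≡ length E * length (tuples d D)
      lemma []      = refl
      lemma (x ∷ E) = trans (length-++ (map (x ∷_) (tuples d D)))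
        (cong₂ _+_ (length-map (x ∷_) (tuples d D)) (lemma E))

  module _ {X Y : Set} (xs : List X) (ys : List Y) (hits : Y → X → Bool) (K : ℕ)
           (covered : ∀ {x} → x ∈ˡ xs → ∃[ y ] (y ∈ˡ ys × hits y x ≡ true)) where

    hittingSet : HittingSet
    hittingSet = record
      { M = length xs ; C = length ys
      ; hit = λ c e → hits (List.lookup ys c) (List.lookup xs e)
      ; covered = λ e → let y , y∈ , y-hit = covered (∈-lookup e) in
          index y∈ , subst (λ y → hits y (List.lookup xs e) ≡ true) (lookup-index y∈) y-hit
      ; K = K }

    ListSolution : List X → Set
    ListSolution H = (∀ {x} → x ∈ˡ H → x ∈ˡ xs) × length H ≤ K ×
                     (∀ {y} → y ∈ˡ ys → ∃[ x ] (x ∈ˡ H × hits y x ≡ true))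

    fromListSolution : ∀ {H} → ListSolution H → HittingSet.Solvable hittingSet
    fromListSolution {H} (H⊆ , H≤ , hit) =
      map locate (allFin (length H)) ,
      ≤-trans (≤-reflexive (trans (length-map locate (allFin (length H))) (length-tabulate id))) H≤ ,
      λ c → let x , x∈ , x-hit = hit (∈-lookup c) in
        locate (index x∈) , ∈-map⁺ locate (∈-allFin (index x∈)) ,
        subst (λ x → hits (List.lookup ys c) x ≡ true)
          (trans (lookup-index x∈) (lookup-index (H⊆ (∈-lookup (index x∈))))) x-hit
      where
      locate : Fin (length H) → Fin (length xs)
      locate i = index (H⊆ (∈-lookup i))

    toListSolution : HittingSet.Solvable hittingSet → ∃[ H ] ListSolution H
    toListSolution (H , H≤ , hit) = map (List.lookup xs) H ,
      (λ x∈ → let e , _ , eq = ∈-map⁻ (List.lookup xs) x∈ in subst (_∈ˡ xs) (sym eq) (∈-lookup e)) ,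
      ≤-trans (≤-reflexive (length-map (List.lookup xs) H)) H≤ ,
      λ y∈ → let e , e∈ , e-hit = hit (index y∈) in
        List.lookup xs e , ∈-map⁺ (List.lookup xs) e∈ ,
        subst (λ y → hits y (List.lookup xs e) ≡ true) (sym (lookup-index y∈)) e-hit

  Point : Set
  Point = ℕ × ℕ

  slot values : ∀ {d} → Vec Point d → Vec ℕ d
  slot   = Vec.map proj₁
  values = Vec.map proj₂

  slot-values-injective : ∀ {d} {e f : Vec Point d} → slot e ≡ slot f → values e ≡ values f → e ≡ f
  slot-values-injective {e = []}    {[]}    _  _  = refl
  slot-values-injective {e = _ ∷ _} {_ ∷ _} p q =
    cong₂ _∷_ (cong₂ _,_ (Vec.∷-injectiveˡ p) (Vec.∷-injectiveˡ q))
      (slot-values-injective (Vec.∷-injectiveʳ p) (Vec.∷-injectiveʳ q))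

  graphOf : (ℕ → ℕ) → ∀ {d} → Vec ℕ d → Vec Point d
  graphOf σ = Vec.map (λ i → i , σ i)

  slot-graphOf : ∀ σ {d} (J : Vec ℕ d) → slot (graphOf σ J) ≡ J
  slot-graphOf σ J = trans (sym (Vec.map-∘ proj₁ (λ i → i , σ i) J)) (Vec.map-id J)

  iffᵇ : Bool → Bool → Bool
  iffᵇ b c = if b then c else not c

  -- The indices have to compare as the values do. For equal indices this forces equal values, so a
  -- set of points that satisfies it pairwise is the graph of a strictly increasing partial
  -- function.
  sameOrder : Point → Point → Bool
  sameOrder (i , u) (j , v) = iffᵇ (i <ᵇ j) (u <ᵇ v) ∧ iffᵇ (j <ᵇ i) (v <ᵇ u)

  compatible : ∀ {d} → Vec Point d → Vec Point d → Bool
  compatible e f = all (λ p → all (sameOrder p) (toList f)) (toList e)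

  iffᵇ-⇒ : ∀ {b c} → iffᵇ b c ≡ true → b ≡ true → c ≡ true
  iffᵇ-⇒ {true} eq _ = eq

  iffᵇ-⇐ : ∀ {b c} → iffᵇ b c ≡ true → c ≡ true → b ≡ true
  iffᵇ-⇐ {true}         eq _ = refl
  iffᵇ-⇐ {false} {true} () _

  iffᵇ-true : ∀ {b c} → (b ≡ true → c ≡ true) → (c ≡ true → b ≡ true) → iffᵇ b c ≡ true
  iffᵇ-true {true}          p _ = p refl
  iffᵇ-true {false} {true}  _ q with q refl
  ... | ()
  iffᵇ-true {false} {false} _ _ = refl

  sameOrder-< : ∀ {i u j v} → sameOrder (i , u) (j , v) ≡ true → i < j → u < v
  sameOrder-< {i} {u} {j} {v} eq i<j = true-<ᵇ u v (iffᵇ-⇒ (proj₁ (∧-true eq)) (<ᵇ-true i<j))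

  sameOrder-≡ : ∀ {i u v} → sameOrder (i , u) (i , v) ≡ true → u ≡ v
  sameOrder-≡ {i} {u} {v} eq with <-cmp u v
  ... | tri≈ _ u≡v _ = u≡v
  ... | tri< u<v _ _ = contradiction (true-<ᵇ i i (iffᵇ-⇐ (proj₁ (∧-true eq)) (<ᵇ-true u<v))) (<-irrefl refl)
  ... | tri> _ _ v<u = contradiction (true-<ᵇ i i (iffᵇ-⇐ (proj₂ (∧-true {iffᵇ (i <ᵇ i) (u <ᵇ v)} eq)) (<ᵇ-true v<u))) (<-irrefl refl)

  -- The indices 0 and k + 1 and the values 0 and N + 1 make room for the sentinels. Vectors have
  -- `suc d` entries, so that even for `d = 0` there is a point whose value can be read off or
  -- varied.
  module Grid (k N d : ℕ) where

    indices : List ℕ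
    indices = upTo (2 + k)

    points : List Point
    points = cartesianProduct indices (upTo (2 + N))

    slots : List (Vec ℕ (suc d))
    slots = tuples (suc d) indices

    elements : List (Vec Point (suc d))
    elements = tuples (suc d) points

  data Clause (P : Set) (d : ℕ) : Set where
    link    : Vec Point (suc d) → Vec ℕ (suc d) → Clause P d
    require : P → Clause P d

  -- `link e J` expresses the implication from the selection of `e` to that of something compatible
  -- with `e` in slot `J`. Its premise is negated by the first alternative, which is adequate once
  -- each slot holds a single selected element.
  hits : {P : Set} {d : ℕ} → (P → Vec Point (suc d) → Bool) → Clause P d → Vec Point (suc d) → Bool
  hits test (link e J)  f = (eqVec (slot f) (slot e) ∧ not (eqVec (values f) (values e)))
                          ∨ (eqVec (slot f) J ∧ compatible e f)
  hits test (require x) f = test x f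

  module _ {P : Set} (k N d : ℕ) (reqs : List P) (test : P → Vec Point (suc d) → Bool) where
    open Grid k N d

    clauses : List (Clause P d)
    clauses = cartesianProductWith link elements slots ++ map require reqs

    ∈-link : ∀ {e J} → e ∈ˡ elements → J ∈ˡ slots → link e J ∈ˡ clauses
    ∈-link e∈ J∈ = ∈-++⁺ˡ (∈-cartesianProductWith⁺ link e∈ J∈)

    ∈-require : ∀ {x} → x ∈ˡ reqs → require x ∈ˡ clauses
    ∈-require x∈ = ∈-++⁺ʳ _ (∈-map⁺ require x∈)

    point-bounds : ∀ {i u} → (i , u) ∈ˡ points → i < 2 + k × u < 2 + N
    point-bounds p∈ = let i∈ , u∈ = ∈-cartesianProduct⁻ indices (upTo (2 + N)) p∈ in ∈-upTo⁻ i∈ , ∈-upTo⁻ u∈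

    slot-∈ : ∀ {e} → e ∈ˡ elements → slot e ∈ˡ slots
    slot-∈ {e} e∈ = ∈-tuples λ i∈ → let p , p∈ , eq = ∈-toList-map⁻ proj₁ e i∈ in
      subst (_∈ˡ indices) (sym eq) (∈-upTo⁺ (proj₁ (point-bounds (tuples-⊆ (suc d) e∈ p∈))))

    graph-∈ : ∀ (σ : ℕ → ℕ) → (∀ {i} → i < 2 + k → σ i < 2 + N) → ∀ {J} → J ∈ˡ slots → graphOf σ J ∈ˡ elements
    graph-∈ σ bounded {J} J∈ = ∈-tuples λ p∈ → let i , i∈ , eq = ∈-toList-map⁻ (λ i → i , σ i) J p∈
                                                   i<  = ∈-upTo⁻ (tuples-⊆ (suc d) J∈ i∈) in
      subst (_∈ˡ points) (sym eq) (∈-cartesianProduct⁺ (∈-upTo⁺ i<) (∈-upTo⁺ (bounded i<)))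

    elements-covered : ∀ {f} → f ∈ˡ elements → ∃[ c ] (c ∈ˡ clauses × hits test c f ≡ true)
    elements-covered {f@((i , u) ∷ f′)} f∈ = link e (slot f) , ∈-link e∈ (slot-∈ f∈) , hit
      where
      -- f satisfies the clauses of every element that has the same slot but other values
      other : ℕ → ℕ
      other zero    = 1
      other (suc _) = 0
      other≢ : ∀ u → u ≢ other u
      other≢ zero    ()
      other≢ (suc _) ()
      other< : ∀ u → other u < 2 + N
      other< zero    = s≤s (s≤s z≤n)
      other< (suc _) = s≤s z≤n
      e : Vec Point (suc d)
      e = (i , other u) ∷ f′
      e∈ : e ∈ˡ elements
      e∈ = ∈-tuples λ where
        (here refl) → ∈-cartesianProduct⁺ (∈-upTo⁺ (proj₁ (point-bounds (tuples-⊆ (suc d) f∈ (here refl))))) (∈-upTo⁺ (other< u))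
        (there p∈)  → tuples-⊆ (suc d) f∈ (there p∈)
      hit : hits test (link e (slot f)) f ≡ true
      hit rewrite eqVec-true {v = slot f} {slot e} refl
                | true-not {eqVec (values f) (values e)} (λ eq → other≢ u (Vec.∷-injectiveˡ (true-eqVec (values f) (values e) eq))) = refl

    chainHittingSet : HittingSet
    chainHittingSet = hittingSet elements clauses (hits test) (length slots) elements-covered

    record Chain (σ : ℕ → ℕ) : Set where
      field
        increasing : ∀ {i j} → i < j → j < 2 + k → σ i < σ j
        bounded    : ∀ {i} → i < 2 + k → σ i < 2 + N

    open Chain

    sameOrder-chain : ∀ {σ} → Chain σ → ∀ {i j} → i < 2 + k → j < 2 + k → sameOrder (i , σ i) (j , σ j) ≡ true
    sameOrder-chain {σ} chain {i} {j} i< j< =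
      cong₂ _∧_ (iffᵇ-true (λ eq → <ᵇ-true (increasing chain (true-<ᵇ i j eq) j<)) (λ eq → <ᵇ-true (reflects j i i< (true-<ᵇ _ _ eq))))
                (iffᵇ-true (λ eq → <ᵇ-true (increasing chain (true-<ᵇ j i eq) i<)) (λ eq → <ᵇ-true (reflects i j j< (true-<ᵇ _ _ eq))))
      where
      reflects : ∀ j i → i < 2 + k → σ i < σ j → i < j
      reflects j i i< σ< with <-cmp i j
      ... | tri< i<j _ _  = i<j
      ... | tri≈ _ refl _ = contradiction σ< (<-irrefl refl)
      ... | tri> _ _ j<i  = contradiction σ< (<-asym (increasing chain j<i i<))

    -- The graph of σ over each slot is selected, one element per slot. For `link e J`, either σ
    -- differs from `e` on the slot of `e` and the first alternative applies, or `e` lies on σ and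
    -- is compatible with the graph over `J`.
    chain⇒solvable : ∀ {σ} → Chain σ →
      (∀ {x} → x ∈ˡ reqs → ∃[ J ] (J ∈ˡ slots × test x (graphOf σ J) ≡ true)) →
      HittingSet.Solvable chainHittingSet
    chain⇒solvable {σ} chain passes = fromListSolution elements clauses (hits test) (length slots) elements-covered
      {map (graphOf σ) slots} (H⊆ , ≤-reflexive (length-map (graphOf σ) slots) , hit)
      where
      H⊆ : ∀ {f} → f ∈ˡ map (graphOf σ) slots → f ∈ˡ elements
      H⊆ f∈ = let J , J∈ , eq = ∈-map⁻ (graphOf σ) f∈ in
        subst (_∈ˡ elements) (sym eq) (graph-∈ σ (bounded chain) J∈)

      in-range : ∀ {J} → J ∈ˡ slots → ∀ {p} → p ∈ˡ toList (graphOf σ J) → ∃[ i ] (p ≡ (i , σ i) × i < 2 + k)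
      in-range {J} J∈ p∈ = let i , i∈ , eq = ∈-toList-map⁻ (λ i → i , σ i) J p∈ in
        i , eq , ∈-upTo⁻ (tuples-⊆ (suc d) J∈ i∈)

      compatible-graphs : ∀ {I J} → I ∈ˡ slots → J ∈ˡ slots → compatible (graphOf σ I) (graphOf σ J) ≡ true
      compatible-graphs {I} {J} I∈ J∈ = all-true (toList (graphOf σ I)) λ p∈ → all-true (toList (graphOf σ J)) λ q∈ →
        let i , p≡ , i< = in-range I∈ p∈ ; j , q≡ , j< = in-range J∈ q∈ in
        subst₂ (λ p q → sameOrder p q ≡ true) (sym p≡) (sym q≡) (sameOrder-chain chain i< j<)

      hit : ∀ {c} → c ∈ˡ clauses → ∃[ f ] (f ∈ˡ map (graphOf σ) slots × hits test c f ≡ true)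
      hit c∈ with ∈-++⁻ (cartesianProductWith link elements slots) c∈
      ... | inj₂ c∈′ with ∈-map⁻ require c∈′
      ...   | x , x∈ , refl = let J , J∈ , ok = passes x∈ in graphOf σ J , ∈-map⁺ (graphOf σ) J∈ , ok
      hit c∈ | inj₁ c∈′ with ∈-cartesianProductWith⁻ link elements slots c∈′
      ... | e , J , e∈ , J∈ , refl with Vec.≡-dec _≟_ (values (graphOf σ (slot e))) (values e)
      ...   | no ≢values = graphOf σ (slot e) , ∈-map⁺ (graphOf σ) (slot-∈ e∈) , ok
        where
        ok : hits test (link e J) (graphOf σ (slot e)) ≡ true
        ok rewrite eqVec-true (slot-graphOf σ (slot e))
                 | true-not {eqVec (values (graphOf σ (slot e))) (values e)} (≢values ∘ true-eqVec _ _) = refl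
      ...   | yes ≡values = graphOf σ J , ∈-map⁺ (graphOf σ) J∈ , ∨-trueʳ _ ok
        where
        ok : eqVec (slot (graphOf σ J)) J ∧ compatible e (graphOf σ J) ≡ true
        ok = cong₂ _∧_ (eqVec-true (slot-graphOf σ J))
          (subst (λ e → compatible e (graphOf σ J) ≡ true)
            (slot-values-injective (slot-graphOf σ (slot e)) ≡values)
            (compatible-graphs (slot-∈ e∈) J∈))

    solvable⇒chain : HittingSet.Solvable chainHittingSet → ∃[ σ ] (Chain σ ×
      (∀ {x} → x ∈ˡ reqs → ∃[ J ] (J ∈ˡ slots × test x (graphOf σ J) ≡ true)))
    solvable⇒chain solvable with toListSolution elements clauses (hits test) (length slots) elements-covered solvable
    ... | H , H⊆ , H≤ , hit = σ , chain , passes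
      where
      _≟ᵖ_ : (e f : Vec Point (suc d)) → Dec (e ≡ f)
      _≟ᵖ_ = Vec.≡-dec (≡-dec _≟_ _≟_)

      -- The element with slot `J` and all values 0 acts as a probe: both alternatives of its clause
      -- with target `J` select something in slot `J`.
      selected : ∀ {J} → J ∈ˡ slots → ∃[ f ] (f ∈ˡ H × slot f ≡ J)
      selected {J} J∈ with hit (∈-link (graph-∈ (λ _ → 0) (λ _ → s≤s z≤n) J∈) J∈)
      ... | f , f∈ , f-hit with ∨-true f-hit
      ...   | inj₁ eq = f , f∈ , trans (true-eqVec _ _ (proj₁ (∧-true eq))) (slot-graphOf _ J)
      ...   | inj₂ eq = f , f∈ , true-eqVec _ _ (proj₁ (∧-true eq))

      -- H meets each of the |H| slots, hence meets it only once.
      slot-injective : ∀ {e f} → e ∈ˡ H → f ∈ˡ H → slot e ≡ slot f → e ≡ f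
      slot-injective {e} {f} e∈ f∈ eq with e ≟ᵖ f
      ... | yes e≡f = e≡f
      ... | no  e≢f = contradiction (begin-strict
          length slots                       ≤⟨ unique-length (tuples-unique (suc d) (Unique.upTo⁺ (2 + k))) slots⊆ ⟩
          length (map slot rest)             ≡⟨ length-map slot rest ⟩
          length rest                        <⟨ filter-notAll (λ g → ¬? (g ≟ᵖ e)) H (Any.map (λ { refl ¬≡ → ¬≡ refl }) e∈) ⟩
          length H                           ≤⟨ H≤ ⟩
          length slots                       ∎) (<-irrefl refl)
        where
        open ≤-Reasoning
        rest : List (Vec Point (suc d))
        rest = filter (λ g → ¬? (g ≟ᵖ e)) H
        slots⊆ : ∀ {J} → J ∈ˡ slots → J ∈ˡ map slot rest
        slots⊆ J∈ with selected J∈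
        ... | g , g∈ , refl with g ≟ᵖ e
        ...   | no  g≢e  = ∈-map⁺ slot (∈-filter⁺ (λ g → ¬? (g ≟ᵖ e)) g∈ g≢e)
        ...   | yes refl = subst (_∈ˡ map slot rest) (sym eq)
                             (∈-map⁺ slot (∈-filter⁺ (λ g → ¬? (g ≟ᵖ e)) f∈ (e≢f ∘ sym)))

      -- In the clause that links `e` to the slot of `f`, the first alternative is impossible: the
      -- element found would have the slot of `e`, hence be `e`, and yet have other values. By the
      -- second one, the element found has the slot of `f`, hence is `f`.
      compatible-H : ∀ {e f} → e ∈ˡ H → f ∈ˡ H → compatible e f ≡ true
      compatible-H {e} {f} e∈ f∈ with hit (∈-link (H⊆ e∈) (slot-∈ (H⊆ f∈)))
      ... | g , g∈ , g-hit with ∨-true g-hit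
      ...   | inj₂ eq = subst (λ g → compatible e g ≡ true)
                          (slot-injective g∈ f∈ (true-eqVec _ _ (proj₁ (∧-true eq))))
                          (proj₂ (∧-true {eqVec (slot g) (slot f)} eq))
      ...   | inj₁ eq with slot-injective g∈ e∈ (true-eqVec _ _ (proj₁ (∧-true eq)))
      ...     | refl = contradiction (eqVec-true {v = values e} refl)
                         (not-true (proj₂ (∧-true {eqVec (slot e) (slot e)} eq)))

      ordered : ∀ {e f p q} → e ∈ˡ H → f ∈ˡ H → p ∈ˡ toList e → q ∈ˡ toList f → sameOrder p q ≡ true
      ordered e∈ f∈ p∈ q∈ = true-all (true-all (compatible-H e∈ f∈) p∈) q∈

      constant-∈ : ∀ {i} → i < 2 + k → Vec.replicate (suc d) i ∈ˡ slots
      constant-∈ {i} i< = ∈-tuples λ j∈ → subst (_∈ˡ indices) (sym (∈-replicate (suc d) j∈)) (∈-upTo⁺ i<)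
        where
        ∈-replicate : ∀ n {j} → j ∈ˡ toList (Vec.replicate n i) → j ≡ i
        ∈-replicate (suc n) (here eq)  = eq
        ∈-replicate (suc n) (there j∈) = ∈-replicate n j∈

      -- The value at `i` is read off the element selected in the constant slot (i, ..., i). Beyond
      -- k + 1, where `Chain` demands nothing, it is 0.
      σ : ℕ → ℕ
      σ i with i <? 2 + k
      ... | yes i< = proj₂ (Vec.head (proj₁ (selected (constant-∈ i<))))
      ... | no  _  = 0

      witness : ∀ {i} → i < 2 + k → ∃[ f ] (f ∈ˡ H × (i , σ i) ∈ˡ toList f)
      witness {i} i< with i <? 2 + k
      ... | no i≮ = contradiction i< i≮
      ... | yes i<′ with selected (constant-∈ i<′)
      ...   | f@((_ , u) ∷ _) , f∈ , eq = f , f∈ , here (cong (_, u) (sym (Vec.∷-injectiveˡ eq)))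

      chain : Chain σ
      chain = record
        { increasing = λ i<j j< →
            let f , f∈ , i∈ = witness (<-trans i<j j<) ; g , g∈ , j∈ = witness j< in
            sameOrder-< (ordered f∈ g∈ i∈ j∈) i<j
        ; bounded    = λ i< → let f , f∈ , i∈ = witness i< in
            proj₂ (point-bounds (tuples-⊆ (suc d) (H⊆ f∈) i∈)) }

      -- Each point of `f` is compatible with the selected element that defines σ at the same index,
      -- which forces the same value.
      is-graph : ∀ {f} → f ∈ˡ H → f ≡ graphOf σ (slot f)
      is-graph {f} f∈ = lemma f λ {i} p∈ →
        let g , g∈ , i∈ = witness (proj₁ (point-bounds (tuples-⊆ (suc d) (H⊆ f∈) p∈))) in
        sameOrder-≡ {i} (ordered f∈ g∈ p∈ i∈)
        where
        lemma : ∀ {d} (f : Vec Point d) → (∀ {i u} → (i , u) ∈ˡ toList f → u ≡ σ i) → f ≡ graphOf σ (slot f)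
        lemma []            _  = refl
        lemma ((i , u) ∷ f) eq = cong₂ _∷_ (cong (i ,_) (eq (here refl))) (lemma f (eq ∘ there))

      passes : ∀ {x} → x ∈ˡ reqs → ∃[ J ] (J ∈ˡ slots × test x (graphOf σ J) ≡ true)
      passes {x} x∈ = let f , f∈ , f-hit = hit (∈-require x∈) in
        slot f , slot-∈ (H⊆ f∈) , subst (λ f → test x f ≡ true) (is-graph f∈) f-hit

-- Certifying first-order formulas by parts of a chain.

module Certificates where

  open PolynomialTime using (Ty; unit; nat; list; vec; _⊗_; ⟦_⟧)
  open UnitLengthGraphs
  open HittingSets
  open Chains
  open import Data.Bool using (Bool; true; false; not; _∧_; _∨_)
  open import Data.Bool.ListAction using (any)
  open import Data.Fin as Fin using (Fin; toℕ; fromℕ<; combine; remQuot)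
  import Data.Fin.Properties as Fin
  open import Data.List as List using (List; []; _∷_; length; map; _++_; filter; upTo; applyUpTo)
  open import Data.List.Properties using (length-map; length-++; length-applyUpTo)
  open import Data.List.Membership.Propositional using () renaming (_∈_ to _∈ˡ_)
  open import Data.List.Membership.Propositional.Properties
  open import Data.List.Relation.Unary.All as All using (All; []; _∷_)
  open import Data.List.Relation.Unary.AllPairs as AllPairs using (AllPairs; []; _∷_)
  import Data.List.Relation.Unary.AllPairs.Properties as AllPairs
  open import Data.List.Relation.Unary.Any using (here; there)
  open import Data.List.Relation.Unary.Unique.Propositional using (Unique)
  import Data.List.Relation.Unary.Unique.Propositional.Properties as Unique
  open import Data.Nat
  open import Data.Nat.Properties
  open import Data.Product using (∃-syntax; _×_; _,_; proj₁; proj₂)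
  open import Data.Sum using (_⊎_; inj₁; inj₂; [_,_]′)
  open import Data.Unit using (tt)
  open import Data.Vec as Vec using (Vec; []; _∷_; lookup; toList)
  import Data.Vec.Properties as Vec
  open import Function using (_∘_; id; _⇔_; mk⇔; Equivalence)
  open import Relation.Binary.PropositionalEquality
  open import Relation.Binary.Definitions using (tri<; tri≈; tri>)
  open import Relation.Nullary using (Dec; yes; no; ¬_; contradiction; ¬?)
  open import Relation.Nullary.Decidable using (_×-dec_; _⊎-dec_)

  relationsTy : Vocabulary → Ty
  relationsTy []      = unit
  relationsTy (r ∷ τ) = list (vec nat r) ⊗ relationsTy τ

  relationAt : ∀ τ → ⟦ relationsTy τ ⟧ → (R : Symbol τ) → List (Vec ℕ (arity τ R))
  relationAt (r ∷ τ) (rel , rels) Fin.zero    = rel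
  relationAt (r ∷ τ) (rel , rels) (Fin.suc R) = relationAt τ rels R

  nums : ∀ {n r} → Vec (Fin n) r → Vec ℕ r
  nums = Vec.map toℕ

  nums-injective : ∀ {n r} {v w : Vec (Fin n) r} → nums v ≡ nums w → v ≡ w
  nums-injective {v = []}    {[]}    _  = refl
  nums-injective {v = _ ∷ _} {_ ∷ _} eq =
    cong₂ _∷_ (Fin.toℕ-injective (Vec.∷-injectiveˡ eq)) (nums-injective (Vec.∷-injectiveʳ eq))

  map-lookup-nums : ∀ {n v r} (ρ : Vec (Fin n) v) (xs : Vec (Fin v) r) →
                    Vec.map (lookup (nums ρ)) xs ≡ nums (Vec.map (lookup ρ) xs)
  map-lookup-nums ρ []       = refl
  map-lookup-nums ρ (x ∷ xs) = cong₂ _∷_ (Vec.lookup-map x toℕ ρ) (map-lookup-nums ρ xs)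

  relationsOf : ∀ τ {n} → ((R : Symbol τ) → List (Vec (Fin n) (arity τ R))) → ⟦ relationsTy τ ⟧
  relationsOf []      rel = tt
  relationsOf (r ∷ τ) rel = map nums (rel Fin.zero) , relationsOf τ (rel ∘ Fin.suc)

  relationAt-relationsOf : ∀ τ {n} (rel : (R : Symbol τ) → List (Vec (Fin n) (arity τ R))) R →
                           relationAt τ (relationsOf τ rel) R ≡ map nums (rel R)
  relationAt-relationsOf (r ∷ τ) rel Fin.zero    = refl
  relationAt-relationsOf (r ∷ τ) rel (Fin.suc R) = relationAt-relationsOf τ (rel ∘ Fin.suc) R

  rankᶠ : ∀ {n s} → Vec (Fin n) s → Fin (n ^ s)
  rankᶠ []      = Fin.zero
  rankᶠ (x ∷ v) = combine x (rankᶠ v)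

  -- The tuple read as a number in base `n`: the arithmetic form of `rankᶠ`, which a program can
  -- evaluate.
  rank : ∀ {s} → ℕ → Vec ℕ s → ℕ
  rank n []              = 0
  rank n (_∷_ {s} x v) = n ^ s * x + rank n v

  rank-nums : ∀ {n s} (v : Vec (Fin n) s) → rank n (nums v) ≡ toℕ (rankᶠ v)
  rank-nums []              = refl
  rank-nums {n} {suc s} (x ∷ v) =
    trans (cong (n ^ s * toℕ x +_) (rank-nums v)) (sym (Fin.toℕ-combine x (rankᶠ v)))

  rankᶠ-injective : ∀ {n s} (v w : Vec (Fin n) s) → rankᶠ v ≡ rankᶠ w → v ≡ w
  rankᶠ-injective []      []      _  = refl
  rankᶠ-injective (x ∷ v) (y ∷ w) eq = let p , q = Fin.combine-injective x (rankᶠ v) y (rankᶠ w) eq in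
    cong₂ _∷_ p (rankᶠ-injective v w q)

  unrank : ∀ {n} s → Fin (n ^ s) → Vec (Fin n) s
  unrank     zero    _ = []
  unrank {n} (suc s) i = proj₁ (remQuot {n} (n ^ s) i) ∷ unrank s (proj₂ (remQuot {n} (n ^ s) i))

  rankᶠ-unrank : ∀ {n} s (i : Fin (n ^ s)) → rankᶠ (unrank {n} s i) ≡ i
  rankᶠ-unrank     zero    Fin.zero = refl
  rankᶠ-unrank {n} (suc s) i = trans (cong (combine (proj₁ (remQuot {n} (n ^ s) i))) (rankᶠ-unrank s _))
    (Fin.combine-remQuot {n} (n ^ s) i)

  -- Ranks are shifted by one, so that 0 and 1 + n ^ s can serve as sentinels of a chain.
  number : ∀ {n s} → Vec (Fin n) s → ℕ
  number t = suc (toℕ (rankᶠ t))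

  number-injective : ∀ {n s} {t u : Vec (Fin n) s} → number t ≡ number u → t ≡ u
  number-injective {t = t} {u} eq = rankᶠ-injective t u (Fin.toℕ-injective (suc-injective eq))

  number≤ : ∀ {n s} (t : Vec (Fin n) s) → number t ≤ n ^ s
  number≤ t = Fin.toℕ<n (rankᶠ t)

  -- Refuting membership takes two indices. Both connectives add up, since a proof of a conjunction
  -- and a refutation of a disjunction involve both sides.
  width : ∀ {τ s v} → QF τ s v → ℕ
  width (relₐ _ _) = 0
  width (eqₐ _ _)  = 0
  width (Xₐ _)     = 2
  width (notₐ φ)   = width φ
  width (andₐ φ ψ) = width φ + width ψ
  width (orₐ φ ψ)  = width φ + width ψ

  -- Only the indices 1, ..., k count. In a chain read off a hitting set the two end values need not
  -- be sentinels, and counting them could yield more than k tuples.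
  inside : ∀ {d} → ℕ → Vec Point d → ℕ → Bool
  inside k f a = any (λ (i , u) → (0 <ᵇ i) ∧ ((i <ᵇ suc k) ∧ (u ≡ᵇ a))) (toList f)

  outside : ∀ {d} → Vec Point d → ℕ → Bool
  outside f a = any (λ (i , u) → any (λ (j , v) → (j ≡ᵇ suc i) ∧ ((u <ᵇ a) ∧ (a <ᵇ v))) (toList f)) (toList f)

  -- cert true and cert false certify the truth and the falsity of a formula from the part f of a chain.
  cert : ∀ {τ s v d} → Bool → QF τ s v → ℕ → ℕ → ⟦ relationsTy τ ⟧ → Vec ℕ v → Vec Point d → Bool
  cert {τ} b (relₐ R xs) n k rels ρ f =
    iffᵇ b (any (λ t → eqVec t (Vec.map (lookup ρ) xs)) (relationAt τ rels R))
  cert b     (eqₐ x y)  n k rels ρ f = iffᵇ b (lookup ρ x ≡ᵇ lookup ρ y)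
  cert true  (Xₐ xs)    n k rels ρ f = inside k f (suc (rank n (Vec.map (lookup ρ) xs)))
  cert false (Xₐ xs)    n k rels ρ f = outside f (suc (rank n (Vec.map (lookup ρ) xs)))
  cert b     (notₐ φ)   n k rels ρ f = cert (not b) φ n k rels ρ f
  cert true  (andₐ φ ψ) n k rels ρ f = cert true φ n k rels ρ f ∧ cert true ψ n k rels ρ f
  cert false (andₐ φ ψ) n k rels ρ f = cert false φ n k rels ρ f ∨ cert false ψ n k rels ρ f
  cert true  (orₐ φ ψ)  n k rels ρ f = cert true φ n k rels ρ f ∨ cert true ψ n k rels ρ f
  cert false (orₐ φ ψ)  n k rels ρ f = cert false φ n k rels ρ f ∧ cert false ψ n k rels ρ f

  module _ {τ : Vocabulary} {s : ℕ} (A : Structure τ) (k : ℕ) where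
    open Structure A

    size-of : ℕ
    size-of = suc pred-size

    N : ℕ
    N = size-of ^ s

    relations : ⟦ relationsTy τ ⟧
    relations = relationsOf τ relation

    open import Data.List.Membership.DecPropositional (Vec.≡-dec {n = s} (Fin._≟_ {size-of})) using () renaming (_∈?_ to _∈ˢ?_)

    certᴬ : ∀ {v d} → Bool → QF τ s v → Vec Universe v → Vec Point d → Bool
    certᴬ b φ ρ f = cert b φ size-of k relations (nums ρ) f

    holds? : ∀ {v} (φ : QF τ s v) S ρ → Dec (holds A φ S ρ)
    holds? (relₐ R xs) S ρ = Vec.map (lookup ρ) xs ∈? relation R
      where open import Data.List.Membership.DecPropositional (Vec.≡-dec {n = arity τ R} (Fin._≟_ {size-of}))
    holds? (eqₐ x y)  S ρ = lookup ρ x Fin.≟ lookup ρ y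
    holds? (Xₐ xs)    S ρ = Vec.map (lookup ρ) xs ∈ˢ? S
    holds? (notₐ φ)   S ρ = ¬? (holds? φ S ρ)
    holds? (andₐ φ ψ) S ρ = holds? φ S ρ ×-dec holds? ψ S ρ
    holds? (orₐ φ ψ)  S ρ = holds? φ S ρ ⊎-dec holds? ψ S ρ

    Truth : Bool → Set → Set
    Truth true  P = P
    Truth false P = ¬ P

    relation-test : ∀ {v} (R : Symbol τ) xs (ρ : Vec Universe v) →
      any (λ t → eqVec t (Vec.map (lookup (nums ρ)) xs)) (relationAt τ relations R) ≡ true ⇔
      Vec.map (lookup ρ) xs ∈ˡ relation R
    relation-test R xs ρ = mk⇔
      (λ eq → let t , t∈ , t≡ = true-any (relationAt τ relations R) eq
                  u , u∈ , t≡u = ∈-map⁻ nums (subst (t ∈ˡ_) (relationAt-relationsOf τ relation R) t∈)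
              in subst (_∈ˡ relation R)
                   (nums-injective (trans (sym t≡u) (trans (true-eqVec t _ t≡) (map-lookup-nums ρ xs)))) u∈)
      (λ t∈ → any-true (subst (nums (Vec.map (lookup ρ) xs) ∈ˡ_) (sym (relationAt-relationsOf τ relation R)) (∈-map⁺ nums t∈))
                       (eqVec-true (sym (map-lookup-nums ρ xs))))

    iffᵇ-Truth : ∀ b {x P} → x ≡ true ⇔ P → iffᵇ b x ≡ true ⇔ Truth b P
    iffᵇ-Truth true  e = e
    iffᵇ-Truth false e = mk⇔ (λ eq p → not-true eq (Equivalence.from e p)) (λ ¬p → true-not (¬p ∘ Equivalence.to e))

    equality-test : ∀ {v} x y (ρ : Vec Universe v) →
      (lookup (nums ρ) x ≡ᵇ lookup (nums ρ) y) ≡ true ⇔ lookup ρ x ≡ lookup ρ y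
    equality-test x y ρ = mk⇔
      (λ eq → Fin.toℕ-injective (trans (sym (Vec.lookup-map x toℕ ρ))
                (trans (true-≡ᵇ _ _ eq) (Vec.lookup-map y toℕ ρ))))
      (λ eq → ≡ᵇ-true {lookup (nums ρ) x} (trans (Vec.lookup-map x toℕ ρ)
                (trans (cong toℕ eq) (sym (Vec.lookup-map y toℕ ρ)))))

    number-lookup : ∀ {v} (ρ : Vec Universe v) (xs : Vec (Fin v) s) →
      suc (rank size-of (Vec.map (lookup (nums ρ)) xs)) ≡ number (Vec.map (lookup ρ) xs)
    number-lookup ρ xs = cong suc (trans (cong (rank size-of) (map-lookup-nums ρ xs)) (rank-nums (Vec.map (lookup ρ) xs)))

    record Describes (σ : ℕ → ℕ) (S : List (Vec Universe s)) : Set where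
      field
        member     : ∀ {i t} → 0 < i → i < suc k → σ i ≡ number t → t ∈ˡ S
        index      : ∀ {t} → t ∈ˡ S → ∃[ i ] (0 < i × i < suc k × σ i ≡ number t)
        increasing : ∀ {i j} → i < j → j < 2 + k → σ i < σ j

    -- Kept apart from `Describes` because a chain read off a hitting set may violate it: its end
    -- values can leave tuples below or above the whole chain. For such a chain only soundness of
    -- certificates is used.
    Gaps : (ℕ → ℕ) → List (Vec Universe s) → Set
    Gaps σ S = ∀ t → ¬ t ∈ˡ S → ∃[ i ] (i < suc k × σ i < number t × number t < σ (suc i))

    module _ {σ S} (describes : Describes σ S) where
      open Describes describes

      monotone : ∀ {i j} → i ≤ j → j < 2 + k → σ i ≤ σ j
      monotone i≤j j< with m≤n⇒m<n∨m≡n i≤j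
      ... | inj₁ i<j  = <⇒≤ (increasing i<j j<)
      ... | inj₂ refl = ≤-refl

      cert-sound : ∀ {v d} b (φ : QF τ s v) ρ (f : Vec Point d) →
        (∀ {i u} → (i , u) ∈ˡ toList f → i < 2 + k × u ≡ σ i) →
        certᴬ b φ ρ f ≡ true → Truth b (holds A φ S ρ)
      cert-sound b     (relₐ R xs) ρ f f⊆ eq = Equivalence.to (iffᵇ-Truth b (relation-test R xs ρ)) eq
      cert-sound b     (eqₐ x y)   ρ f f⊆ eq = Equivalence.to (iffᵇ-Truth b (equality-test x y ρ)) eq
      cert-sound true  (Xₐ xs)     ρ f f⊆ eq with true-any (toList f) eq
      ... | (i , u) , p∈ , eq′ =
        let 0<i , rest = ∧-true eq′ ; i≤k , u≡ = ∧-true {i <ᵇ suc k} rest in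
        member (true-<ᵇ 0 i 0<i) (true-<ᵇ i (suc k) i≤k)
          (trans (sym (proj₂ (f⊆ p∈))) (trans (true-≡ᵇ u _ u≡) (number-lookup ρ xs)))
      -- If the tuple were the member of index `l`, monotonicity would give σ l ≤ σ i or σ (i + 1) ≤
      -- σ l, and both lie outside the gap that contains its number.
      cert-sound false (Xₐ xs)     ρ f f⊆ eq t∈ with true-any (toList f) eq
      ... | (i , u) , p∈ , eq′ with true-any (toList f) eq′
      ...   | (j , v) , q∈ , eq″ with ∧-true {j ≡ᵇ suc i} eq″
      ...     | j≡ , rest with ∧-true {u <ᵇ suc (rank size-of (Vec.map (lookup (nums ρ)) xs))} rest | true-≡ᵇ j (suc i) j≡ | index t∈
      ...       | u< , <v | refl | l , _ , l≤k , σl≡ with f⊆ p∈ | f⊆ q∈ | l ≤? i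
      ...         | _ , refl | j< , refl | yes l≤i = <-irrefl refl (begin-strict
        number (Vec.map (lookup ρ) xs)  ≡⟨ σl≡ ⟨
        σ l                             ≤⟨ monotone l≤i (<-trans (n<1+n i) j<) ⟩
        σ i                             <⟨ true-<ᵇ (σ i) _ u< ⟩
        suc (rank size-of (Vec.map (lookup (nums ρ)) xs)) ≡⟨ number-lookup ρ xs ⟩
        number (Vec.map (lookup ρ) xs)  ∎)
        where open ≤-Reasoning
      ...         | _ , refl | j< , refl | no l≰i = <-irrefl refl (begin-strict
        number (Vec.map (lookup ρ) xs)  ≡⟨ number-lookup ρ xs ⟨
        suc (rank size-of (Vec.map (lookup (nums ρ)) xs)) <⟨ true-<ᵇ _ (σ (suc i)) <v ⟩
        σ (suc i)                       ≤⟨ monotone (≰⇒> l≰i) (<-trans l≤k (n<1+n (suc k))) ⟩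
        σ l                             ≡⟨ σl≡ ⟩
        number (Vec.map (lookup ρ) xs)  ∎)
        where open ≤-Reasoning
      cert-sound true  (notₐ φ)   ρ f f⊆ eq = cert-sound false φ ρ f f⊆ eq
      cert-sound false (notₐ φ)   ρ f f⊆ eq ¬p = ¬p (cert-sound true φ ρ f f⊆ eq)
      cert-sound true  (andₐ φ ψ) ρ f f⊆ eq =
        let p , q = ∧-true {certᴬ true φ ρ f} eq in cert-sound true φ ρ f f⊆ p , cert-sound true ψ ρ f f⊆ q
      cert-sound false (andₐ φ ψ) ρ f f⊆ eq (hφ , hψ) with ∨-true {certᴬ false φ ρ f} eq
      ... | inj₁ p = cert-sound false φ ρ f f⊆ p hφ
      ... | inj₂ p = cert-sound false ψ ρ f f⊆ p hψ
      cert-sound true  (orₐ φ ψ)  ρ f f⊆ eq with ∨-true {certᴬ true φ ρ f} eq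
      ... | inj₁ p = inj₁ (cert-sound true φ ρ f f⊆ p)
      ... | inj₂ p = inj₂ (cert-sound true ψ ρ f f⊆ p)
      cert-sound false (orₐ φ ψ)  ρ f f⊆ eq h with ∧-true {certᴬ false φ ρ f} eq
      ... | p , q = [ cert-sound false φ ρ f f⊆ p , cert-sound false ψ ρ f f⊆ q ]′ h

      -- `valid` speaks of every `f` that contains the listed points, so the certificates of two
      -- subformulas can be joined and padded with further points.
      record Certificate {v} (b : Bool) (φ : QF τ s v) (ρ : Vec Universe v) : Set where
        constructor certificate
        field
          indexes : List ℕ
          short   : length indexes ≤ width φ
          inRange : ∀ {i} → i ∈ˡ indexes → i < 2 + k
          valid   : ∀ {d} (f : Vec Point d) → (∀ {i} → i ∈ˡ indexes → (i , σ i) ∈ˡ toList f) → certᴬ b φ ρ f ≡ true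

      open Certificate

      -- The flag `b` pushes negations inward. A double negation and a refuted conjunction are
      -- resolved constructively by deciding a subformula with `holds?`.
      cert-complete : Gaps σ S → ∀ {v} b (φ : QF τ s v) ρ → Truth b (holds A φ S ρ) → Certificate b φ ρ
      cert-complete gap b (relₐ R xs) ρ h = certificate [] z≤n (λ ())
        (λ _ _ → Equivalence.from (iffᵇ-Truth b (relation-test R xs ρ)) h)
      cert-complete gap b (eqₐ x y)   ρ h = certificate [] z≤n (λ ())
        (λ _ _ → Equivalence.from (iffᵇ-Truth b (equality-test x y ρ)) h)
      cert-complete gap true (Xₐ xs) ρ h = let i , 0<i , i≤k , σi≡ = index h in certificate (i ∷ []) (s≤s z≤n)
        (λ { (here refl) → <-trans i≤k (n<1+n (suc k)) })
        λ f f⊇ → any-true (f⊇ (here refl)) (cong₂ _∧_ (<ᵇ-true 0<i) (cong₂ _∧_ (<ᵇ-true i≤k)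
          (≡ᵇ-true (trans σi≡ (sym (number-lookup ρ xs))))))
      cert-complete gap false (Xₐ xs) ρ h = let i , i≤k , σi< , <σi = gap _ h in certificate (i ∷ suc i ∷ []) ≤-refl
        (λ { (here refl) → <-trans i≤k (n<1+n (suc k)) ; (there (here refl)) → s≤s i≤k })
        λ f f⊇ → any-true (f⊇ (here refl)) (any-true (f⊇ (there (here refl)))
          (cong₂ _∧_ (≡ᵇ-true {suc i} refl) (cong₂ _∧_
            (<ᵇ-true (subst (σ i <_) (sym (number-lookup ρ xs)) σi<))
            (<ᵇ-true (subst (_< σ (suc i)) (sym (number-lookup ρ xs)) <σi)))))
      cert-complete gap true  (notₐ φ) ρ h = let certificate J s r v = cert-complete gap false φ ρ h in certificate J s r v
      cert-complete gap false (notₐ φ) ρ h with holds? φ S ρ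
      ... | yes p = let certificate J s r v = cert-complete gap true φ ρ p in certificate J s r v
      ... | no ¬p = contradiction ¬p h
      cert-complete gap true (andₐ φ ψ) ρ (hφ , hψ) = both (cert-complete gap true φ ρ hφ) (cert-complete gap true ψ ρ hψ)
        where
        both : Certificate true φ ρ → Certificate true ψ ρ → Certificate true (andₐ φ ψ) ρ
        both (certificate I s r v) (certificate J s′ r′ v′) = certificate (I ++ J)
          (≤-trans (≤-reflexive (length-++ I)) (+-mono-≤ s s′)) (λ i∈ → [ r , r′ ]′ (∈-++⁻ I i∈))
          λ f f⊇ → cong₂ _∧_ (v f (f⊇ ∘ ∈-++⁺ˡ)) (v′ f (f⊇ ∘ ∈-++⁺ʳ I))
      cert-complete gap false (orₐ φ ψ) ρ h = both (cert-complete gap false φ ρ (h ∘ inj₁)) (cert-complete gap false ψ ρ (h ∘ inj₂))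
        where
        both : Certificate false φ ρ → Certificate false ψ ρ → Certificate false (orₐ φ ψ) ρ
        both (certificate I s r v) (certificate J s′ r′ v′) = certificate (I ++ J)
          (≤-trans (≤-reflexive (length-++ I)) (+-mono-≤ s s′)) (λ i∈ → [ r , r′ ]′ (∈-++⁻ I i∈))
          λ f f⊇ → cong₂ _∧_ (v f (f⊇ ∘ ∈-++⁺ˡ)) (v′ f (f⊇ ∘ ∈-++⁺ʳ I))
      cert-complete gap true (orₐ φ ψ) ρ (inj₁ h) = let certificate J s r v = cert-complete gap true φ ρ h in
        certificate J (m≤n⇒m≤n+o _ s) r λ f f⊇ → cong (_∨ _) (v f f⊇)
      cert-complete gap true (orₐ φ ψ) ρ (inj₂ h) = let certificate J s r v = cert-complete gap true ψ ρ h in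
        certificate J (m≤n⇒m≤o+n _ s) r λ f f⊇ → ∨-trueʳ _ (v f f⊇)
      cert-complete gap false (andₐ φ ψ) ρ h with holds? φ S ρ
      ... | no ¬p = let certificate J s r v = cert-complete gap false φ ρ ¬p in
        certificate J (m≤n⇒m≤n+o _ s) r λ f f⊇ → cong (_∨ _) (v f f⊇)
      ... | yes p = let certificate J s r v = cert-complete gap false ψ ρ (λ q → h (p , q)) in
        certificate J (m≤n⇒m≤o+n _ s) r λ f f⊇ → ∨-trueʳ _ (v f f⊇)

  nth : List ℕ → ℕ → ℕ
  nth []       _       = 0
  nth (x ∷ xs) zero    = x
  nth (x ∷ xs) (suc i) = nth xs i

  nth-∈ : ∀ xs {i} → i < length xs → nth xs i ∈ˡ xs
  nth-∈ (x ∷ xs) {zero}  _       = here refl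
  nth-∈ (x ∷ xs) {suc i} (s≤s p) = there (nth-∈ xs p)

  ∈-nth : ∀ {x xs} → x ∈ˡ xs → ∃[ i ] (i < length xs × nth xs i ≡ x)
  ∈-nth (here refl) = 0 , s≤s z≤n , refl
  ∈-nth (there x∈)  = let i , i< , eq = ∈-nth x∈ in suc i , s≤s i< , eq

  nth-increasing : ∀ {xs} → AllPairs _<_ xs → ∀ {i j} → i < j → j < length xs → nth xs i < nth xs j
  nth-increasing {x ∷ xs} (x< ∷ _) {zero}  {suc j} _         (s≤s j<) = All.lookup x< (nth-∈ xs j<)
  nth-increasing {x ∷ xs} (_ ∷ ps) {suc i} {suc j} (s≤s i<j) (s≤s j<) = nth-increasing ps i<j j<

  -- The first entry above `a` ends the gap: `z` guarantees that there is one, and no entry equals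
  -- `a`.
  nth-gap : ∀ {x xs a z} → x < a → a < z → z ∈ˡ xs → ¬ a ∈ˡ xs →
            ∃[ i ] (i < length xs × nth (x ∷ xs) i < a × a < nth (x ∷ xs) (suc i))
  nth-gap {x} {y ∷ ys} {a} x<a a<z z∈ a∉ with <-cmp a y
  ... | tri< a<y _ _  = 0 , s≤s z≤n , x<a , a<y
  ... | tri≈ _ refl _ = contradiction (here refl) a∉
  nth-gap {x} {y ∷ ys} {a} x<a a<z (here refl) a∉ | tri> _ _ y<a = contradiction a<z (<-asym y<a)
  nth-gap {x} {y ∷ ys} {a} x<a a<z (there z∈)  a∉ | tri> _ _ y<a =
    let i , i< , p , q = nth-gap y<a a<z z∈ (a∉ ∘ there) in suc i , s≤s i< , p , q

  sorted-gap : ∀ {xs y a z} → AllPairs _<_ xs → y ∈ˡ xs → z ∈ˡ xs → y < a → a < z → ¬ a ∈ˡ xs →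
               ∃[ i ] (suc i < length xs × nth xs i < a × a < nth xs (suc i))
  sorted-gap (x< ∷ _) y∈ (here refl) y<a a<z a∉ = contradiction (<-trans y<a a<z) (≤⇒≯ (least y∈))
    where
    least : ∀ {y} → y ∈ˡ _ → _ ≤ y
    least (here refl) = ≤-refl
    least (there y∈)  = <⇒≤ (All.lookup x< y∈)
  sorted-gap (x< ∷ _) (here refl) (there z∈) y<a a<z a∉ =
    let i , i< , p , q = nth-gap y<a a<z z∈ (a∉ ∘ there) in i , s≤s i< , p , q
  sorted-gap (x< ∷ _) (there y∈)  (there z∈) y<a a<z a∉ =
    let i , i< , p , q = nth-gap (<-trans (All.lookup x< y∈) y<a) a<z z∈ (a∉ ∘ there) in i , s≤s i< , p , q

  abstract
    -- Filtering 0, ..., b - 1 by membership sorts and removes repetitions at once.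
    sort : ∀ b (xs : List ℕ) → (∀ {a} → a ∈ˡ xs → a < b) →
           ∃[ ys ] (AllPairs _<_ ys × (∀ {a} → a ∈ˡ xs ⇔ a ∈ˡ ys))
    sort b xs bounded = filter (_∈? xs) (upTo b) ,
      AllPairs.filter⁺ (_∈? xs) (AllPairs.applyUpTo⁺₁ id b (λ i<j _ → i<j)) ,
      mk⇔ (λ a∈ → ∈-filter⁺ (_∈? xs) (∈-upTo⁺ (bounded a∈)) a∈)
          (λ a∈ → proj₂ (∈-filter⁻ (_∈? xs) {xs = upTo b} a∈))
      where open import Data.List.Membership.DecPropositional _≟_ using (_∈?_)

  -- The filler 0 is an index of every chain, and additional points leave a certificate valid.
  pad : ∀ m → List ℕ → Vec ℕ m
  pad zero    _        = []
  pad (suc m) []       = 0 ∷ pad m []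
  pad (suc m) (i ∷ is) = i ∷ pad m is

  ∈-pad : ∀ {m is i} → length is ≤ m → i ∈ˡ is → i ∈ˡ toList (pad m is)
  ∈-pad {suc m} (s≤s p) (here refl) = here refl
  ∈-pad {suc m} (s≤s p) (there i∈)  = there (∈-pad p i∈)

  ∈-pad⁻ : ∀ m is {i} → i ∈ˡ toList (pad m is) → i ≡ 0 ⊎ i ∈ˡ is
  ∈-pad⁻ (suc m) []       (here eq)  = inj₁ eq
  ∈-pad⁻ (suc m) []       (there i∈) = ∈-pad⁻ m [] i∈
  ∈-pad⁻ (suc m) (j ∷ is) (here eq)  = inj₂ (here eq)
  ∈-pad⁻ (suc m) (j ∷ is) (there i∈) = [ inj₁ , inj₂ ∘ there ]′ (∈-pad⁻ m is i∈)

  unnums : ∀ {n d} (v : Vec ℕ d) → v ∈ˡ tuples d (upTo n) → ∃[ w ] v ≡ nums {n} w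
  unnums []      _  = [] , refl
  unnums {n} {suc d} (x ∷ v) v∈ with ∈-cartesianProductWith⁻ _∷_ (upTo n) (tuples d (upTo n)) v∈
  ... | _ , _ , x∈ , v∈′ , refl = let w , eq = unnums v v∈′ in
    fromℕ< (∈-upTo⁻ x∈) ∷ w , cong₂ _∷_ (sym (Fin.toℕ-fromℕ< (∈-upTo⁻ x∈))) eq

  nums-∈ : ∀ {n d} (w : Vec (Fin n) d) → nums w ∈ˡ tuples d (upTo n)
  nums-∈ {n} w = ∈-tuples λ x∈ → let i , _ , eq = ∈-toList-map⁻ toℕ w x∈ in
    subst (_∈ˡ upTo n) (sym eq) (∈-upTo⁺ (Fin.toℕ<n i))

  module _ {τ : Vocabulary} {s : ℕ} (A : Structure τ) (k : ℕ) where
    open Structure A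

    private
      n K : ℕ
      n = suc pred-size
      K = n ^ s

    module _ {S : List (Vec Universe s)} (unique : Unique S) (|S|≡k : length S ≡ k) where
      private
        marks : List ℕ
        marks = 0 ∷ suc K ∷ map number S

        marks< : ∀ {a} → a ∈ˡ marks → a < 2 + K
        marks< (here refl)         = s≤s z≤n
        marks< (there (here refl)) = ≤-refl
        marks< (there (there a∈)) with ∈-map⁻ number a∈
        ... | t , _ , refl = s≤s (m≤n⇒m≤1+n (number≤ t))

        sorted : List ℕ
        sorted = proj₁ (sort (2 + K) marks marks<)

        sorted-increasing : AllPairs _<_ sorted
        sorted-increasing = proj₁ (proj₂ (sort (2 + K) marks marks<))

        ∈-sorted : ∀ {a} → a ∈ˡ marks → a ∈ˡ sorted
        ∈-sorted = Equivalence.to (proj₂ (proj₂ (sort (2 + K) marks marks<)))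

        ∈-sorted⁻ : ∀ {a} → a ∈ˡ sorted → a ∈ˡ marks
        ∈-sorted⁻ = Equivalence.from (proj₂ (proj₂ (sort (2 + K) marks marks<)))

      chainOf : ℕ → ℕ
      chainOf = nth sorted

      private
        marks-unique : Unique marks
        marks-unique = ((λ ()) ∷ All.tabulate (λ a∈ eq → zero∉ (subst (_∈ˡ _) (sym eq) a∈)))
                     ∷ All.tabulate (λ a∈ eq → top∉ (subst (_∈ˡ _) (sym eq) a∈))
                     ∷ Unique.map⁺ number-injective unique
          where
          zero∉ : ¬ 0 ∈ˡ map number S
          zero∉ a∈ with ∈-map⁻ number a∈
          ... | _ , _ , ()
          top∉ : ¬ suc K ∈ˡ map number S
          top∉ a∈ with ∈-map⁻ number a∈
          ... | t , _ , eq = <-irrefl refl (subst (_≤ K) (sym eq) (number≤ t))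

        -- Both lists are duplicate-free and have the same members: the numbers of k tuples and the
        -- two sentinels. This is where the k + 2 indices of a chain come from.
        length-sorted : length sorted ≡ 2 + k
        length-sorted = trans (≤-antisym
          (unique-length (AllPairs.map <⇒≢ sorted-increasing) ∈-sorted⁻)
          (unique-length marks-unique ∈-sorted)) (cong (2 +_) (trans (length-map number S) |S|≡k))

        increasing : ∀ {i j} → i < j → j < 2 + k → chainOf i < chainOf j
        increasing i<j j< = nth-increasing sorted-increasing i<j (subst (_ <_) (sym length-sorted) j<)

        position-of : ∀ {a} → a ∈ˡ marks → ∃[ i ] (i < 2 + k × chainOf i ≡ a)
        position-of a∈ = let i , i< , eq = ∈-nth (∈-sorted a∈) in i , subst (i <_) length-sorted i< , eq

        reflects : ∀ {i j} → i < 2 + k → chainOf i < chainOf j → i < j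
        reflects {i} {j} i< p with <-cmp i j
        ... | tri< i<j _ _  = i<j
        ... | tri≈ _ refl _ = contradiction p (<-irrefl refl)
        ... | tri> _ _ j<i  = contradiction p (<-asym (increasing j<i i<))

      chainOf-bounded : ∀ {i} → i < 2 + k → chainOf i < 2 + K
      chainOf-bounded i< = marks< (∈-sorted⁻ (nth-∈ sorted (subst (_ <_) (sym length-sorted) i<)))

      chainOf-describes : Describes A k chainOf S
      chainOf-describes = record
        { member = λ {i} {t} _ i≤k eq → member (subst (_∈ˡ sorted) eq
            (nth-∈ sorted (subst (i <_) (sym length-sorted) (<-trans i≤k (n<1+n (suc k))))))
        ; index = index
        ; increasing = increasing }
        where
        member : ∀ {t} → number t ∈ˡ sorted → t ∈ˡ S
        member {t} t∈ with ∈-sorted⁻ t∈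
        ... | there (here eq)  = contradiction (subst (_≤ K) eq (number≤ t)) (<-irrefl refl)
        ... | there (there t∈′) with ∈-map⁻ number t∈′
        ...   | u , u∈ , eq = subst (_∈ˡ S) (sym (number-injective eq)) u∈
        index : ∀ {t} → t ∈ˡ S → ∃[ i ] (0 < i × i < suc k × chainOf i ≡ number t)
        index {t} t∈ =
          let i , i< , eq = position-of (there (there (∈-map⁺ number t∈)))
              b , b< , eqb = position-of (here refl)
              e , e< , eqe = position-of (there (here refl))
          -- Lying strictly between the positions `b` and `e` of the sentinels already gives `0 < i`
          -- and `i < suc k`.
          in i , ≤-trans (s≤s z≤n) (reflects {b} b< (subst₂ _<_ (sym eqb) (sym eq) (s≤s z≤n))) ,
             ≤-trans (reflects {i} i< (subst₂ _<_ (sym eq) (sym eqe) (s≤s (number≤ t)))) (s≤s⁻¹ e<) , eq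

      chainOf-gaps : Gaps A k chainOf S
      chainOf-gaps t t∉ =
        let i , i< , p , q = sorted-gap sorted-increasing (∈-sorted (here refl)) (∈-sorted (there (here refl)))
                               (s≤s z≤n) (s≤s (number≤ t)) t∉sorted
        in i , s≤s⁻¹ (≤-trans i< (≤-reflexive length-sorted)) , p , q
        where
        t∉sorted : ¬ number t ∈ˡ sorted
        t∉sorted t∈ with ∈-sorted⁻ t∈
        ... | there (here eq)  = contradiction (subst (_≤ K) eq (number≤ t)) (<-irrefl refl)
        ... | there (there t∈′) with ∈-map⁻ number t∈′
        ...   | u , u∈ , eq = t∉ (subst (_∈ˡ S) (sym (number-injective eq)) u∈)

    module _ {σ : ℕ → ℕ} (increasing : ∀ {i j} → i < j → j < 2 + k → σ i < σ j)
             (bounded : ∀ {i} → i < 2 + k → σ i < 2 + K) where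
      private
        decode : ℕ → Vec Universe s
        decode zero    = Vec.replicate s Fin.zero
        decode (suc a) with a <? K
        ... | yes a<K = unrank s (fromℕ< a<K)
        ... | no  _   = Vec.replicate s Fin.zero

        number-decode : ∀ {a} → 0 < a → a < suc K → number (decode a) ≡ a
        number-decode {suc a} _ (s≤s a<K) with a <? K
        ... | no a≮K = contradiction a<K a≮K
        ... | yes a<K′ = cong suc (trans (cong toℕ (rankᶠ-unrank s (fromℕ< a<K′))) (Fin.toℕ-fromℕ< a<K′))

        -- An inner value lies strictly between σ 0 ≥ 0 and σ (k + 1) ≤ K + 1, so it is the number
        -- of a tuple whatever the two end values are.
        number-σ : ∀ {i} → i < k → number (decode (σ (suc i))) ≡ σ (suc i)
        number-σ i<k = number-decode
          (≤-trans (s≤s z≤n) (increasing (s≤s z≤n) (s≤s (m≤n⇒m≤1+n i<k))))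
          (≤-trans (increasing (s≤s i<k) ≤-refl) (s≤s⁻¹ (bounded ≤-refl)))

      setOf : List (Vec Universe s)
      setOf = applyUpTo (λ i → decode (σ (suc i))) k

      setOf-unique : Unique setOf
      setOf-unique = Unique.applyUpTo⁺₁ _ k λ {i} {j} i<j j<k eq → <-irrefl
        (trans (sym (number-σ (<-trans i<j j<k))) (trans (cong number eq) (number-σ j<k)))
        (increasing (s≤s i<j) (s≤s (m≤n⇒m≤1+n j<k)))

      setOf-describes : Describes A k σ setOf
      setOf-describes = record
        { member = λ { {suc i} {t} _ (s≤s i<k) eq → subst (_∈ˡ setOf)
                         (number-injective (trans (number-σ i<k) eq)) (∈-applyUpTo⁺ _ i<k) }
        ; index = λ t∈ → index (∈-applyUpTo⁻ _ t∈)
        ; increasing = increasing }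
        where
        index : ∀ {t} → ∃[ i ] (i < k × t ≡ decode (σ (suc i))) → ∃[ i ] (0 < i × i < suc k × σ i ≡ number t)
        index (i , i<k , refl) = suc i , s≤s z≤n , s≤s i<k , sym (number-σ i<k)

  module _ {τ : Vocabulary} {s : ℕ} (φ : Π₂ τ s) where
    open Π₂ φ

    -- The existential quantifiers are absorbed here: an element hits the clause of `x` if it
    -- certifies the matrix for some `y`. The universal ones give one clause for each `x`.
    passes : ℕ → ℕ → ⟦ relationsTy τ ⟧ → Vec ℕ p → Vec Point (suc (width matrix)) → Bool
    passes n k rels x f = any (λ y → cert true matrix n k rels (x Vec.++ y) f) (tuples q (upTo n))

    wdHittingSet : Structure τ × ℕ → HittingSet
    wdHittingSet (A , k) = chainHittingSet k (n ^ s) (width matrix) (tuples p (upTo n)) (passes n k (relationsOf τ relation))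
      where
      open Structure A
      n = suc pred-size

    wd-correct : ∀ I → ParamProblem.Yes (p-WD φ) I ⇔ HittingSet.Solvable (wdHittingSet I)
    wd-correct (A , k) = mk⇔ to from
      where
      open Structure A
      n : ℕ
      n = suc pred-size
      rels : ⟦ relationsTy τ ⟧
      rels = relationsOf τ relation
      d : ℕ
      d = width matrix
      reqs : List (Vec ℕ p)
      reqs = tuples p (upTo n)

      to : ParamProblem.Yes (p-WD φ) (A , k) → HittingSet.Solvable (wdHittingSet (A , k))
      to (S , unique , |S|≡k , sat) = chain⇒solvable k (n ^ s) d reqs (passes n k rels) {σ}
        (record { increasing = Describes.increasing describes ; bounded = chainOf-bounded A k unique |S|≡k }) certified
        where
        σ : ℕ → ℕ
        σ = chainOf A k unique |S|≡k
        describes : Describes A k σ S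
        describes = chainOf-describes A k unique |S|≡k
        certified : ∀ {x} → x ∈ˡ reqs → ∃[ J ] (J ∈ˡ Grid.slots k (n ^ s) d
                      × passes n k rels x (graphOf σ J) ≡ true)
        certified {x} x∈ with unnums x x∈
        ... | xs , refl =
          let ys , h = sat xs
              certificate I short inRange valid =
                cert-complete A k describes (chainOf-gaps A k unique |S|≡k) true matrix (xs Vec.++ ys) h
              J = pad (suc d) I
          in J , ∈-tuples (λ i∈ → ∈-upTo⁺ ([ (λ { refl → s≤s z≤n }) , inRange ]′ (∈-pad⁻ (suc d) I i∈))) ,
             any-true (nums-∈ ys) (subst (λ ρ → cert true matrix n k rels ρ (graphOf σ J) ≡ true)
               (Vec.map-++ toℕ xs ys)
               (valid (graphOf σ J) (λ i∈ → ∈-toList-map (λ i → i , σ i) J (∈-pad (m≤n⇒m≤1+n short) i∈))))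

      fromChain : ∃[ σ ] (Chain k (n ^ s) d reqs (passes n k rels) σ ×
        (∀ {x} → x ∈ˡ reqs → ∃[ J ] (J ∈ˡ Grid.slots k (n ^ s) d
                                     × passes n k rels x (graphOf σ J) ≡ true))) →
        ParamProblem.Yes (p-WD φ) (A , k)
      fromChain (σ , chain , certified) = setOf A k increasing bounded , setOf-unique A k increasing bounded ,
        length-applyUpTo _ k , λ xs →
          let J , J∈ , eq = certified (nums-∈ xs)
              y , y∈ , eq′ = true-any (tuples q (upTo n)) eq
              ys , y≡ = unnums y y∈
          in ys , cert-sound A k (setOf-describes A k increasing bounded) true matrix (xs Vec.++ ys) (graphOf σ J)
               (λ p∈ → in-graph J J∈ (∈-toList-map⁻ (λ i → i , σ i) J p∈))
               (subst (λ ρ → cert true matrix n k rels ρ (graphOf σ J) ≡ true)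
                 (trans (cong (nums xs Vec.++_) y≡) (sym (Vec.map-++ toℕ xs ys))) eq′)
        where
        open Chain chain
        in-graph : ∀ {i u} (J : Vec ℕ (suc d)) → J ∈ˡ Grid.slots k (n ^ s) d →
                   ∃[ j ] (j ∈ˡ toList J × (i , u) ≡ (j , σ j)) → i < 2 + k × u ≡ σ i
        in-graph J J∈ (j , j∈ , refl) = ∈-upTo⁻ (tuples-⊆ (suc d) J∈ j∈) , refl

      from : HittingSet.Solvable (wdHittingSet (A , k)) → ParamProblem.Yes (p-WD φ) (A , k)
      from solvable = fromChain (solvable⇒chain k (n ^ s) d reqs (passes n k rels) solvable)

-- The code of a constructed spanner instance as an explicit table.

module Tables where

  open PolynomialTime
  open Combinators
  open HittingSets
  open Chains
  open import Data.Bool using (Bool; true; false; if_then_else_; T?)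
  open import Data.Fin using (toℕ)
  open import Data.Fin.Properties using (toℕ-↑ˡ; toℕ-↑ʳ)
  open import Data.List as List using (List; []; _∷_; length; map; _++_; concatMap; upTo; applyUpTo; allFin; tabulate; filterᵇ; cartesianProductWith)
  open import Data.List.Properties
  open import Data.List.Membership.Propositional using () renaming (_∈_ to _∈ˡ_)
  open import Data.Nat
  import Data.Nat.Binary as ℕᵇ
  import Data.Nat.Binary.Properties as ℕᵇ
  open import Data.Product using (∃-syntax; _×_; _,_)
  open import Function using (_∘_; id)
  open import Relation.Binary.PropositionalEquality

  private variable
    Γ : Ty

  ones : ℕ → ℕᵇ.ℕᵇ
  ones zero    = ℕᵇ.zero
  ones (suc j) = ℕᵇ.1+[2 ones j ]

  suc-toℕ-ones : ∀ j → suc (ℕᵇ.toℕ (ones j)) ≡ 2 ^ j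
  suc-toℕ-ones zero    = refl
  suc-toℕ-ones (suc j) = trans (lemma (ℕᵇ.toℕ (ones j))) (cong (2 *_) (suc-toℕ-ones j))
    where
    open import Data.Nat.Tactic.RingSolver using (solve-∀)
    lemma : ∀ x → suc (suc (2 * x)) ≡ 2 * suc x
    lemma = solve-∀

  binary-2^∸1 : ∀ j → binary (2 ^ j ∸ 1) ≡ unary j
  binary-2^∸1 j = trans (cong binary (sym (cong pred (suc-toℕ-ones j))))
    (trans (cong codeℕᵇ (ℕᵇ.fromℕ-toℕ (ones j))) (code-ones j))
    where
    code-ones : ∀ j → codeℕᵇ (ones j) ≡ unary j
    code-ones zero    = refl
    code-ones (suc j) = cong (nil ∙_) (code-ones j)

  EdgeTy OutTy : Ty
  EdgeTy = nat ⊗ nat ⊗ nat ⊗ nat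
  OutTy  = (nat ⊗ list EdgeTy ⊗ nat ⊗ nat) ⊗ nat

  edgeTable : ℕ → ℕ → List (List ℕ) → List ⟦ EdgeTy ⟧
  edgeTable M K rows = (0 , 1 , 0 , 1)
    ∷ map (λ e → 0 , 2 + e , 1 , 1) (upTo M)
    ++ map (λ c → 1 , 2 + (M + c) , suc K , 1) (upTo (length rows))
    ++ concatMap (λ (c , row) → map (λ e → 2 + e , 2 + (M + c) , 0 , 1) row) (indexFrom 0 rows)

  -- A number `2 ^ j ∸ 1` that the problem codes in binary is entered as `j`, since its binary code
  -- is `unary j`. So numerator 3 and denominator 1 of the stretch factor appear as 2 and 1, and a
  -- length 1 as 1.
  spannerTable : ℕ → ℕ → List (List ℕ) → ⟦ OutTy ⟧
  spannerTable M K rows = (2 + (M + length rows) , edgeTable M K rows , 2 , 1) , K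

  spannerTableP : {M K : ⟦ Γ ⟧ → ℕ} {rows : ⟦ Γ ⟧ → List (List ℕ)} →
    Poly {Γ} {nat} M → Poly {Γ} {nat} K → Poly {Γ} {list (list nat)} rows →
    Poly {Γ} {OutTy} (λ γ → spannerTable (M γ) (K γ) (rows γ))
  spannerTableP {Γ} {M} {K} {rows} MP KP rowsP =
    pairP (pairP (sucP (sucP (addP MP (lengthP rowsP)))) (pairP edgesP (pairP (constP 2) (constP 1)))) KP
    where
    edgesP : Poly {Γ} {list EdgeTy} (λ γ → edgeTable (M γ) (K γ) (rows γ))
    edgesP = consP (pairP (constP 0) (pairP (constP 1) (pairP (constP 0) (constP 1))))
      (appendP (mapP (pairP (constP 0) (pairP (sucP (sucP sndP)) (pairP (constP 1) (constP 1)))) (upToP MP))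
      (appendP (mapP (pairP (constP 1) (pairP (sucP (sucP (addP (MP ∘P fstP) sndP)))
                       (pairP (sucP (KP ∘P fstP)) (constP 1)))) (upToP (lengthP rowsP)))
        (concatMapP
          (mapP (pairP (sucP (sucP sndP)) (pairP
                   (sucP (sucP (addP (MP ∘P fstP ∘P fstP) (fstP ∘P sndP ∘P fstP))))
                   (pairP (constP 0) (constP 1))))
                (sndP ∘P sndP))
          (indexP rowsP))))

  module _ {X Y : Set} (hits : Y → X → Bool) where

    row : List X → Y → List ℕ
    row xs y = concatMap (λ (i , x) → if hits y x then i ∷ [] else []) (indexFrom 0 xs)

    row-filter : ∀ xs y → row xs y ≡ map toℕ (filterᵇ (hits y ∘ List.lookup xs) (allFin (length xs)))
    row-filter xs y = trans (cong (concatMap _) (trans (indexFrom-tabulate 0 xs) (sym (map-tabulate id _))))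
                            (lemma (allFin (length xs)))
      where
      lemma : ∀ js → concatMap (λ (i , x) → if hits y x then i ∷ [] else []) (map (λ j → toℕ j , List.lookup xs j) js)
                     ≡ map toℕ (filterᵇ (hits y ∘ List.lookup xs) js)
      lemma []       = refl
      lemma (j ∷ js) with hits y (List.lookup xs j)
      ... | true  = cong (toℕ j ∷_) (lemma js)
      ... | false = lemma js

  indexFrom-map : ∀ {A B : Set} (f : A → B) i xs → indexFrom i (map f xs) ≡ map (λ (i , x) → i , f x) (indexFrom i xs)
  indexFrom-map f i []       = refl
  indexFrom-map f i (x ∷ xs) = cong ((i , f x) ∷_) (indexFrom-map f (suc i) xs)

  map-toℕ-allFin : ∀ n → map toℕ (allFin n) ≡ upTo n
  map-toℕ-allFin n = trans (map-tabulate id toℕ) (lemma id n)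
    where
    lemma : ∀ {A : Set} (f : ℕ → A) n → tabulate (f ∘ toℕ {n}) ≡ applyUpTo f n
    lemma f zero    = refl
    lemma f (suc n) = cong (f 0 ∷_) (lemma (f ∘ suc) n)

  module _ (I : HittingSet) where
    open HittingSet I

    edgeCode : Edge → ⟦ EdgeTy ⟧
    edgeCode e = toℕ (position (source e)) , toℕ (position (target e)) , logWeight e , 1

    spanner-input : ParamProblem.input Spanner instance′
                      ≡ enc OutTy ((2 + (M + C) , map edgeCode edges , 2 , 1) , K)
    spanner-input = cong (λ es → (unary (2 + (M + C)) ∙ es ∙ binary 3 ∙ binary 1) ∙ unary K)
      (trans (lemma (λ i → cong (λ w → unary (toℕ (position (source (edge i)))) ∙ unary (toℕ (position (target (edge i)))) ∙ w ∙ binary 1)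
                              (binary-2^∸1 (logWeight (edge i)))) (allFin _))
             (cong (enc (list EdgeTy)) (trans (map-tabulate id (edgeCode ∘ edge))
               (trans (sym (map-tabulate edge edgeCode)) (cong (map edgeCode) (tabulate-lookup edges))))))
      where
      lemma : ∀ {A : Set} {f : A → Tree} {g : A → ⟦ EdgeTy ⟧} → (∀ x → f x ≡ enc EdgeTy (g x)) →
              ∀ xs → codeList f xs ≡ enc (list EdgeTy) (map g xs)
      lemma eq []       = refl
      lemma eq (x ∷ xs) = cong₂ _∙_ (eq x) (lemma eq xs)

    edgeCode-mems : ∀ cs es → map edgeCode (filterᵇ present (cartesianProductWith mem cs es))
      ≡ concatMap (λ c → map (λ e → 2 + e , 2 + (M + toℕ c) , 0 , 1) (map toℕ (filterᵇ (hit c) es))) cs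
    edgeCode-mems []       es = refl
    edgeCode-mems (c ∷ cs) es = trans (cong (map edgeCode) (filter-++ (T? ∘ present) (map (mem c) es) _))
      (trans (map-++ edgeCode (filterᵇ present (map (mem c) es)) _) (cong₂ _++_ (single es) (edgeCode-mems cs es)))
      where
      single : ∀ es → map edgeCode (filterᵇ present (map (mem c) es))
                 ≡ map (λ e → 2 + e , 2 + (M + toℕ c) , 0 , 1) (map toℕ (filterᵇ (hit c) es))
      single []       = refl
      single (e ∷ es) with hit c e
      ... | true  = cong₂ _∷_ (cong₂ (λ x y → 2 + x , 2 + y , 0 , 1) (toℕ-↑ˡ e C) (toℕ-↑ʳ M c)) (single es)
      ... | false = single es

  module _ {X Y : Set} (xs : List X) (ys : List Y) (hits : Y → X → Bool) (K : ℕ)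
           (covered : ∀ {x} → x ∈ˡ xs → ∃[ y ] (y ∈ˡ ys × hits y x ≡ true)) where
    private
      I : HittingSet
      I = hittingSet xs ys hits K covered
      open HittingSet I using (M; C; sel; dir; mem; edges; present; hit)

    -- Computed separately for each kind of edge: filtering affects only the `mem` edges, and what
    -- remains of them for a clause is its row.
    edges-table : map (edgeCode I) edges ≡ edgeTable M K (map (row hits xs) ys)
    edges-table = cong ((0 , 1 , 0 , 1) ∷_) (begin
        map code (filterᵇ present (map sel (allFin M) ++ map dir (allFin C) ++ mems))
          ≡⟨ cong (map code) (trans (filter-++ P? (map sel (allFin M)) _) (cong₂ _++_ (keep sel (λ _ → refl) (allFin M))
               (trans (filter-++ P? (map dir (allFin C)) mems) (cong (_++ filterᵇ present mems) (keep dir (λ _ → refl) (allFin C)))))) ⟩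
        map code (map sel (allFin M) ++ map dir (allFin C) ++ filterᵇ present mems)
          ≡⟨ trans (map-++ code (map sel (allFin M)) _) (cong (map code (map sel (allFin M)) ++_) (map-++ code (map dir (allFin C)) _)) ⟩
        map code (map sel (allFin M)) ++ map code (map dir (allFin C)) ++ map code (filterᵇ present mems)
          ≡⟨ cong₂ _++_ sels (cong₂ _++_ dirs mems≡) ⟩
        _ ∎)
      where
      open ≡-Reasoning
      code = edgeCode I
      mems = cartesianProductWith mem (allFin C) (allFin M)
      P? = T? ∘ present
      rows : List (List ℕ)
      rows = map (row hits xs) ys
      keep : ∀ {A : Set} (f : A → HittingSet.Edge I) → (∀ x → present (f x) ≡ true) → ∀ xs →
             filterᵇ present (map f xs) ≡ map f xs
      keep f eq []       = refl
      keep f eq (x ∷ xs) rewrite eq x = cong (f x ∷_) (keep f eq xs)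
      sels : map code (map sel (allFin M)) ≡ map (λ e → 0 , 2 + e , 1 , 1) (upTo M)
      sels = begin
        map code (map sel (allFin M))                     ≡⟨ map-∘ (allFin M) ⟨
        map (code ∘ sel) (allFin M)                       ≡⟨ map-cong (λ e → cong (λ x → 0 , 2 + x , 1 , 1) (toℕ-↑ˡ e C)) (allFin M) ⟩
        map (λ e → 0 , 2 + toℕ e , 1 , 1) (allFin M)      ≡⟨ map-∘ (allFin M) ⟩
        map (λ e → 0 , 2 + e , 1 , 1) (map toℕ (allFin M)) ≡⟨ cong (map _) (map-toℕ-allFin M) ⟩
        map (λ e → 0 , 2 + e , 1 , 1) (upTo M)            ∎
      dirs : map code (map dir (allFin C)) ≡ map (λ c → 1 , 2 + (M + c) , suc K , 1) (upTo (length rows))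
      dirs = begin
        map code (map dir (allFin C))                     ≡⟨ map-∘ (allFin C) ⟨
        map (code ∘ dir) (allFin C)                       ≡⟨ map-cong (λ c → cong (λ x → 1 , 2 + x , suc K , 1) (toℕ-↑ʳ M c)) (allFin C) ⟩
        map (λ c → 1 , 2 + (M + toℕ c) , suc K , 1) (allFin C) ≡⟨ map-∘ (allFin C) ⟩
        map (λ c → 1 , 2 + (M + c) , suc K , 1) (map toℕ (allFin C)) ≡⟨ cong (map _) (map-toℕ-allFin C) ⟩
        map (λ c → 1 , 2 + (M + c) , suc K , 1) (upTo C)  ≡⟨ cong (map (λ c → 1 , 2 + (M + c) , suc K , 1) ∘ upTo) (length-map (row hits xs) ys) ⟨
        map (λ c → 1 , 2 + (M + c) , suc K , 1) (upTo (length rows)) ∎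
      mems≡ : map code (filterᵇ present mems)
                ≡ concatMap (λ (c , r) → map (λ e → 2 + e , 2 + (M + c) , 0 , 1) r) (indexFrom 0 rows)
      mems≡ = begin
        map code (filterᵇ present mems)
          ≡⟨ edgeCode-mems I (allFin C) (allFin M) ⟩
        concatMap (λ c → line (toℕ c) (map toℕ (filterᵇ (hit c) (allFin M)))) (allFin C)
          ≡⟨ concatMap-cong (λ c → cong (line (toℕ c)) (sym (row-filter hits xs (List.lookup ys c)))) (allFin C) ⟩
        concatMap (λ c → line (toℕ c) (row hits xs (List.lookup ys c))) (allFin C)
          ≡⟨ concatMap-map (λ (c , r) → line c r) (λ c → toℕ c , row hits xs (List.lookup ys c)) (allFin C) ⟨
        concatMap (λ (c , r) → line c r) (map (λ c → toℕ c , row hits xs (List.lookup ys c)) (allFin C))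
          ≡⟨ cong (concatMap (λ (c , r) → line c r)) (begin
               map (λ c → toℕ c , row hits xs (List.lookup ys c)) (allFin C)
                 ≡⟨ map-tabulate id _ ⟩
               tabulate (λ c → toℕ c , row hits xs (List.lookup ys c))
                 ≡⟨ map-tabulate (λ c → toℕ c , List.lookup ys c) (λ (i , y) → i , row hits xs y) ⟨
               map (λ (i , y) → i , row hits xs y) (tabulate (λ c → toℕ c , List.lookup ys c))
                 ≡⟨ cong (map _) (indexFrom-tabulate 0 ys) ⟨
               map (λ (i , y) → i , row hits xs y) (indexFrom 0 ys)
                 ≡⟨ indexFrom-map (row hits xs) 0 ys ⟨
               indexFrom 0 rows ∎) ⟩
        concatMap (λ (c , r) → line c r) (indexFrom 0 rows) ∎
        where
        line : ℕ → List ℕ → List ⟦ EdgeTy ⟧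
        line c r = map (λ e → 2 + e , 2 + (M + c) , 0 , 1) r

    hittingSet-input : ParamProblem.input Spanner (HittingSet.instance′ I)
                         ≡ enc OutTy (spannerTable M K (map (row hits xs) ys))
    hittingSet-input = trans (spanner-input I)
      (cong₂ (λ C es → enc OutTy ((2 + (M + C) , es , 2 , 1) , K)) (sym (length-map (row hits xs) ys)) edges-table)

-- Programs for the candidates, the clauses and the certificates.

module Programs where

  open PolynomialTime
  open Combinators
  open Chains
  open Certificates
  open import Data.Bool using (Bool; true; false; _∧_)
  open import Data.Fin as Fin using (Fin)
  open import Data.List using (List; []; _∷_; map; _++_; concatMap; cartesianProductWith)
  open import Data.Nat
  open import Data.Product using (_,_)
  open import Data.Vec as Vec using (Vec; []; _∷_; lookup)
  open import Function using (_∘_)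
  open import Relation.Binary.PropositionalEquality

  private variable
    a b c Γ : Ty
    d : ℕ

  cartesianProductWithP : {f : ⟦ (Γ ⊗ a) ⊗ b ⟧ → ⟦ c ⟧} {xs : ⟦ Γ ⟧ → List ⟦ a ⟧} {ys : ⟦ Γ ⟧ → List ⟦ b ⟧} →
    Poly {(Γ ⊗ a) ⊗ b} {c} f → Poly {Γ} {list a} xs → Poly {Γ} {list b} ys →
    Poly {Γ} {list c} (λ γ → cartesianProductWith (λ x y → f ((γ , x) , y)) (xs γ) (ys γ))
  cartesianProductWithP {f = f} {xs} {ys} P XS YS =
    Poly-cong (λ γ → lemma (λ x y → f ((γ , x) , y)) (xs γ) (ys γ)) (concatMapP (mapP P (YS ∘P fstP)) XS)
    where
    lemma : ∀ {A B C : Set} (f : A → B → C) xs ys →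
            concatMap (λ x → map (f x) ys) xs ≡ cartesianProductWith f xs ys
    lemma f []       ys = refl
    lemma f (x ∷ xs) ys = cong (map (f x) ys ++_) (lemma f xs ys)

  -- `d` is fixed outside the computation, so the `d`-th power of the length of the list remains
  -- polynomial.
  tuplesP : {D : ⟦ Γ ⟧ → List ⟦ a ⟧} → ∀ d → Poly {Γ} {list a} D → Poly {Γ} {list (vec a d)} (tuples d ∘ D)
  tuplesP zero    P = consP vnilP nilP
  tuplesP (suc d) P = cartesianProductWithP (vconsP (sndP ∘P fstP) sndP) P (tuplesP d P)

  eqVecP : {v w : ⟦ Γ ⟧ → Vec ℕ d} → Poly {Γ} {vec nat d} v → Poly {Γ} {vec nat d} w →
           Poly {Γ} {bool} (λ γ → eqVec (v γ) (w γ))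
  eqVecP {d = zero} {v} {w} P Q = Poly-cong (λ γ → lemma (v γ) (w γ)) trueP
    where
    lemma : ∀ (v w : Vec ℕ 0) → true ≡ eqVec v w
    lemma [] [] = refl
  eqVecP {d = suc d} {v} {w} P Q = Poly-cong (λ γ → lemma (v γ) (w γ))
    (andP (eqP (vheadP ∘P P) (vheadP ∘P Q)) (eqVecP (vtailP ∘P P) (vtailP ∘P Q)))
    where
    lemma : ∀ {d} (v w : Vec ℕ (suc d)) →
            (Vec.head v ≡ᵇ Vec.head w) ∧ eqVec (Vec.tail v) (Vec.tail w) ≡ eqVec v w
    lemma (_ ∷ _) (_ ∷ _) = refl

  iffP : {f g : ⟦ Γ ⟧ → Bool} → Poly {Γ} {bool} f → Poly {Γ} {bool} g → Poly {Γ} {bool} (λ γ → iffᵇ (f γ) (g γ))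
  iffP P Q = ifP P Q (notP Q)

  Pt : Ty
  Pt = nat ⊗ nat

  sameOrderP : {p q : ⟦ Γ ⟧ → Point} → Poly {Γ} {Pt} p → Poly {Γ} {Pt} q →
               Poly {Γ} {bool} (λ γ → sameOrder (p γ) (q γ))
  sameOrderP P Q = andP
    (iffP (ltP (fstP ∘P P) (fstP ∘P Q)) (ltP (sndP ∘P P) (sndP ∘P Q)))
    (iffP (ltP (fstP ∘P Q) (fstP ∘P P)) (ltP (sndP ∘P Q) (sndP ∘P P)))

  compatibleP : {e f : ⟦ Γ ⟧ → Vec Point d} → Poly {Γ} {vec Pt d} e → Poly {Γ} {vec Pt d} f →
                Poly {Γ} {bool} (λ γ → compatible (e γ) (f γ))
  compatibleP E F = allP (allP (sameOrderP (sndP ∘P fstP) sndP) (vtoListP (F ∘P fstP))) (vtoListP E)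

  slotP : {e : ⟦ Γ ⟧ → Vec Point d} → Poly {Γ} {vec Pt d} e → Poly {Γ} {vec nat d} (slot ∘ e)
  slotP {d = d} E = vmapP fstP d ∘P E

  valuesP : {e : ⟦ Γ ⟧ → Vec Point d} → Poly {Γ} {vec Pt d} e → Poly {Γ} {vec nat d} (values ∘ e)
  valuesP {d = d} E = vmapP sndP d ∘P E

  insideP : {k a : ⟦ Γ ⟧ → ℕ} {f : ⟦ Γ ⟧ → Vec Point d} → Poly {Γ} {nat} k → Poly {Γ} {vec Pt d} f →
            Poly {Γ} {nat} a → Poly {Γ} {bool} (λ γ → inside (k γ) (f γ) (a γ))
  insideP K F A = anyP
    (andP (ltP (constP 0) (fstP ∘P sndP)) (andP (ltP (fstP ∘P sndP) (sucP (K ∘P fstP))) (eqP (sndP ∘P sndP) (A ∘P fstP))))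
    (vtoListP F)

  outsideP : {a : ⟦ Γ ⟧ → ℕ} {f : ⟦ Γ ⟧ → Vec Point d} → Poly {Γ} {vec Pt d} f →
             Poly {Γ} {nat} a → Poly {Γ} {bool} (λ γ → outside (f γ) (a γ))
  outsideP F A = anyP (anyP
    (andP (eqP (fstP ∘P sndP) (sucP (fstP ∘P sndP ∘P fstP)))
      (andP (ltP (sndP ∘P sndP ∘P fstP) (A ∘P fstP ∘P fstP)) (ltP (A ∘P fstP ∘P fstP) (sndP ∘P sndP))))
    (vtoListP (F ∘P fstP))) (vtoListP F)

  relationAtP : ∀ τ R → Poly {relationsTy τ} {list (vec nat (arity τ R))} (λ rels → relationAt τ rels R)
  relationAtP (r ∷ τ) Fin.zero    = fstP
  relationAtP (r ∷ τ) (Fin.suc R) = relationAtP τ R ∘P sndP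

  lookupsP : ∀ {v r} (xs : Vec (Fin v) r) → Poly {vec nat v} {vec nat r} (λ ρ → Vec.map (lookup ρ) xs)
  lookupsP []       = vnilP
  lookupsP (x ∷ xs) = vconsP (vlookupP x) (lookupsP xs)

  rankP : {n : ⟦ Γ ⟧ → ℕ} {v : ⟦ Γ ⟧ → Vec ℕ d} → Poly {Γ} {nat} n → Poly {Γ} {vec nat d} v →
          Poly {Γ} {nat} (λ γ → rank (n γ) (v γ))
  rankP {d = zero} {n} {v} NP V = Poly-cong (λ γ → lemma (v γ)) zeroP
    where
    lemma : ∀ {m} (v : Vec ℕ 0) → 0 ≡ rank m v
    lemma [] = refl
  rankP {d = suc d} {n} {v} NP V = Poly-cong (λ γ → lemma (v γ))
    (addP (mulP (powP NP d) (vheadP ∘P V)) (rankP NP (vtailP ∘P V)))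
    where
    lemma : ∀ {m} (v : Vec ℕ (suc d)) → m ^ d * Vec.head v + rank m (Vec.tail v) ≡ rank m v
    lemma (_ ∷ _) = refl

  module _ {τ : Vocabulary} {s : ℕ} where

    -- The recursion on φ takes place outside the computation: the formula is not part of the input,
    -- and the degree may depend on it.
    certP : ∀ {n k : ⟦ Γ ⟧ → ℕ} {rels : ⟦ Γ ⟧ → ⟦ relationsTy τ ⟧} {v} {ρ : ⟦ Γ ⟧ → Vec ℕ v} {f : ⟦ Γ ⟧ → Vec Point d} →
      Poly {Γ} {nat} n → Poly {Γ} {nat} k → Poly {Γ} {relationsTy τ} rels →
      Poly {Γ} {vec nat v} ρ → Poly {Γ} {vec Pt d} f → ∀ b (φ : QF τ s v) →
      Poly {Γ} {bool} (λ γ → cert b φ (n γ) (k γ) (rels γ) (ρ γ) (f γ))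
    certP N K RS ρP F b (relₐ R xs) =
      iffP (boolP b) (anyP (eqVecP sndP (lookupsP xs ∘P ρP ∘P fstP)) (relationAtP τ R ∘P RS))
      where
      boolP : ∀ {Γ} b → Poly {Γ} {bool} (λ _ → b)
      boolP true  = trueP
      boolP false = falseP
    certP N K RS ρP F true  (eqₐ x y)  = eqP (vlookupP x ∘P ρP) (vlookupP y ∘P ρP)
    certP N K RS ρP F false (eqₐ x y)  = notP (eqP (vlookupP x ∘P ρP) (vlookupP y ∘P ρP))
    certP N K RS ρP F true  (Xₐ xs)    = insideP K F (sucP (rankP N (lookupsP xs ∘P ρP)))
    certP N K RS ρP F false (Xₐ xs)   = outsideP F (sucP (rankP N (lookupsP xs ∘P ρP)))
    certP N K RS ρP F true  (notₐ φ)   = certP N K RS ρP F false φ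
    certP N K RS ρP F false (notₐ φ)   = certP N K RS ρP F true φ
    certP N K RS ρP F true  (andₐ φ ψ) = andP (certP N K RS ρP F true φ) (certP N K RS ρP F true ψ)
    certP N K RS ρP F false (andₐ φ ψ) = orP (certP N K RS ρP F false φ) (certP N K RS ρP F false ψ)
    certP N K RS ρP F true  (orₐ φ ψ)  = orP (certP N K RS ρP F true φ) (certP N K RS ρP F true ψ)
    certP N K RS ρP F false (orₐ φ ψ)  = andP (certP N K RS ρP F false φ) (certP N K RS ρP F false ψ)

-- The reduction from weighted Fagin definability to spanners.

module Hardness where

  open PolynomialTime
  open Combinators
  open Reductions
  open HittingSets
  open Chains
  open Certificates
  open Tables
  open Programs
  open import Data.Bool using (Bool; true)
  open import Data.Fin as Fin using (Fin)
  open import Data.List using (List; []; _∷_; length; map; _++_; upTo; tabulate; cartesianProductWith)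
  open import Data.List.Properties
  open import Data.Nat
  open import Data.Nat.Properties
  open import Data.Product using (_×_; _,_)
  open import Data.Vec using (Vec; []; _∷_; toList)
  open import Function using (_∘_; _⇔_; mk⇔)
  open import Function.Construct.Composition using (_⇔-∘_)
  open import Relation.Binary.PropositionalEquality

  InTy : Vocabulary → Ty
  InTy τ = (nat ⊗ relationsTy τ) ⊗ nat

  -- Stated for any `code` that agrees with the intended one, so that the induction can pass to the
  -- rest of the vocabulary.
  relationsOf-code : ∀ τ {n} (rel : (R : Symbol τ) → List (Vec (Fin n) (arity τ R))) (code : Symbol τ → Tree) →
    (∀ R → code R ≡ codeList (codeList codeFin ∘ toList) (rel R)) →
    enc (relationsTy τ) (relationsOf τ rel) ≡ codeList (λ t → t) (tabulate code)
  relationsOf-code []      rel code eq = refl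
  relationsOf-code (r ∷ τ) rel code eq = cong₂ _∙_
    (trans (lemma (rel Fin.zero)) (sym (eq Fin.zero)))
    (relationsOf-code τ (rel ∘ Fin.suc) (code ∘ Fin.suc) (eq ∘ Fin.suc))
    where
    tuple-code : ∀ {n r} (t : Vec (Fin n) r) → enc (vec nat r) (nums t) ≡ codeList codeFin (toList t)
    tuple-code []      = refl
    tuple-code (x ∷ t) = cong (codeFin x ∙_) (tuple-code t)
    lemma : ∀ {n r} (ts : List (Vec (Fin n) r)) →
            enc (list (vec nat r)) (map nums ts) ≡ codeList (codeList codeFin ∘ toList) ts
    lemma []       = refl
    lemma (t ∷ ts) = cong₂ _∙_ (tuple-code t) (lemma ts)

  Target : ParamProblem
  Target = restrict Spanner (Restricted α₃)

  map-cartesianProductWith : ∀ {A B C D : Set} (g : C → D) (f : A → B → C) xs ys →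
    map g (cartesianProductWith f xs ys) ≡ cartesianProductWith (λ x y → g (f x y)) xs ys
  map-cartesianProductWith g f []       ys = refl
  map-cartesianProductWith g f (x ∷ xs) ys = trans (map-++ g (map (f x) ys) _)
    (cong₂ _++_ (sym (map-∘ ys)) (map-cartesianProductWith g f xs ys))

  abstract
    toTarget : HittingSet → ParamProblem.Instance Target
    toTarget h = HittingSet.instance′ h , HittingSet.restricted h

    toTarget-correct : ∀ h → HittingSet.Solvable h ⇔ ParamProblem.Yes Target (toTarget h)
    toTarget-correct h = mk⇔ (HittingSet.solvable⇒spanner h) (HittingSet.spanner⇒solvable h)

    toTarget-param : ∀ h → ParamProblem.param Target (toTarget h) ≡ HittingSet.K h
    toTarget-param h = refl

    -- `Clause` is not among the coded types, so the row of a clause is produced directly from the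
    -- pair of `e` and `J` or from the requirement `x`.
    chainTable : ∀ {P : Set} (k N d : ℕ) (reqs : List P) (test : P → Vec Point (suc d) → Bool) → ⟦ OutTy ⟧
    chainTable k N d reqs test = spannerTable (length elements) (length slots)
      (cartesianProductWith (λ e J → row (hits test) elements (link e J)) elements slots
        ++ map (λ x → row (hits test) elements (require x)) reqs)
      where open Grid k N d

    chainTable-code : ∀ {P : Set} (k N d : ℕ) (reqs : List P) (test : P → Vec Point (suc d) → Bool) →
      enc OutTy (chainTable k N d reqs test)
        ≡ ParamProblem.input Target (toTarget (chainHittingSet k N d reqs test))
    chainTable-code k N d reqs test = trans (cong (λ rs → enc OutTy (spannerTable (length elements) (length slots) rs)) (sym rows≡))
      (sym (hittingSet-input elements (clauses k N d reqs test) (hits test) (length slots) (elements-covered k N d reqs test)))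
      where
      open Grid k N d
      rows≡ : map (row (hits test) elements) (clauses k N d reqs test)
        ≡ cartesianProductWith (λ e J → row (hits test) elements (link e J)) elements slots
          ++ map (λ x → row (hits test) elements (require x)) reqs
      rows≡ = trans (map-++ (row (hits test) elements) (cartesianProductWith link elements slots) (map require reqs))
        (cong₂ _++_ (map-cartesianProductWith _ link elements slots) (sym (map-∘ reqs)))

  module _ {τ : Vocabulary} {s : ℕ} (φ : Π₂ τ s) where
    open Π₂ φ

    private
      d : ℕ
      d = width matrix

    decodeInput : Structure τ × ℕ → ⟦ InTy τ ⟧
    decodeInput (A , k) = (suc pred-size , relationsOf τ relation) , k
      where open Structure A

    decodeInput-code : ∀ I → enc (InTy τ) (decodeInput I) ≡ ParamProblem.input (p-WD φ) I
    decodeInput-code (A , k) = cong (λ t → (unary (suc pred-size) ∙ t) ∙ unary k)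
      (relationsOf-code τ relation _ (λ _ → refl))
      where open Structure A

    elementList : ⟦ InTy τ ⟧ → List (Vec Point (suc d))
    elementList ((n , _) , k) = Grid.elements k (n ^ s) d

    slotList : ⟦ InTy τ ⟧ → List (Vec ℕ (suc d))
    slotList ((n , _) , k) = Grid.slots k (n ^ s) d

    requirements : ⟦ InTy τ ⟧ → List (Vec ℕ p)
    requirements ((n , _) , k) = tuples p (upTo n)

    hit? : ⟦ InTy τ ⟧ → Clause (Vec ℕ p) d → Vec Point (suc d) → Bool
    hit? ((n , rels) , k) = hits (passes φ n k rels)

    build : ⟦ InTy τ ⟧ → ⟦ OutTy ⟧
    build γ@((n , rels) , k) = chainTable k (n ^ s) d (requirements γ) (passes φ n k rels)

    private
      nP : Poly {InTy τ} {nat} (λ ((n , _) , _) → n)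
      nP = fstP ∘P fstP

      relsP : Poly {InTy τ} {relationsTy τ} (λ ((_ , rels) , _) → rels)
      relsP = sndP ∘P fstP

      kP : Poly {InTy τ} {nat} (λ (_ , k) → k)
      kP = sndP

      elementsP : Poly {InTy τ} {list (vec Pt (suc d))} elementList
      elementsP = tuplesP (suc d) (cartesianProductWithP {Γ = InTy τ} {a = nat} {b = nat}
        (pairP (sndP ∘P fstP) sndP) (upToP (sucP (sucP kP))) (upToP (sucP (sucP (powP nP s)))))

      slotsP : Poly {InTy τ} {list (vec nat (suc d))} slotList
      slotsP = tuplesP (suc d) (upToP (sucP (sucP kP)))

      requirementsP : Poly {InTy τ} {list (vec nat p)} requirements
      requirementsP = tuplesP p (upToP nP)

      rowP : ∀ {Γ} {γ : ⟦ Γ ⟧ → ⟦ InTy τ ⟧} {c : ⟦ Γ ⟧ → Clause (Vec ℕ p) d} → Poly {Γ} {InTy τ} γ →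
        Poly {Γ ⊗ (nat ⊗ vec Pt (suc d))} {bool} (λ (ξ , i , f) → hit? (γ ξ) (c ξ) f) →
        Poly {Γ} {list nat} (λ ξ → row (hit? (γ ξ)) (elementList (γ ξ)) (c ξ))
      rowP G H = concatMapP (ifP H (consP (fstP ∘P sndP) nilP) nilP) (indexP (elementsP ∘P G))

      linkP : Poly {(InTy τ ⊗ vec Pt (suc d)) ⊗ vec nat (suc d)} {list nat}
                (λ ((γ , e) , J) → row (hit? γ) (elementList γ) (link e J))
      linkP = rowP {c = λ ((_ , e) , J) → link e J} (fstP ∘P fstP) (orP
        (andP (eqVecP (slotP fP) (slotP eP)) (notP (eqVecP (valuesP fP) (valuesP eP))))
        (andP (eqVecP (slotP fP) JP) (compatibleP eP fP)))
        where
        Ξ : Ty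
        Ξ = ((InTy τ ⊗ vec Pt (suc d)) ⊗ vec nat (suc d)) ⊗ (nat ⊗ vec Pt (suc d))
        fP : Poly {Ξ} {vec Pt (suc d)} (λ (_ , _ , f) → f)
        fP = sndP ∘P sndP
        eP : Poly {Ξ} {vec Pt (suc d)} (λ (((_ , e) , _) , _) → e)
        eP = sndP ∘P fstP ∘P fstP
        JP : Poly {Ξ} {vec nat (suc d)} (λ ((_ , J) , _) → J)
        JP = sndP ∘P fstP

      requireP : Poly {InTy τ ⊗ vec nat p} {list nat} (λ (γ , x) → row (hit? γ) (elementList γ) (require x))
      requireP = rowP {c = λ (_ , x) → require x} fstP (anyP
        (certP (nP ∘P γP) (kP ∘P γP) (relsP ∘P γP) (vappendP (sndP ∘P fstP ∘P fstP) sndP) (sndP ∘P sndP ∘P fstP) true matrix)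
        (tuplesP q (upToP (nP ∘P fstP ∘P fstP))))
        where
        γP : Poly {((InTy τ ⊗ vec nat p) ⊗ (nat ⊗ vec Pt (suc d))) ⊗ vec nat q} {InTy τ} (λ (((γ , _) , _) , _) → γ)
        γP = fstP ∘P fstP ∘P fstP

    abstract
      buildP : Poly {InTy τ} {OutTy} build
      buildP = spannerTableP (lengthP elementsP) (lengthP slotsP)
        (appendP (cartesianProductWithP linkP elementsP slotsP) (mapP requireP requirementsP))

    build-code : ∀ I → enc OutTy (build (decodeInput I)) ≡ ParamProblem.input Target (toTarget (wdHittingSet φ I))
    build-code (A , k) =
      chainTable-code k (suc pred-size ^ s) d (tuples p (upTo (suc pred-size))) (passes φ (suc pred-size) k (relationsOf τ relation))
      where open Structure A

    -- The new parameter is the number of slots, `(2 + k) ^ suc d`. As `d` depends on φ only, this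
    -- is a function of `k`, whatever the structure is.
    ≤fpt-spanner : ∀ {P} → P ≤fpt p-WD φ → P ≤fpt Target
    ≤fpt-spanner P≤WD = ≤fpt-trans-poly P≤WD buildP {λ k → (2 + k) ^ suc d} (powP (sucP (sucP idP)) (suc d))
      (toTarget ∘ wdHittingSet φ) decodeInput
      (λ I → toTarget-correct (wdHittingSet φ I) ⇔-∘ wd-correct φ I)
      (λ m≤n → ^-monoˡ-≤ (suc d) (+-monoʳ-≤ 2 m≤n))
      (λ I@(A , k) → ≤-reflexive (trans (toTarget-param (wdHittingSet φ I)) (trans (length-tuples {D = upTo (2 + k)} (suc d)) (cong (_^ suc d) (length-upTo (2 + k))))))
      decodeInput-code build-code

open Reductions
open HittingSets
open Hardness
open import Data.Product using (_×_; _,_; ∃-syntax)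
open import Data.Rational using (1ℚ; _≤_)

theorem9 : W[2]-Hard Spanner × ∃[ α ] (1ℚ ≤ α × W[2]-Hard (restrict Spanner (Restricted α)))
theorem9 = (λ P P∈W[2] → forget-restriction (hard P P∈W[2])) , α₃ , 1≤α₃ , hard
  where
  hard : W[2]-Hard (restrict Spanner (Restricted α₃))
  hard P (τ , s , φ , P≤WD) = ≤fpt-spanner φ P≤WD
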